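{- Let $n\ge2$, $w\in \mathcal D_n$ and $k\geq 0$. Then the $k$-truncation $\mathfrak D_w^{[k]}(\mathbf z,\mathbf x)$ of the type $D$ Schubert polynomial $\mathfrak D_w(\mathbf z,\mathbf x)$ is equal to the sum of monomials over all reduced $d$-signed pipe dreams in $\mathrm{PD}_{\mathcal D_n}^k(w)$: \[ \sum_{D\in\mathrm{PD}_{\mathcal D_n}^k(w)}\mathbf x^{\alpha(D)}\mathbf z^{\beta(D)}=\sum_{\substack{u v=w\\ \ell(u)+\ell(v)=\ell(w) \\ v \in \mathcal S_{n}}}\ \sum_{\substack{\mathbf a \in R(u)\\ \mathbf x^{\alpha} \in \mathscr A_{x}(\mathbf{a})\\\alpha_{k+1}=\alpha_{k+2}=\ldots=0}}\ \sum_{\substack{\mathbf b \in R(v)\\ \mathbf z^{\beta} \in \mathscr A_{z}(\mathbf b)}} 2^{i(\alpha)-o(\mathbf a)} \mathbf x^{\alpha} \mathbf z^{\beta}=\mathfrak D_w^{[k]}(\mathbf z,\mathbf x). \]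
   Context: **Groups.** $\mathcal D_n$ is the group of permutations $w$ of $\{\pm1,\dots,\pm n\}$ with $w(-i)=-w(i)$ and with an even number of $i\in\{1,\dots,n\}$ such that $w(i)<0$. Its generators are $s_i=(i\leftrightarrow i+1)$ (also exchanging $-i,-(i+1)$), $1\le i\le n-1$, and $s_{\hat 1}$ defined by $1\mapsto-2$, $2\mapsto -1$, fixing $3,\dots,n$. Products are compositions of maps, $(uv)(i)=u(v(i))$. $\mathcal S_n\subset\mathcal D_n$ is the symmetric group generated by $s_1,\dots,s_{n-1}$. $\ell$ is the Coxeter length with respect to these generators, $R(w)$ the set of reduced words of $w$; $\mathcal D_\infty=\bigcup_n\mathcal D_n$. **Schubert polynomials of type $D$.** Let $\mathbb Q[\mathbf z,p_1(\mathbf x),p_3(\mathbf x),\dots]$ be the ring of polynomials in $z_1,z_2,\dots$ and the odd power sums $p_k(\mathbf x)=\sum_{i\ge1}x_i^k$ (algebraically independent generators). $\mathcal D_\infty$ acts on it by ring automorphisms: $s_i$ ($i\ge1$) exchanges $z_i$ and $z_{i+1}$ and fixes each $p_k(\mathbf x)$; $s_{\hat1}$ sends $z_1\mapsto -z_2$, $z_2\mapsto-z_1$, fixes $z_j$ ($j\ge 3$), and sends $p_k(\mathbf x)\mapsto p_k(\mathbf x)+z_1^k+z_2^k$. Put $\partial_if=\frac{f-s_if}{z_i-z_{i+1}}$ ($i\ge1$), $\partial_{\hat1}f=\frac{f-s_{\hat1}f}{ -z_1-z_2}$. The polynomials $\mathfrak D_w$, $w\in\mathcal D_\infty$, are the unique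 homogeneous elements ($\deg z_i=1$, $\deg p_k(\mathbf x)=k$) with $\mathfrak D_{\mathrm{id}}=1$ and, for all $i\in\{\hat1,1,2,\dots\}$, $\partial_i\mathfrak D_w=\mathfrak D_{ws_i}$ if $\ell(ws_i)<\ell(w)$ and $\partial_i\mathfrak D_w=0$ otherwise (existence and uniqueness are due to Billey and Haiman). The $k$-truncation is $\mathfrak D_w^{[k]}(\mathbf z,\mathbf x)=\mathfrak D_w(\mathbf z;x_1,\dots,x_k,0,0,\dots)$. **Admissible monomials.** Let $\mathbf a=s_{a_1}\cdots s_{a_l}$ be a reduced word. Its peak set is $P(\mathbf a)=\{i\in\{2,\dots,l-1\}: a_{i-1}<a_i>a_{i+1}\}$, where for comparisons $\hat1=1<2<3<\cdots$. A sequence of positive integers $j_1\ge\dots\ge j_l$ is $x$-admissible for $\mathbf a$ if $j_{i-1}=j_i=j_{i+1}$ implies $i\notin P(\mathbf a)$; $\mathscr A_x(\mathbf a)$ is the set of monomials $\mathbf x^\alpha=x_{j_1}\cdots x_{j_l}$ of such sequences. If $\mathbf a$ is a reduced word of an element of $\mathcal S_n$ (in $s_1,\dots,s_{n-1}$), a sequence of positive integers $j_1\le\dots\le j_l$ is $z$-admissible for $\mathbf a$ if $j_i\le a_i$ for all $i$ and $j_i=j_{i+1}$ implies $a_i>a_{i+1}$; $\mathscr A_z(\mathbf a)$ is the set of monomials $\mathbf z^\beta=z_{j_1}\cdots z_{j_l}$ of such sequences. $i(\alpha)$ is the number of distinct variables occurring in $\mathbf x^\alpha$ with nonzero exponent;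 $o(\mathbf a)$ is the total number of occurrences of the letters $s_1$ and $s_{\hat1}$ in $\mathbf a$. **$d$-signed pipe dreams.** The base $B^k_{\mathcal D_n}$ consists of a staircase block and $k$ $\Gamma$-blocks numbered $1,\dots,k$ from bottom to top, all lying above the staircase block. The staircase block has boxes $(i,j)$, $1\le i\le n-1$, $1\le j\le n-i$ (row $i$ from the top, column $j$ from the left); the box $(i,j)$ is indexed by $i+j-1$ and has variable $z_i$. Each $\Gamma$-block has a corner box indexed by the symbol $1'$, boxes indexed $2,\dots,n-1$ from left to right in the same row as the corner and to its right (together with the corner: the horizontal part), and boxes indexed $2,\dots,n-1$ from top to bottom in a column below the corner (together with the corner: the vertical part); all boxes of the $m$-th $\Gamma$-block have variable $x_m$. A $d$-signed pipe dream $D$ is a filling of the base in which each corner $1'$ contains one of four elements: an elbow (weight $0$, no letter), a cross (weight $1$, letter $s_1$), a cross with a faucet (weight $1$, letter $s_{\hat1}$), an elbow with two faucets (weight $2$, the two commuting letters $s_1,s_{\hat1}$ in either order); every other box, of index $i$, contains either an elbow (weight $0$, no letter) or a cross (weight $1$, letter $s_i$). The words of $D$ are obtained by reading the letters from top to bottom and in each row from right to left: i.e. the $\Gamma$-blocks $k,k-1,\dots,1$, in each of them first the horizontal boxes $n-1,\dots,2$, then the corner, then the vertical boxes $2,\dots,n-1$; then the staircase rows $1,\dots,n-1$, each from right to left; for each elbow with two faucets one may choose the order of its two letters, so if there are $r(D)$ such elbows one gets $2^{r(D)}$ words, all representing the same group element. $\mathbf x^{\alpha(D)}\mathbf z^{\beta(D)}$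 is the product over all boxes of the variable of the box raised to the weight of its element. $D$ is reduced of shape $w$ if its words are reduced words of $w\in\mathcal D_n$; $\mathrm{PD}^k_{\mathcal D_n}(w)$ is the set of reduced $d$-signed pipe dreams with $k$ $\Gamma$-blocks of shape $w$. -}

module Defs where

open import Algebra.Bundles using (CommutativeRing)
open import Data.Bool using (if_then_else_)
open import Data.Empty using (⊥-elim)
open import Data.Fin as Fin using (Fin; zero; suc; toℕ; fromℕ; fromℕ<; inject₁)
import Data.Fin.Properties as Fin
import Data.Fin.Permutation.Components as PC
open import Data.Integer using (+_)
open import Data.List as List using
  (List; []; _∷_; _++_; length; map; foldr; filter; mapMaybe; concatMap; reverse;
   cartesianProduct; cartesianProductWith; deduplicate; replicate; zip; allFin)
open import Data.List.Membership.Propositional using (_∈_; find; lose)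
open import Data.List.Membership.Propositional.Properties using
  (∈-cartesianProductWith⁺; ∈-cartesianProductWith⁻; ∈-allFin; ∈-map⁺)
open import Data.List.Relation.Unary.All as All using (All; []; _∷_)
open import Data.List.Relation.Unary.Any using (Any; here; there; any?)
open import Data.List.Relation.Unary.Linked using (Linked; linked?)
open import Data.Maybe using (Maybe; just; nothing)
open import Data.Nat as ℕ using (ℕ; zero; suc; _+_; _*_; _∸_; _^_; _≤_; _<_; z≤n; s≤s)
import Data.Nat.Properties as ℕ
open import Data.Nat.ListAction using (sum)
open import Data.Nat.Divisibility using (_∣_; _∣?_; divides; ∣m+n∣m⇒∣n; ∣-refl; ∣m∣n⇒∣m+n; ∣1⇒≡1)
open import Data.Product using (Σ; ∃; _×_; _,_; proj₁; proj₂)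
open import Data.Rational as ℚ using (ℚ; 0ℚ; 1ℚ)
open import Data.Sign as Sign using (Sign; opposite)
import Data.Sign.Properties as Sign
open import Data.Sum using (inj₁; inj₂)
open import Data.Unit using (⊤; tt)
open import Data.Vec as Vec using (Vec; []; _∷_; lookup; tabulate)
import Data.Vec.Properties as Vec
open import Function using (_∘_; id; Bijective; Injective; StrictlySurjective; mk⤖; _↔_)
open import Function.Consequences.Propositional using (strictlySurjective⇒surjective)
import Function.Construct.Composition as Comp
open import Function.Properties.Bijection using (⤖⇒↔)
open import Level using (0ℓ)
open import Relation.Binary.PropositionalEquality as ≡ using
  (_≡_; _≢_; refl; sym; trans; cong; cong₂; subst)
open import Relation.Nullary using (Dec; yes; no; ¬_; ¬?; _×-dec_; _→-dec_; does)
open import Relation.Nullary.Decidable using (map′; recompute; dec-true; dec-false)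

open import Algebra.Properties.CommutativeMonoid.Sum Sign.*-commutativeMonoid using ()
  renaming (sum to ∏ˢ; ∑-distrib-+ to ∏ˢ-distrib; sum-permute to ∏ˢ-permute; sum-cong-≗ to ∏ˢ-cong)

-- Poly V with _≈_ is the free commutative ℚ-algebra on V, i.e. ℚ[V].

infixl 6 _⊕_
infixl 7 _⊗_
infix  8 ⊝_
infix  4 _≈_

data Poly (V : Set) : Set where
  con : ℚ → Poly V
  var : V → Poly V
  _⊕_ : Poly V → Poly V → Poly V
  _⊗_ : Poly V → Poly V → Poly V
  ⊝_  : Poly V → Poly V

data _≈_ {V : Set} : Poly V → Poly V → Set where
  ≈-refl  : ∀ {f} → f ≈ f
  ≈-sym   : ∀ {f g} → f ≈ g → g ≈ f
  ≈-trans : ∀ {f g h} → f ≈ g → g ≈ h → f ≈ h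
  ⊕-cong  : ∀ {f f′ g g′} → f ≈ f′ → g ≈ g′ → f ⊕ g ≈ f′ ⊕ g′
  ⊗-cong  : ∀ {f f′ g g′} → f ≈ f′ → g ≈ g′ → f ⊗ g ≈ f′ ⊗ g′
  ⊝-cong  : ∀ {f f′} → f ≈ f′ → ⊝ f ≈ ⊝ f′
  ⊕-assoc : ∀ f g h → (f ⊕ g) ⊕ h ≈ f ⊕ (g ⊕ h)
  ⊕-comm  : ∀ f g → f ⊕ g ≈ g ⊕ f
  ⊕-identityˡ : ∀ f → con 0ℚ ⊕ f ≈ f
  ⊝-inverseˡ  : ∀ f → ⊝ f ⊕ f ≈ con 0ℚ
  ⊗-assoc : ∀ f g h → (f ⊗ g) ⊗ h ≈ f ⊗ (g ⊗ h)
  ⊗-comm  : ∀ f g → f ⊗ g ≈ g ⊗ f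
  ⊗-identityˡ : ∀ f → con 1ℚ ⊗ f ≈ f
  ⊗-distribˡ-⊕ : ∀ f g h → f ⊗ (g ⊕ h) ≈ f ⊗ g ⊕ f ⊗ h
  con-⊕ : ∀ p q → con (p ℚ.+ q) ≈ con p ⊕ con q
  con-⊗ : ∀ p q → con (p ℚ.* q) ≈ con p ⊗ con q

polyRing : Set → CommutativeRing 0ℓ 0ℓ
polyRing V = record
  { Carrier = Poly V ; _≈_ = _≈_ ; _+_ = _⊕_ ; _*_ = _⊗_ ; -_ = ⊝_
  ; 0# = con 0ℚ ; 1# = con 1ℚ
  ; isCommutativeRing = record
    { isRing = record
      { +-isAbelianGroup = record
        { isGroup = record
          { isMonoid = record
            { isSemigroup = record
              { isMagma = record
                { isEquivalence = record { refl = ≈-refl ; sym = ≈-sym ; trans = ≈-trans }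
                ; ∙-cong = ⊕-cong }
              ; assoc = ⊕-assoc }
            ; identity = ⊕-identityˡ , λ f → ≈-trans (⊕-comm _ _) (⊕-identityˡ f) }
          ; inverse = ⊝-inverseˡ , λ f → ≈-trans (⊕-comm _ _) (⊝-inverseˡ f)
          ; ⁻¹-cong = ⊝-cong }
        ; comm = ⊕-comm }
      ; *-cong = ⊗-cong
      ; *-assoc = ⊗-assoc
      ; *-identity = ⊗-identityˡ , λ f → ≈-trans (⊗-comm _ _) (⊗-identityˡ f)
      ; distrib = ⊗-distribˡ-⊕ , λ f g h →
          ≈-trans (⊗-comm _ _) (≈-trans (⊗-distribˡ-⊕ f g h) (⊕-cong (⊗-comm _ _) (⊗-comm _ _)))
      }
    ; *-comm = ⊗-comm } }

infixl 6 _⊖_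
_⊖_ : ∀ {V} → Poly V → Poly V → Poly V
f ⊖ g = f ⊕ ⊝ g

∑ ∏ : ∀ {V} {A : Set} → List A → (A → Poly V) → Poly V
∑ as f = foldr (λ a → f a ⊕_) (con 0ℚ) as
∏ as f = foldr (λ a → f a ⊗_) (con 1ℚ) as

infixr 9 _↑_
_↑_ : ∀ {V} → Poly V → ℕ → Poly V
f ↑ e = ∏ (replicate e f) id

substitute : ∀ {V W} → (V → Poly W) → Poly V → Poly W
substitute σ (con q) = con q
substitute σ (var v) = σ v
substitute σ (f ⊕ g) = substitute σ f ⊕ substitute σ g
substitute σ (f ⊗ g) = substitute σ f ⊗ substitute σ g
substitute σ (⊝ f)   = ⊝ substitute σ f

-- A term (c , m) stands for c times the product of the variables listed in m.
Homogeneous : ∀ {V} → (V → ℕ) → ℕ → Poly V → Set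
Homogeneous {V} deg d f = Σ (List (ℚ × List V)) λ ts →
  All (λ (c , m) → sum (map deg m) ≡ d) ts × f ≈ ∑ ts (λ (c , m) → con c ⊗ ∏ m var)

-- (σ , i) : ± n is the element σ(i+1) of {±1,…,±n}.
± : ℕ → Set
± n = Sign × Fin n

_≟±_ : ∀ {n} (x y : ± n) → Dec (x ≡ y)
(σ , i) ≟± (τ , j) = map′ (λ (p , q) → cong₂ _,_ p q) (λ { refl → refl , refl })
                          ((σ Sign.≟ τ) ×-dec (i Fin.≟ j))

-- The map w of {±1,…,±n} with w(-i) = -w(i) and given values [w(1),…,w(n)].
oddMap : ∀ {n} → Vec (± n) n → ± n → ± n
oddMap v (σ , i) = (σ Sign.* proj₁ (lookup v i)) , proj₂ (lookup v i)

negatives : ∀ {n m} → Vec (± n) m → ℕ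
negatives = Vec.count (λ x → proj₁ x Sign.≟ Sign.-)

record 𝒟 (n : ℕ) : Set where
  constructor mk𝒟
  field
    window     : Vec (± n) n
    .bijective : Bijective _≡_ _≡_ (oddMap window)
    .even      : 2 ∣ negatives window

open 𝒟 public

infixl 20 _⟨_⟩
_⟨_⟩ : ∀ {n} → 𝒟 n → ± n → ± n
w ⟨ x ⟩ = oddMap (window w) x

window-injective : ∀ {n} {u v : 𝒟 n} → window u ≡ window v → u ≡ v
window-injective refl = refl

_≟𝒟_ : ∀ {n} (u v : 𝒟 n) → Dec (u ≡ v)
u ≟𝒟 v = map′ window-injective (cong window) (Vec.≡-dec _≟±_ (window u) (window v))

private
  variable
    n : ℕ

  all±? : {P : ± n → Set} → (∀ x → Dec (P x)) → Dec (∀ x → P x)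
  all±? P? = map′ (λ { (p , q) (Sign.+ , i) → p i ; (p , q) (Sign.- , i) → q i })
                  (λ f → (λ i → f _) , (λ i → f _))
                  (Fin.all? (λ i → P? (Sign.+ , i)) ×-dec Fin.all? (λ i → P? (Sign.- , i)))

  any±? : {P : ± n → Set} → (∀ x → Dec (P x)) → Dec (∃ P)
  any±? {n} {P} P? with Fin.any? (λ i → P? (Sign.+ , i)) | Fin.any? (λ i → P? (Sign.- , i))
  ... | yes (i , p) | _           = yes (_ , p)
  ... | no _        | yes (i , p) = yes (_ , p)
  ... | no ¬p       | no ¬q       = no λ { ((Sign.+ , i) , p) → ¬p (i , p)
                                         ; ((Sign.- , i) , p) → ¬q (i , p) }

bijective? : (f : ± n → ± n) → Dec (Bijective _≡_ _≡_ f)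
bijective? f = map′ (λ (inj , sur) → (λ {x} {y} → inj x y) , strictlySurjective⇒surjective sur)
                    (λ (inj , sur) → (λ x y → inj) , λ y → proj₁ (sur y) , proj₂ (sur y) refl)
  (all±? (λ x → all±? λ y → (f x ≟± f y) →-dec (x ≟± y))
   ×-dec all±? (λ y → any±? λ x → f x ≟± y))

private
  two-steps : ∀ {k} → 2 ∣ suc (suc k) → 2 ∣ k
  two-steps d = ∣m+n∣m⇒∣n d ∣-refl

  parity : ℕ → Sign
  parity zero    = Sign.+
  parity (suc k) = opposite (parity k)

  parity-even : ∀ k → 2 ∣ k → parity k ≡ Sign.+
  parity-even zero          _ = refl
  parity-even (suc zero)    d with () ← ∣1⇒≡1 d
  parity-even (suc (suc k)) d rewrite Sign.opposite-selfInverse {parity k} refl = parity-even k (two-steps d)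

  even-parity : ∀ k → parity k ≡ Sign.+ → 2 ∣ k
  even-parity zero          _ = divides 0 refl
  even-parity (suc zero)    ()
  even-parity (suc (suc k)) e rewrite Sign.opposite-selfInverse {parity k} refl =
    ∣m∣n⇒∣m+n ∣-refl (even-parity k e)

  signs : ∀ {m} → Vec (± n) m → Sign
  signs v = ∏ˢ (λ i → proj₁ (lookup v i))

  parity-signs : ∀ {m} (v : Vec (± n) m) → parity (negatives v) ≡ signs v
  parity-signs []                 = refl
  parity-signs ((Sign.- , _) ∷ v) = cong opposite (parity-signs v)
  parity-signs ((Sign.+ , _) ∷ v) = parity-signs v

  even⇒signs : ∀ {m} (v : Vec (± n) m) → 2 ∣ negatives v → signs v ≡ Sign.+
  even⇒signs v d = trans (sym (parity-signs v)) (parity-even _ d)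

  signs⇒even : ∀ {m} (v : Vec (± n) m) → signs v ≡ Sign.+ → 2 ∣ negatives v
  signs⇒even v e = even-parity _ (trans (parity-signs v) e)

  compose : Vec (± n) n → Vec (± n) n → Vec (± n) n
  compose u v = tabulate (λ i → oddMap u (lookup v i))

  oddMap-compose : ∀ (u v : Vec (± n) n) x → oddMap (compose u v) x ≡ oddMap u (oddMap v x)
  oddMap-compose u v (σ , i)
    rewrite Vec.lookup∘tabulate (λ i → oddMap u (lookup v i)) i =
    cong (_, _) (sym (Sign.*-assoc σ _ _))

  bijective-≗ : ∀ {f g : ± n → ± n} → (∀ x → g x ≡ f x) → Bijective _≡_ _≡_ f → Bijective _≡_ _≡_ g
  bijective-≗ g≗f (inj , sur) =
    (λ {x} {y} e → inj (trans (sym (g≗f x)) (trans e (g≗f y)))) ,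
    λ y → proj₁ (sur y) , λ e → trans (g≗f _) (proj₂ (sur y) e)

  compose-bijective : ∀ (u v : Vec (± n) n) → Bijective _≡_ _≡_ (oddMap u) →
                      Bijective _≡_ _≡_ (oddMap v) → Bijective _≡_ _≡_ (oddMap (compose u v))
  compose-bijective u v bu bv =
    bijective-≗ (oddMap-compose u v) (Comp.bijective _≡_ _≡_ _≡_ bv bu)

  ∣_∣-perm : (v : Vec (± n) n) → Bijective _≡_ _≡_ (oddMap v) →
             Σ (Fin n ↔ Fin n) λ π → ∀ i → Function.Inverse.to π i ≡ proj₂ (lookup v i)
  ∣ v ∣-perm (inj , sur) = ⤖⇒↔ (mk⤖ (inj′ , sur′)) , λ i → refl
    where
    square : ∀ σ → σ Sign.* σ ≡ Sign.+
    square Sign.+ = refl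
    square Sign.- = refl
    positive : ∀ i → oddMap v (proj₁ (lookup v i) , i) ≡ (Sign.+ , proj₂ (lookup v i))
    positive i = cong (_, proj₂ (lookup v i)) (square (proj₁ (lookup v i)))
    inj′ : Injective _≡_ _≡_ (proj₂ ∘ lookup v)
    inj′ {i} {j} e = cong proj₂ (inj {proj₁ (lookup v i) , i} {proj₁ (lookup v j) , j} (trans (positive i) (trans (cong (Sign.+ ,_) e) (sym (positive j)))))
    sur′ : Function.Surjective _≡_ _≡_ (proj₂ ∘ lookup v)
    sur′ a = proj₂ (proj₁ (sur (Sign.+ , a))) , λ { refl → cong proj₂ (proj₂ (sur (Sign.+ , a)) refl) }

  compose-even : ∀ (u v : Vec (± n) n) → Bijective _≡_ _≡_ (oddMap v) →
                 2 ∣ negatives u → 2 ∣ negatives v → 2 ∣ negatives (compose u v)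
  compose-even u v bv eu ev = signs⇒even (compose u v) (begin
      signs (compose u v)
        ≡⟨ ∏ˢ-cong (λ i → cong proj₁ (Vec.lookup∘tabulate (λ i → oddMap u (lookup v i)) i)) ⟩
      ∏ˢ (λ i → proj₁ (lookup v i) Sign.* proj₁ (lookup u (proj₂ (lookup v i))))
        ≡⟨ ∏ˢ-distrib (λ i → proj₁ (lookup v i)) (λ i → proj₁ (lookup u (proj₂ (lookup v i)))) ⟩
      signs v Sign.* ∏ˢ (λ i → proj₁ (lookup u (proj₂ (lookup v i))))
        ≡⟨ cong₂ Sign._*_ (even⇒signs v ev)
             (trans (∏ˢ-cong (λ i → cong (proj₁ ∘ lookup u) (sym (proj₂ (∣ v ∣-perm bv) i))))
                    (sym (∏ˢ-permute (proj₁ ∘ lookup u) (proj₁ (∣ v ∣-perm bv))))) ⟩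
      signs u
        ≡⟨ even⇒signs u eu ⟩
      Sign.+ ∎)
    where open ≡.≡-Reasoning

infixl 7 _∙_
_∙_ : 𝒟 n → 𝒟 n → 𝒟 n
mk𝒟 u bu eu ∙ mk𝒟 v bv ev =
  mk𝒟 (compose u v) (compose-bijective u v bu bv) (compose-even u v bv eu ev)

∙-action : ∀ (u v : 𝒟 n) x → (u ∙ v) ⟨ x ⟩ ≡ u ⟨ v ⟨ x ⟩ ⟩
∙-action u v = oddMap-compose (window u) (window v)

private
  self-inverse : (f : Fin n → ± n) → (∀ i → oddMap (tabulate f) (f i) ≡ (Sign.+ , i)) →
                 ∀ x → oddMap (tabulate f) (oddMap (tabulate f) x) ≡ x
  self-inverse f inv (σ , i) = begin
      oddMap (tabulate f) (oddMap (tabulate f) (σ , i))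
        ≡⟨ cong (λ y → oddMap (tabulate f) (σ Sign.* proj₁ y , proj₂ y)) (Vec.lookup∘tabulate f i) ⟩
      oddMap (tabulate f) (σ Sign.* proj₁ (f i) , proj₂ (f i))
        ≡⟨ cong (_, _) (Sign.*-assoc σ _ _) ⟩
      (σ Sign.* proj₁ (oddMap (tabulate f) (f i)) , proj₂ (oddMap (tabulate f) (f i)))
        ≡⟨ cong (λ y → σ Sign.* proj₁ y , proj₂ y) (inv i) ⟩
      (σ Sign.* Sign.+ , i)
        ≡⟨ cong (_, i) (Sign.*-identityʳ σ) ⟩
      (σ , i) ∎
    where open ≡.≡-Reasoning

  involution : (f : Fin n → ± n) → (∀ i → oddMap (tabulate f) (f i) ≡ (Sign.+ , i)) →
               ∏ˢ (proj₁ ∘ f) ≡ Sign.+ → 𝒟 n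
  involution f inv pos = mk𝒟 (tabulate f) (inj , sur)
      (signs⇒even (tabulate f) (trans (∏ˢ-cong (λ i → cong proj₁ (Vec.lookup∘tabulate f i))) pos))
    where
    inj : Injective _≡_ _≡_ (oddMap (tabulate f))
    inj {x} {y} e = trans (sym (self-inverse f inv x))
                          (trans (cong (oddMap (tabulate f)) e) (self-inverse f inv y))
    sur : Function.Surjective _≡_ _≡_ (oddMap (tabulate f))
    sur y = oddMap (tabulate f) y , λ { refl → self-inverse f inv y }

  ∏ˢ-+ : ∀ n → ∏ˢ {n} (λ _ → Sign.+) ≡ Sign.+
  ∏ˢ-+ zero    = refl
  ∏ˢ-+ (suc n) = ∏ˢ-+ n

ε : 𝒟 n
ε {n} = involution (Sign.+ ,_)
  (λ i → cong (λ y → Sign.+ Sign.* proj₁ y , proj₂ y) (Vec.lookup∘tabulate (Sign.+ ,_) i)) (∏ˢ-+ n)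

-- s i is s_{i+1}, and ŝ is s_{1̂}, whose index counts as 1 in comparisons.
data Letter : ℕ → Set where
  s : Fin n → Letter (suc n)
  ŝ : Letter (2 + n)

index : Letter n → ℕ
index (s i) = suc (toℕ i)
index ŝ     = 1

private
  exchange : Fin n → Fin (suc n) → ± (suc n)
  exchange i j = Sign.+ , PC.transpose (inject₁ i) (suc i) j

  exchange-involutive : ∀ (i : Fin n) j → oddMap (tabulate (exchange i)) (exchange i j) ≡ (Sign.+ , j)
  exchange-involutive i j =
    trans (cong (λ y → Sign.+ Sign.* proj₁ y , proj₂ y) (Vec.lookup∘tabulate (exchange i) (proj₂ (exchange i j))))
          (cong (Sign.+ ,_) (trans (transpose-comm (inject₁ i) (suc i) (proj₂ (exchange i j))) (PC.transpose-inverse (suc i) (inject₁ i))))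
    where
    transpose-comm : ∀ {m} (a b c : Fin m) → PC.transpose a b c ≡ PC.transpose b a c
    transpose-comm a b c with c Fin.≟ a
    ... | yes refl with c Fin.≟ b
    ...   | yes refl = refl
    ...   | no _ rewrite dec-true (c Fin.≟ c) refl = refl
    transpose-comm a b c | no c≢a with c Fin.≟ b
    ...   | yes _ = refl
    ...   | no _ rewrite dec-false (c Fin.≟ a) c≢a = refl

  hat : Fin (2 + n) → ± (2 + n)
  hat zero          = Sign.- , suc zero
  hat (suc zero)    = Sign.- , zero
  hat (suc (suc i)) = Sign.+ , suc (suc i)

  hat-involutive : ∀ (i : Fin (2 + n)) → oddMap (tabulate hat) (hat i) ≡ (Sign.+ , i)
  hat-involutive zero          = refl
  hat-involutive (suc zero)    = refl
  hat-involutive (suc (suc i)) = cong (λ y → Sign.+ Sign.* proj₁ y , proj₂ y)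
                                      (Vec.lookup∘tabulate (λ i → hat (suc (suc i))) i)

generator : Letter n → 𝒟 n
generator {suc n}       (s i) = involution (exchange i) (exchange-involutive i) (∏ˢ-+ (suc n))
generator {suc (suc n)} ŝ     = involution hat hat-involutive (cong (opposite ∘ opposite) (∏ˢ-+ n))

⟦_⟧ : List (Letter n) → 𝒟 n
⟦ [] ⟧    = ε
⟦ a ∷ as ⟧ = generator a ∙ ⟦ as ⟧

letters : ∀ n → List (Letter n)
letters zero          = []
letters (suc zero)    = []
letters (suc (suc n)) = ŝ ∷ map s (allFin (suc n))

lists : {A : Set} → List A → ℕ → List (List A)
lists xs zero    = [] ∷ []
lists xs (suc l) = cartesianProductWith _∷_ xs (lists xs l)

private
  ∈-letters : (a : Letter n) → a ∈ letters n
  ∈-letters {suc (suc n)} (s i) = there (∈-map⁺ s (∈-allFin i))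
  ∈-letters {suc (suc n)} ŝ     = here refl

  ∈-lists : {A : Set} {xs : List A} → (∀ a → a ∈ xs) → ∀ as → as ∈ lists xs (length as)
  ∈-lists all []       = here refl
  ∈-lists all (a ∷ as) = ∈-cartesianProductWith⁺ _∷_ (all a) (∈-lists all as)

  lists-length : {A : Set} (xs : List A) (l : ℕ) {as : List A} → as ∈ lists xs l → length as ≡ l
  lists-length xs zero (here refl) = refl
  lists-length xs (suc l) p with ∈-cartesianProductWith⁻ _∷_ xs (lists xs l) p
  ... | _ , _ , _ , q , refl = cong suc (lists-length xs l q)

  ≗⇒≡ : {u v : 𝒟 n} → (∀ i → u ⟨ Sign.+ , i ⟩ ≡ v ⟨ Sign.+ , i ⟩) → u ≡ v
  ≗⇒≡ {u = u} {v} e = window-injective (begin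
      window u                     ≡⟨ Vec.tabulate∘lookup (window u) ⟨
      tabulate (lookup (window u)) ≡⟨ Vec.tabulate-cong e ⟩
      tabulate (lookup (window v)) ≡⟨ Vec.tabulate∘lookup (window v) ⟩
      window v ∎)
    where open ≡.≡-Reasoning

  𝒟-ext : {u v : 𝒟 n} → (∀ x → u ⟨ x ⟩ ≡ v ⟨ x ⟩) → u ≡ v
  𝒟-ext e = ≗⇒≡ (λ i → e (Sign.+ , i))

  ε-action : ∀ (x : ± n) → ε ⟨ x ⟩ ≡ x
  ε-action (σ , i) =
    trans (cong (λ y → σ Sign.* proj₁ y , proj₂ y) (Vec.lookup∘tabulate (Sign.+ ,_) i))
          (cong (_, i) (Sign.*-identityʳ σ))

  generator² : (a : Letter n) → ∀ x → generator a ⟨ generator a ⟨ x ⟩ ⟩ ≡ x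
  generator² {suc n}       (s i) = self-inverse (exchange i) (exchange-involutive i)
  generator² {suc (suc n)} ŝ     = self-inverse hat hat-involutive

  Generated : 𝒟 n → Set
  Generated {n} w = Σ (List (Letter n)) λ as → ⟦ as ⟧ ≡ w

  ∷ʳ-action : ∀ (as : List (Letter n)) a x → ⟦ as ++ a ∷ [] ⟧ ⟨ x ⟩ ≡ ⟦ as ⟧ ⟨ generator a ⟨ x ⟩ ⟩
  ∷ʳ-action [] a x =
    trans (∙-action (generator a) ε x)
          (trans (cong (generator a ⟨_⟩) (ε-action x)) (sym (ε-action (generator a ⟨ x ⟩))))
  ∷ʳ-action (b ∷ as) a x =
    trans (∙-action (generator b) ⟦ as ++ a ∷ [] ⟧ x)
          (trans (cong (generator b ⟨_⟩) (∷ʳ-action as a x))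
                 (sym (∙-action (generator b) ⟦ as ⟧ (generator a ⟨ x ⟩))))

  step : ∀ {w : 𝒟 n} a → Generated (w ∙ generator a) → Generated w
  step {w = w} a (as , e) = as ++ a ∷ [] , 𝒟-ext λ x →
    trans (∷ʳ-action as a x)
          (trans (cong (_⟨ generator a ⟨ x ⟩ ⟩) e)
                 (trans (∙-action w (generator a) (generator a ⟨ x ⟩))
                        (cong (w ⟨_⟩) (generator² a x))))

  transpose-left : ∀ (a b : Fin n) → PC.transpose a b a ≡ b
  transpose-left a b rewrite dec-true (a Fin.≟ a) refl = refl

  transpose-right : ∀ (a b : Fin n) → PC.transpose a b b ≡ a
  transpose-right a b with b Fin.≟ a
  ... | yes b≡a = b≡a
  ... | no _ rewrite dec-true (b Fin.≟ b) refl = refl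

  transpose-other : ∀ (a b c : Fin n) → c ≢ a → c ≢ b → PC.transpose a b c ≡ c
  transpose-other a b c c≢a c≢b
    rewrite dec-false (c Fin.≟ a) c≢a | dec-false (c Fin.≟ b) c≢b = refl

  generator-s : ∀ (q : Fin n) i → generator (s q) ⟨ Sign.+ , i ⟩ ≡ exchange q i
  generator-s q i = Vec.lookup∘tabulate (exchange q) i

  swap-inject₁ : ∀ (w : 𝒟 (suc n)) q → (w ∙ generator (s q)) ⟨ Sign.+ , inject₁ q ⟩ ≡ w ⟨ Sign.+ , suc q ⟩
  swap-inject₁ w q = trans (∙-action w (generator (s q)) (Sign.+ , inject₁ q)) (cong (w ⟨_⟩)
    (trans (generator-s q (inject₁ q)) (cong (Sign.+ ,_) (transpose-left (inject₁ q) (suc q)))))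

  swap-suc : ∀ (w : 𝒟 (suc n)) q → (w ∙ generator (s q)) ⟨ Sign.+ , suc q ⟩ ≡ w ⟨ Sign.+ , inject₁ q ⟩
  swap-suc w q = trans (∙-action w (generator (s q)) (Sign.+ , suc q)) (cong (w ⟨_⟩)
    (trans (generator-s q (suc q)) (cong (Sign.+ ,_) (transpose-right (inject₁ q) (suc q)))))

  Fixes : ℕ → 𝒟 n → Set
  Fixes j w = ∀ i → j ≤ toℕ i → w ⟨ Sign.+ , i ⟩ ≡ (Sign.+ , i)

  fixes-s : ∀ {j} (w : 𝒟 (suc n)) q → suc (toℕ q) ≤ j → Fixes (suc j) w → Fixes (suc j) (w ∙ generator (s q))
  fixes-s w q q<j fix i j<i =
    trans (∙-action w (generator (s q)) (Sign.+ , i)) (trans (cong (w ⟨_⟩)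
      (trans (generator-s q i) (cong (Sign.+ ,_) (transpose-other _ _ _ i≢inject₁ i≢suc)))) (fix i j<i))
    where
    i≢inject₁ : i ≢ inject₁ q
    i≢inject₁ refl = ℕ.<⇒≱ j<i (ℕ.≤-trans (ℕ.≤-reflexive (Fin.toℕ-inject₁ q)) (ℕ.<⇒≤ q<j))
    i≢suc : i ≢ suc q
    i≢suc refl = ℕ.<⇒≱ j<i q<j

  fixes-ŝ : ∀ {j} (w : 𝒟 (2 + n)) → 1 ≤ j → Fixes (suc j) w → Fixes (suc j) (w ∙ generator ŝ)
  fixes-ŝ w (s≤s _) fix (suc zero) (s≤s ())
  fixes-ŝ w _ fix (suc (suc i)) j<i =
    trans (∙-action w (generator ŝ) (Sign.+ , suc (suc i))) (trans (cong (w ⟨_⟩)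
      (Vec.lookup∘tabulate hat (suc (suc i)))) (fix (suc (suc i)) j<i))

  raise : ∀ {j} (t : Fin (suc n)) → toℕ t ≡ j → (∀ w → Fixes j w → Generated w) →
          ∀ d (w : 𝒟 (suc n)) p → toℕ p + d ≡ j → Fixes (suc j) w →
          w ⟨ Sign.+ , p ⟩ ≡ (Sign.+ , t) → Generated w
  raise t refl ih zero w p p≡t fix wp = ih w fix′
    where
    fix′ : Fixes (toℕ t) w
    fix′ i t≤i with ℕ.m≤n⇒m<n∨m≡n t≤i
    ... | inj₁ t<i = fix i t<i
    ... | inj₂ t≡i with Fin.toℕ-injective {i = t} t≡i
                      | Fin.toℕ-injective {i = p} (trans (sym (ℕ.+-identityʳ _)) p≡t)
    ...   | refl | refl = wp
  raise {n} t refl ih (suc d) w p p+d≡t fix wp =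
    step (s q) (raise t refl ih d (w ∙ generator (s q)) (suc q)
                      (trans (sym (ℕ.+-suc (toℕ q) d)) (trans (cong (_+ suc d) q≡p) p+d≡t))
                      (fixes-s w q q<t fix)
                      (trans (swap-suc w q) (trans (cong (λ r → w ⟨ Sign.+ , r ⟩) inject₁q≡p) wp)))
    where
    p<t : toℕ p < toℕ t
    p<t = subst (toℕ p <_) p+d≡t (ℕ.m<m+n (toℕ p) (s≤s z≤n))
    p<n : toℕ p < n
    p<n = ℕ.<-≤-trans p<t (ℕ.s≤s⁻¹ (Fin.toℕ<n t))
    q : Fin n
    q = fromℕ< p<n
    q≡p : toℕ q ≡ toℕ p
    q≡p = Fin.toℕ-fromℕ< p<n
    q<t : toℕ q < toℕ t
    q<t = subst (_< toℕ t) (sym q≡p) p<t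
    inject₁q≡p : inject₁ q ≡ p
    inject₁q≡p = Fin.toℕ-injective (trans (Fin.toℕ-inject₁ q) q≡p)

  lower : ∀ {j} (t : Fin (2 + n)) → toℕ t ≡ suc j → (∀ w → Fixes (suc j) w → Generated w) →
          ∀ l (w : 𝒟 (2 + n)) p → toℕ p ≡ l → l ≤ suc j → Fixes (2 + j) w →
          w ⟨ Sign.+ , p ⟩ ≡ (Sign.- , t) → Generated w
  lower {j = j} t t≡j ih l w zero _ _ fix wp =
    step ŝ (raise t t≡j ih j (w ∙ generator ŝ) (suc zero) refl (fixes-ŝ w (s≤s z≤n) fix)
                  (trans (∙-action w (generator ŝ) (Sign.+ , suc zero)) (cong (λ y → opposite (proj₁ y) , proj₂ y) wp)))
  lower {j = j} t t≡j ih (suc l) w (suc q) refl l≤j fix wp =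
    step (s q) (lower t t≡j ih l (w ∙ generator (s q)) (inject₁ q) (Fin.toℕ-inject₁ q) (ℕ.<⇒≤ l≤j)
                      (fixes-s w q l≤j fix) (trans (swap-inject₁ w q) wp))

  preimage : ∀ j (w : 𝒟 n) → Fixes (suc j) w → (t : Fin n) → toℕ t ≡ j →
             Σ Sign λ σ → Σ (Fin n) λ p → w ⟨ Sign.+ , p ⟩ ≡ (σ , t) × toℕ p ≤ j
  preimage j w@(mk𝒟 _ b _) fix t refl with proj₂ (recompute (bijective? (w ⟨_⟩)) b) (Sign.+ , t)
  ... | (σ , p) , e = proj₁ (w ⟨ Sign.+ , p ⟩) , p , cong (_ ,_) wp , bound
    where
    wp : proj₂ (w ⟨ Sign.+ , p ⟩) ≡ t
    wp = cong proj₂ (e refl)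
    bound : toℕ p ≤ toℕ t
    bound with toℕ p ℕ.≤? toℕ t
    ... | yes p≤t = p≤t
    ... | no p≰t  = ℕ.≤-reflexive (cong toℕ (trans (sym (cong proj₂ (fix p (ℕ.≰⇒> p≰t)))) wp))

  fixes-0 : ∀ (w : 𝒟 n) → Fixes 0 w → Generated w
  fixes-0 w fix = [] , ≗⇒≡ (λ i → trans (ε-action (Sign.+ , i)) (sym (fix i z≤n)))

  fixes-1 : ∀ (w : 𝒟 (suc n)) → Fixes 1 w → Generated w
  fixes-1 {n} w@(mk𝒟 v _ e) fix with preimage 0 w fix zero refl
  ... | σ , zero , wp , _ = fixes-0 w fix′
    where
    σ≡+ : σ ≡ Sign.+
    σ≡+ = begin
        σ                                            ≡⟨ Sign.*-identityʳ σ ⟨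
        σ Sign.* Sign.+                              ≡⟨ cong₂ Sign._*_ (cong proj₁ wp) (trans (∏ˢ-cong (λ i → cong proj₁ (fix (suc i) (s≤s z≤n)))) (∏ˢ-+ n)) ⟨
        signs v                                      ≡⟨ even⇒signs v (recompute (2 ∣? negatives v) e) ⟩
        Sign.+ ∎
      where open ≡.≡-Reasoning
    fix′ : Fixes 0 w
    fix′ zero    _ = trans wp (cong (_, zero) σ≡+)
    fix′ (suc i) _ = fix (suc i) (s≤s z≤n)

  fixes-suc : ∀ j → suc j < 2 + n → (∀ w → Fixes (suc j) w → Generated w) →
              (w : 𝒟 (2 + n)) → Fixes (2 + j) w → Generated w
  fixes-suc j j<n ih w fix
    with preimage (suc j) w fix (fromℕ< j<n) (Fin.toℕ-fromℕ< j<n)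
  ... | Sign.+ , p , wp , p≤j =
    raise (fromℕ< j<n) (Fin.toℕ-fromℕ< j<n) ih _ w p (ℕ.m+[n∸m]≡n p≤j) fix wp
  ... | Sign.- , p , wp , p≤j =
    lower (fromℕ< j<n) (Fin.toℕ-fromℕ< j<n) ih _ w p refl p≤j fix wp

  fixes : ∀ j → j ≤ 2 + n → (w : 𝒟 (2 + n)) → Fixes j w → Generated w
  fixes zero          _   = fixes-0
  fixes (suc zero)    _   = fixes-1
  fixes (suc (suc j)) j<n = fixes-suc j j<n (fixes (suc j) (ℕ.<⇒≤ j<n))

generated : (w : 𝒟 n) → Σ (List (Letter n)) λ as → ⟦ as ⟧ ≡ w
generated {zero}        w = fixes-0 w (λ ())
generated {suc zero}    w = fixes-1 w (λ { zero () })
generated {suc (suc n)} w = fixes (2 + n) ℕ.≤-refl w (λ i n≤i → ⊥-elim (ℕ.<⇒≱ (Fin.toℕ<n i) n≤i))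

IsLength : 𝒟 n → ℕ → Set
IsLength {n} w l = (Σ (List (Letter n)) λ as → length as ≡ l × ⟦ as ⟧ ≡ w)
                 × (∀ as → ⟦ as ⟧ ≡ w → l ≤ length as)

private
  hasWord? : ∀ (w : 𝒟 n) l → Dec (Σ (List (Letter n)) λ as → length as ≡ l × ⟦ as ⟧ ≡ w)
  hasWord? {n} w l with any? (λ as → ⟦ as ⟧ ≟𝒟 w) (lists (letters n) l)
  ... | yes p = let as , as∈ , e = find p in yes (as , lists-length (letters n) l as∈ , e)
  ... | no ¬p = no λ { (as , refl , e) → ¬p (lose (∈-lists ∈-letters as) e) }

  search : ∀ (w : 𝒟 n) d l → (∀ as → ⟦ as ⟧ ≡ w → l ≤ length as) →
           (Σ (List (Letter n)) λ as → length as ≡ l + d × ⟦ as ⟧ ≡ w) → ∃ (IsLength w)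
  search w zero l lb (as , e , f) = l , (as , trans e (ℕ.+-identityʳ l) , f) , lb
  search w (suc d) l lb (as , e , f) with hasWord? w l
  ... | yes p = l , p , lb
  ... | no ¬p = search w d (suc l) lb′ (as , trans e (ℕ.+-suc l d) , f)
    where
    lb′ : ∀ as → ⟦ as ⟧ ≡ w → suc l ≤ length as
    lb′ bs g = ℕ.≤∧≢⇒< (lb bs g) (λ l≡ → ¬p (bs , sym l≡ , g))

coxeterLength : (w : 𝒟 n) → ∃ (IsLength w)
coxeterLength w = let as , e = generated w in search w (length as) 0 (λ _ _ → z≤n) (as , refl , e)

ℓ : 𝒟 n → ℕ
ℓ w = proj₁ (coxeterLength w)

R : 𝒟 n → List (List (Letter n))
R {n} w = filter (λ as → ⟦ as ⟧ ≟𝒟 w) (lists (letters n) (ℓ w))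

-- z i is the variable z_{i+1}, and p j is the power sum p_{2j+1}(𝐱).
data ZP : Set where
  z p : ℕ → ZP

degree : ZP → ℕ
degree (z i) = 1
degree (p j) = 2 * j + 1

swap : ℕ → ℕ → ℕ
swap i j = if does (j ℕ.≟ i) then suc i else if does (j ℕ.≟ suc i) then i else j

image : Letter n → ZP → Poly ZP
image (s i) (z j)             = var (z (swap (toℕ i) j))
image (s i) (p j)             = var (p j)
image ŝ     (z zero)          = ⊝ var (z 1)
image ŝ     (z (suc zero))    = ⊝ var (z 0)
image ŝ     (z (suc (suc j))) = var (z (2 + j))
image ŝ     (p j)             = var (p j) ⊕ (var (z 0) ↑ (2 * j + 1) ⊕ var (z 1) ↑ (2 * j + 1))

infixr 9 _·_
_·_ : Letter n → Poly ZP → Poly ZP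
a · f = substitute (image a) f

denominator : Letter n → Poly ZP
denominator (s i) = var (z (toℕ i)) ⊖ var (z (suc (toℕ i)))
denominator ŝ     = ⊝ var (z 0) ⊖ var (z 1)

-- g is the quotient ∂ₐf = (f − a·f) / denominator a; it is unique because ℚ[𝐳, p₁, p₃, …] is a domain.
∂[_]_≈_ : Letter n → Poly ZP → Poly ZP → Set
∂[ a ] f ≈ g = denominator a ⊗ g ≈ f ⊖ a · f

-- w′ is the image of w under the inclusion of 𝒟 n into 𝒟 (suc n).
Extends : 𝒟 n → 𝒟 (suc n) → Set
Extends {n} w w′ =
  (∀ σ i → w′ ⟨ σ , inject₁ i ⟩ ≡ (proj₁ (w ⟨ σ , i ⟩) , inject₁ (proj₂ (w ⟨ σ , i ⟩))))
  × w′ ⟨ Sign.+ , fromℕ n ⟩ ≡ (Sign.+ , fromℕ n)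

-- A family indexed by 𝒟_∞ = ⋃ 𝒟 n is a family on every 𝒟 n compatible with the inclusions.
record IsSchubertFamily (𝔇 : ∀ {n} → 𝒟 n → Poly ZP) : Set where
  field
    compatible  : ∀ {n} (w : 𝒟 n) (w′ : 𝒟 (suc n)) → Extends w w′ → 𝔇 w′ ≈ 𝔇 w
    homogeneous : ∀ {n} (w : 𝒟 n) → ∃ λ d → Homogeneous degree d (𝔇 w)
    identity    : ∀ {n} → 𝔇 (ε {n}) ≈ con 1ℚ
    descent     : ∀ {n} (w : 𝒟 n) (a : Letter n) → ℓ (w ∙ generator a) < ℓ w →
                  ∂[ a ] 𝔇 w ≈ 𝔇 (w ∙ generator a)
    nondescent  : ∀ {n} (w : 𝒟 n) (a : Letter n) → ¬ ℓ (w ∙ generator a) < ℓ w →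
                  ∂[ a ] 𝔇 w ≈ con 0ℚ

-- x i and z i are the variables x_{i+1} and z_{i+1}.
data XZ : Set where
  x z : ℕ → XZ

truncate : ℕ → Poly ZP → Poly XZ
truncate k = substitute λ where
  (z i) → var (z i)
  (p j) → ∑ (List.upTo k) λ i → var (x i) ↑ (2 * j + 1)

-- A monomial is represented by its index sequence, which monotonicity makes
-- unique; j : Fin k stands for the index j+1.

Peak : Letter n → Letter n → Letter n → Set
Peak a b c = index a < index b × index c < index b

NoForbiddenPeak : ∀ {k} → List (Letter n × Fin k) → Set
NoForbiddenPeak ((a , i) ∷ (b , j) ∷ (c , h) ∷ r) =
  (i ≡ j × j ≡ h → ¬ Peak a b c) × NoForbiddenPeak ((b , j) ∷ (c , h) ∷ r)
NoForbiddenPeak _ = ⊤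

XAdmissible : ∀ {k} → List (Letter n) → List (Fin k) → Set
XAdmissible as js = Linked Fin._≥_ js × NoForbiddenPeak (zip as js)

-- Only applied to reduced words of elements of 𝒮ₙ, in which ŝ does not occur.
ZAdmissible : ∀ {k} → List (Letter n) → List (Fin k) → Set
ZAdmissible as js =
  Linked Fin._≤_ js
  × All (λ (a , j) → suc (toℕ j) ≤ index a) (zip as js)
  × Linked (λ (a , i) (b , j) → i ≡ j → index b < index a) (zip as js)

private
  noForbiddenPeak? : ∀ {k} (r : List (Letter n × Fin k)) → Dec (NoForbiddenPeak r)
  noForbiddenPeak? []          = yes tt
  noForbiddenPeak? (_ ∷ [])     = yes tt
  noForbiddenPeak? (_ ∷ _ ∷ []) = yes tt
  noForbiddenPeak? ((a , i) ∷ (b , j) ∷ (c , h) ∷ r) =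
    (((i Fin.≟ j) ×-dec (j Fin.≟ h)) →-dec ¬? ((index a ℕ.<? index b) ×-dec (index c ℕ.<? index b)))
    ×-dec noForbiddenPeak? ((b , j) ∷ (c , h) ∷ r)

xAdmissible? : ∀ {k} (as : List (Letter n)) (js : List (Fin k)) → Dec (XAdmissible as js)
xAdmissible? as js = linked? (λ i j → j Fin.≤? i) js ×-dec noForbiddenPeak? (zip as js)

zAdmissible? : ∀ {k} (as : List (Letter n)) (js : List (Fin k)) → Dec (ZAdmissible as js)
zAdmissible? as js =
  linked? Fin._≤?_ js
  ×-dec All.all? (λ (a , j) → suc (toℕ j) ℕ.≤? index a) (zip as js)
  ×-dec linked? (λ (a , i) (b , j) → (i Fin.≟ j) →-dec (index b ℕ.<? index a)) (zip as js)

-- Entries in Fin k encode α_{k+1} = α_{k+2} = … = 0.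
𝒜x : ∀ k → List (Letter n) → List (List (Fin k))
𝒜x k as = filter (xAdmissible? as) (lists (allFin k) (length as))

-- j_i ≤ a_i < n bounds the indices.
𝒜z : List (Letter n) → List (List (Fin n))
𝒜z {n} as = filter (zAdmissible? as) (lists (allFin n) (length as))

x^ z^ : ∀ {k} → List (Fin k) → Poly XZ
x^ js = ∏ js (λ j → var (x (toℕ j)))
z^ js = ∏ js (λ j → var (z (toℕ j)))

variableCount : ∀ {k} → List (Fin k) → ℕ
variableCount js = length (deduplicate Fin._≟_ js)

o : List (Letter n) → ℕ
o as = length (filter (λ a → index a ℕ.≟ 1) as)

2^[_-_] : ℕ → ℕ → ℚ
2^[ i - j ] = ℚ._/_ (+ (2 ^ i)) (2 ^ j) {{ℕ.m^n≢0 2 j}}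

vectors : {A : Set} → List A → (l : ℕ) → List (Vec A l)
vectors xs zero    = [] ∷ []
vectors xs (suc l) = cartesianProductWith _∷_ xs (vectors xs l)

elements : ∀ n → List (𝒟 n)
elements n = mapMaybe element (vectors (cartesianProduct (Sign.+ ∷ Sign.- ∷ []) (allFin n)) n)
  where
  element : Vec (± n) n → Maybe (𝒟 n)
  element v with bijective? (oddMap v) | 2 ∣? negatives v
  ... | yes b | yes e = just (mk𝒟 v b e)
  ... | _     | _     = nothing

-- The permutations of {1,…,n}, extended oddly to {±1,…,±n}.
𝒮 : 𝒟 n → Set
𝒮 v = ∀ i → proj₁ (v ⟨ Sign.+ , i ⟩) ≡ Sign.+

factorisations : 𝒟 n → List (𝒟 n × 𝒟 n)
factorisations {n} w =
  filter (λ (u , v) → ((u ∙ v) ≟𝒟 w) ×-dec ((ℓ u + ℓ v) ℕ.≟ ℓ w)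
                      ×-dec Fin.all? (λ i → proj₁ (v ⟨ Sign.+ , i ⟩) Sign.≟ Sign.+))
         (cartesianProduct (elements n) (elements n))

factorisationSum : ℕ → 𝒟 n → Poly XZ
factorisationSum k w =
  ∑ (factorisations w) λ (u , v) →
  ∑ (R u) λ a → ∑ (𝒜x k a) λ α →
  ∑ (R v) λ b → ∑ (𝒜z b) λ β →
  con 2^[ variableCount α - o a ] ⊗ (x^ α ⊗ z^ β)

-- The boxes of the base for n = 2 + m and k Γ-blocks; c : Fin k is the block c+1,
-- stair i j is the box in row i+1 and column j+1 of the staircase block;
-- horizontal c i and vertical c i are the boxes of block c+1 indexed i+2.
data Box (m k : ℕ) : Set where
  stair               : (i : Fin (suc m)) → Fin (suc m ∸ toℕ i) → Box m k
  corner              : Fin k → Box m k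
  horizontal vertical : Fin k → Fin m → Box m k

private
  stair-bound : ∀ {m} (i : Fin (suc m)) (j : Fin (suc m ∸ toℕ i)) → toℕ i + toℕ j < suc m
  stair-bound {m} i j = subst (toℕ i + toℕ j <_) (ℕ.m+[n∸m]≡n (ℕ.<⇒≤ (Fin.toℕ<n i)))
                              (ℕ.+-monoʳ-< (toℕ i) (Fin.toℕ<n j))

-- The letter of a cross in the box; a corner counts as a box of index 1.
boxLetter : ∀ {m k} → Box m k → Letter (2 + m)
boxLetter (stair i j)      = s (fromℕ< (stair-bound i j))
boxLetter (corner c)       = s zero
boxLetter (horizontal c i) = s (suc i)
boxLetter (vertical c i)   = s (suc i)

boxVariable : ∀ {m k} → Box m k → XZ
boxVariable (stair i j)      = z (toℕ i)
boxVariable (corner c)       = x (toℕ c)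
boxVariable (horizontal c i) = x (toℕ c)
boxVariable (vertical c i)   = x (toℕ c)

-- Listed in reading order, so that words of a filling are concatenated from left to right.
base : ∀ m k → List (Box m k)
base m k = concatMap Γ-block (reverse (allFin k)) ++ concatMap row (allFin (suc m))
  where
  Γ-block : Fin k → List (Box m k)
  Γ-block c = map (horizontal c) (reverse (allFin m)) ++ corner c ∷ map (vertical c) (allFin m)
  row : Fin (suc m) → List (Box m k)
  row i = map (stair i) (reverse (allFin (suc m ∸ toℕ i)))

data Tile {m k : ℕ} : Box m k → Set where
  elbow cross              : ∀ {b} → Tile b
  faucetCross faucetsElbow : ∀ {c} → Tile (corner c)

PipeDream : ℕ → ℕ → Set
PipeDream m k = All Tile (base m k)

weight : ∀ {m k} {b : Box m k} → Tile b → ℕ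
weight elbow        = 0
weight cross        = 1
weight faucetCross  = 1
weight faucetsElbow = 2

tileWords : ∀ {m k} {b : Box m k} → Tile b → List (List (Letter (2 + m)))
tileWords elbow         = [] ∷ []
tileWords {b = b} cross = (boxLetter b ∷ []) ∷ []
tileWords faucetCross   = (ŝ ∷ []) ∷ []
tileWords faucetsElbow  = (s zero ∷ ŝ ∷ []) ∷ (ŝ ∷ s zero ∷ []) ∷ []

words : ∀ {m k} {bs : List (Box m k)} → All Tile bs → List (List (Letter (2 + m)))
words []      = [] ∷ []
words (t ∷ D) = cartesianProductWith _++_ (tileWords t) (words D)

weightMonomial : ∀ {m k} {bs : List (Box m k)} → All Tile bs → Poly XZ
weightMonomial []                = con 1ℚ
weightMonomial (_∷_ {x = b} t D) = var (boxVariable b) ↑ weight t ⊗ weightMonomial D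

IsReducedWordOf : 𝒟 n → List (Letter n) → Set
IsReducedWordOf w as = ⟦ as ⟧ ≡ w × length as ≡ ℓ w

ReducedOfShape : ∀ {m k} → 𝒟 (2 + m) → PipeDream m k → Set
ReducedOfShape w D = All (IsReducedWordOf w) (words D)

reducedOfShape? : ∀ {m k} (w : 𝒟 (2 + m)) (D : PipeDream m k) → Dec (ReducedOfShape w D)
reducedOfShape? w D = All.all? (λ as → (⟦ as ⟧ ≟𝒟 w) ×-dec (length as ℕ.≟ ℓ w)) (words D)

tiles : ∀ {m k} (b : Box m k) → List (Tile b)
tiles (corner _)       = elbow ∷ cross ∷ faucetCross ∷ faucetsElbow ∷ []
tiles (stair _ _)      = elbow ∷ cross ∷ []
tiles (horizontal _ _) = elbow ∷ cross ∷ []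
tiles (vertical _ _)   = elbow ∷ cross ∷ []

fillings : ∀ {m k} (bs : List (Box m k)) → List (All Tile bs)
fillings []       = [] ∷ []
fillings (b ∷ bs) = cartesianProductWith _∷_ (tiles b) (fillings bs)

PD : ∀ {m} k → 𝒟 (2 + m) → List (PipeDream m k)
PD {m} k w = filter (reducedOfShape? w) (fillings (base m k))

pipeDreamSum : ∀ {m} → ℕ → 𝒟 (2 + m) → Poly XZ
pipeDreamSum k w = ∑ (PD k w) weightMonomial

{-
In the nil-Coxeter algebra put 𝔇 = Σ 𝔇_w u_w. The divided difference equations say that letting
s_a act on the variables multiplies 𝔇 on the right by 1 - d_a u_a, where d_a is the denominator of
∂_a, so the values of 𝔇 at two points of one orbit differ by a product of such linear factors.
For w ∈ 𝒟ₙ the polynomial 𝔇_w does not involve z_n, z_{n+1}, …, so an arbitrary value may be put at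
z_n before each walk. Starting from the origin, where 𝔇 = 1:
moving x from z_n down to z_1, turning it into -x by ŝ (which adds x^j to p_j) and moving it back
to z_n yields the factors of a Γ-block with variable x; moving z_i from z_n down to its place
yields row i of the staircase. Expanding the product gives the sum over pipe dreams.

For the middle sum, split the product after the Γ-blocks and compare coefficients of reduced words
in the free algebra. Within one block the words without peaks fall and then rise: one whose lowest
letter has index ≥ 2 arises twice, since that letter can be taken from the horizontal or from the
vertical part; a single s₁ or ŝ comes from the corner only; and the two orders of s₁ŝ share the
coefficient of the elbow with two faucets. These are the factors 2^{i(α)-o(a)}.
-}

module Submission where

open import Defs
open import Algebra.Bundles using (CommutativeRing)
import Algebra.Properties.Group as GroupProperties
import Algebra.Solver.Ring as RingSolver
open import Algebra.Solver.Ring.AlmostCommutativeRing using (_-Raw-AlmostCommutative⟶_; fromCommutativeRing)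
open import Data.Empty using (⊥; ⊥-elim)
import Data.Empty.Irrelevant as Irrelevant
open import Data.Fin as Fin using (Fin; fromℕ; fromℕ<; inject₁; suc; toℕ; zero)
import Data.Fin.Permutation.Components as PC
import Data.Fin.Properties as Fin
import Data.Integer as ℤ
import Data.Integer.Properties as ℤ
open import Data.List as List using (List; []; _++_; _∷_; allFin; cartesianProduct; cartesianProductWith; concatMap;
  deduplicate; filter; length; map; mapMaybe; replicate; reverse; upTo; zip)
open import Data.List.Membership.Propositional using (_∈_; _∉_)
open import Data.List.Membership.Propositional.Properties using (∈-allFin; ∈-map⁺; ∈-map⁻)
import Data.List.Properties as List
open import Data.List.Relation.Unary.All as All using (All; []; _∷_)
import Data.List.Relation.Unary.All.Properties as All
open import Data.List.Relation.Unary.AllPairs as AllPairs using (AllPairs; []; _∷_; allPairs?)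
import Data.List.Relation.Unary.AllPairs.Properties as AllPairs
open import Data.List.Relation.Unary.Any as Any using (Any; here; there)
import Data.List.Relation.Unary.Any.Properties as Any
open import Data.List.Relation.Unary.Linked using (Linked; [-]; []; _∷_; linked?)
open import Data.List.Relation.Unary.Linked.Properties using (AllPairs⇒Linked; Linked⇒AllPairs)
open import Data.List.Reverse using (Reverse; []; _∶_∶ʳ_; reverseView)
open import Data.Maybe using (Maybe; just; maybe′; nothing)
open import Data.Nat as ℕ using (_*_; _+_; _<_; _^_; _∸_; _≤_; _⊔_; suc; s≤s; zero; z≤n; ℕ)
import Data.Nat.Coprimality as Coprimality
open import Data.Nat.Divisibility using (_∣?_)
open import Data.Nat.ListAction using (sum)
import Data.Nat.Properties as ℕ
open import Data.Product using (_,_; _×_; proj₁; proj₂; Σ; ∃)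
open import Data.Rational as ℚ using (0ℚ; 1ℚ; mkℚ; ½; ℚ)
import Data.Rational.Properties as ℚ
import Data.Rational.Unnormalised as ℚᵘ
import Data.Rational.Unnormalised.Properties as ℚᵘ
open import Data.Sign as Sign using (Sign; opposite)
import Data.Sign.Properties as Sign
open import Data.Sum using (_⊎_; inj₁; inj₂)
open import Data.Unit using (tt)
open import Data.Vec as Vec using (Vec; []; _∷_)
import Data.Vec.Properties as Vec
open import Function using (_∘_; id)
open import Relation.Binary.Definitions using (Tri; tri<; tri>; tri≈)
open import Relation.Binary.PropositionalEquality as ≡ using (_≡_; _≢_; cong; cong₂; refl; subst; subst₂; sym; trans)
import Relation.Binary.Reasoning.Setoid as SetoidReasoning
open import Relation.Nullary using (Dec; _×-dec_; _→-dec_; no; yes; ¬?; ¬_)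
open import Relation.Nullary.Decidable using (dec-false; dec-true; map′; recompute)

-- No two of the three expressions are compared directly. Each is reduced to the same linear
-- functional, the indicator `reduced w` of the reduced words of w, applied to the product of the
-- factors 1 + t a over the boxes of the base. The free algebra on the letters stands in for the
-- nil-Coxeter algebra: it needs no relations, it separates individual words as the middle sum
-- requires, and s₁ŝ = ŝs₁ enters only as a symmetry of the functional. Two facts about a Schubert
-- family are not among its axioms. Its value at the origin must be 1 for the identity and 0
-- otherwise; the axioms grant homogeneity of some degree only, so degree 0 has to be excluded for w
-- ≠ ε. Polynomials are terms modulo a generated congruence, which offers no cancellation, so this
-- is done by evaluating at rational points where no denominator vanishes. The independence of the
-- later z-variables is extracted from ascents in the larger groups; to recognise these, lengths are
-- related to signs of roots by an exchange argument.

private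
  variable
    n m k : ℕ
    A B C V W : Set

-- Polynomials and finite sums

module ≈-Reasoning {V : Set} = SetoidReasoning (CommutativeRing.setoid (polyRing V))

𝟘 𝟙 : Poly V
𝟘 = con 0ℚ
𝟙 = con 1ℚ

≡⇒≈ : {f g : Poly V} → f ≡ g → f ≈ g
≡⇒≈ refl = ≈-refl

con-⊝ : ∀ c → con {V} (ℚ.- c) ≈ ⊝ con c
con-⊝ {V} c = GroupProperties.inverseˡ-unique (CommutativeRing.+-group (polyRing V)) _ _
  (≈-trans (≈-sym (con-⊕ (ℚ.- c) c)) (≡⇒≈ (cong con (ℚ.+-inverseˡ c))))

con-morphism : ∀ V → ℚ.+-*-rawRing -Raw-AlmostCommutative⟶ fromCommutativeRing (polyRing V)
con-morphism V = record
  { ⟦_⟧ = con ; +-homo = con-⊕ ; *-homo = con-⊗ ; -‿homo = con-⊝ ; 0-homo = ≈-refl ; 1-homo = ≈-refl }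

con-≟ : ∀ c d → Maybe (con {V} c ≈ con d)
con-≟ c d with c ℚ.≟ d
... | yes e = just (≡⇒≈ (cong con e))
... | no _  = nothing

module Solver {V : Set} = RingSolver ℚ.+-*-rawRing (fromCommutativeRing (polyRing V)) (con-morphism V) con-≟
open Solver using (solve; _:+_; _:*_; _:-_; :-_; _:=_) renaming (con to :con)

⊕-congˡ : {f g h : Poly V} → g ≈ h → f ⊕ g ≈ f ⊕ h
⊕-congˡ = ⊕-cong ≈-refl

⊕-congʳ : {f g h : Poly V} → g ≈ h → g ⊕ f ≈ h ⊕ f
⊕-congʳ e = ⊕-cong e ≈-refl

⊗-congˡ : {f g h : Poly V} → g ≈ h → f ⊗ g ≈ f ⊗ h
⊗-congˡ = ⊗-cong ≈-refl

⊗-congʳ : {f g h : Poly V} → g ≈ h → g ⊗ f ≈ h ⊗ f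
⊗-congʳ e = ⊗-cong e ≈-refl

⊕-identityʳ : (f : Poly V) → f ⊕ 𝟘 ≈ f
⊕-identityʳ {V} = CommutativeRing.+-identityʳ (polyRing V)

⊗-identityʳ : (f : Poly V) → f ⊗ 𝟙 ≈ f
⊗-identityʳ {V} = CommutativeRing.*-identityʳ (polyRing V)

⊗-zeroˡ : (f : Poly V) → 𝟘 ⊗ f ≈ 𝟘
⊗-zeroˡ {V} = CommutativeRing.zeroˡ (polyRing V)

⊗-zeroʳ : (f : Poly V) → f ⊗ 𝟘 ≈ 𝟘
⊗-zeroʳ {V} = CommutativeRing.zeroʳ (polyRing V)

∑-cong : ∀ (as : List A) {f g : A → Poly V} → (∀ a → f a ≈ g a) → ∑ as f ≈ ∑ as g
∑-cong []       e = ≈-refl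
∑-cong (a ∷ as) e = ⊕-cong (e a) (∑-cong as e)

∑-cong-All : ∀ {P : A → Set} {as : List A} {f g : A → Poly V} → All P as →
             (∀ a → P a → f a ≈ g a) → ∑ as f ≈ ∑ as g
∑-cong-All []         e = ≈-refl
∑-cong-All (pa ∷ pas) e = ⊕-cong (e _ pa) (∑-cong-All pas e)

∑-zero : ∀ (as : List A) {f : A → Poly V} → (∀ a → f a ≈ 𝟘) → ∑ as f ≈ 𝟘
∑-zero []       e = ≈-refl
∑-zero (a ∷ as) e = ≈-trans (⊕-cong (e a) (∑-zero as e)) (⊕-identityˡ 𝟘)

∑-⊕ : ∀ (as : List A) {f g : A → Poly V} → ∑ as (λ a → f a ⊕ g a) ≈ ∑ as f ⊕ ∑ as g
∑-⊕ []       = ≈-sym (⊕-identityˡ 𝟘)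
∑-⊕ (a ∷ as) = ≈-trans (⊕-congˡ (∑-⊕ as))
  (solve 4 (λ a b c d → ((a :+ b) :+ (c :+ d)) := ((a :+ c) :+ (b :+ d))) ≈-refl _ _ _ _)

∑-⊗ˡ : ∀ (as : List A) c {f : A → Poly V} → c ⊗ ∑ as f ≈ ∑ as (λ a → c ⊗ f a)
∑-⊗ˡ []       c = ⊗-zeroʳ c
∑-⊗ˡ (a ∷ as) c = ≈-trans (⊗-distribˡ-⊕ _ _ _) (⊕-congˡ (∑-⊗ˡ as c))

∑-⊗ʳ : ∀ (as : List A) c {f : A → Poly V} → ∑ as f ⊗ c ≈ ∑ as (λ a → f a ⊗ c)
∑-⊗ʳ as c = ≈-trans (⊗-comm _ _) (≈-trans (∑-⊗ˡ as c) (∑-cong as (λ _ → ⊗-comm _ _)))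

∑-++ : ∀ (as bs : List A) {f : A → Poly V} → ∑ (as ++ bs) f ≈ ∑ as f ⊕ ∑ bs f
∑-++ []       bs = ≈-sym (⊕-identityˡ _)
∑-++ (a ∷ as) bs = ≈-trans (⊕-congˡ (∑-++ as bs)) (≈-sym (⊕-assoc _ _ _))

∑-map : ∀ (h : A → B) as {f : B → Poly V} → ∑ (map h as) f ≡ ∑ as (f ∘ h)
∑-map h []       = refl
∑-map h (a ∷ as) = cong (_ ⊕_) (∑-map h as)

∑-reverse : ∀ (as : List A) {f : A → Poly V} → ∑ (reverse as) f ≈ ∑ as f
∑-reverse []       = ≈-refl
∑-reverse (a ∷ as) {f} = begin
  ∑ (reverse (a ∷ as)) f         ≡⟨ cong (λ r → ∑ r f) (List.unfold-reverse a as) ⟩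
  ∑ (reverse as ++ a ∷ []) f     ≈⟨ ∑-++ (reverse as) (a ∷ []) ⟩
  ∑ (reverse as) f ⊕ (f a ⊕ 𝟘)   ≈⟨ ⊕-cong (∑-reverse as) (⊕-identityʳ _) ⟩
  ∑ as f ⊕ f a                   ≈⟨ ⊕-comm _ _ ⟩
  f a ⊕ ∑ as f ∎
  where open ≈-Reasoning

∑-swap : ∀ (as : List A) (bs : List B) {f : A → B → Poly V} →
         ∑ as (λ a → ∑ bs (f a)) ≈ ∑ bs (λ b → ∑ as (λ a → f a b))
∑-swap []       bs = ≈-sym (∑-zero bs (λ _ → ≈-refl))
∑-swap (a ∷ as) bs = ≈-trans (⊕-congˡ (∑-swap as bs)) (≈-sym (∑-⊕ bs))

∑-cartesianProductWith : ∀ (h : A → B → C) as bs {f : C → Poly V} →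
  ∑ (cartesianProductWith h as bs) f ≈ ∑ as (λ a → ∑ bs (λ b → f (h a b)))
∑-cartesianProductWith h []       bs = ≈-refl
∑-cartesianProductWith h (a ∷ as) bs =
  ≈-trans (∑-++ (map (h a) bs) _)
          (⊕-cong (≡⇒≈ (∑-map (h a) bs)) (∑-cartesianProductWith h as bs))

∑-mapMaybe : ∀ (h : A → Maybe B) as {f : B → Poly V} →
             ∑ (mapMaybe h as) f ≈ ∑ as (λ a → maybe′ f 𝟘 (h a))
∑-mapMaybe h []       = ≈-refl
∑-mapMaybe h (a ∷ as) with h a
... | just b  = ⊕-congˡ (∑-mapMaybe h as)
... | nothing = ≈-trans (∑-mapMaybe h as) (≈-sym (⊕-identityˡ _))

-- An indicator in place of filtering: sums over filtered lists become sums over the full list,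
-- where one condition can be exchanged for an equivalent one term by term.
when : ∀ {P : Set} → Dec P → Poly V → Poly V
when (yes _) f = f
when (no _)  f = 𝟘

when-yes : ∀ {P : Set} (P? : Dec P) {f : Poly V} → P → when P? f ≈ f
when-yes (yes _) e = ≈-refl
when-yes (no ¬e) e = ⊥-elim (¬e e)

when-no : ∀ {P : Set} (P? : Dec P) {f : Poly V} → ¬ P → when P? f ≈ 𝟘
when-no (yes e) ¬e = ⊥-elim (¬e e)
when-no (no _)  ¬e = ≈-refl

when-cong : ∀ {P Q : Set} (P? : Dec P) (Q? : Dec Q) {f g : Poly V} → (P → Q) → (Q → P) →
            (P → f ≈ g) → when P? f ≈ when Q? g
when-cong (yes e) Q? to from f≈g = ≈-trans (f≈g e) (≈-sym (when-yes Q? (to e)))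
when-cong (no ¬e) Q? to from f≈g = ≈-sym (when-no Q? (¬e ∘ from))

when-zero : ∀ {P : Set} (P? : Dec P) {f : Poly V} → f ≈ 𝟘 → when P? f ≈ 𝟘
when-zero (yes _) e = e
when-zero (no _)  e = ≈-refl

when-⊗ : ∀ {P : Set} (P? : Dec P) {f g : Poly V} → when P? (f ⊗ g) ≈ f ⊗ when P? g
when-⊗ (yes _) = ≈-refl
when-⊗ (no _)  = ≈-sym (⊗-zeroʳ _)

when-congˡ : ∀ {P : Set} (P? : Dec P) {f g : Poly V} → f ≈ g → when P? f ≈ when P? g
when-congˡ (yes _) e = e
when-congˡ (no _)  e = ≈-refl

when-homo : ∀ {P : Set} (P? : Dec P) {f : Poly V} {h : Poly V → Poly W} → h 𝟘 ≈ 𝟘 → h (when P? f) ≈ when P? (h f)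
when-homo (yes _) e = ≈-refl
when-homo (no _)  e = e

when-× : ∀ {P Q : Set} (P? : Dec P) (Q? : Dec Q) {f : Poly V} → when (P? ×-dec Q?) f ≈ when P? (when Q? f)
when-× (yes _) (yes _) = ≈-refl
when-× (yes _) (no _)  = ≈-refl
when-× (no _)  _       = ≈-refl

∑-filter : ∀ {P : A → Set} (P? : ∀ a → Dec (P a)) as {f : A → Poly V} →
           ∑ (filter P? as) f ≈ ∑ as (λ a → when (P? a) (f a))
∑-filter P? []       = ≈-refl
∑-filter P? (a ∷ as) with P? a
... | yes _ = ⊕-congˡ (∑-filter P? as)
... | no _  = ≈-trans (∑-filter P? as) (≈-sym (⊕-identityˡ _))

substitute-cong : ∀ {σ : V → Poly W} {f g} → f ≈ g → substitute σ f ≈ substitute σ g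
substitute-cong ≈-refl = ≈-refl
substitute-cong (≈-sym e) = ≈-sym (substitute-cong e)
substitute-cong (≈-trans e e′) = ≈-trans (substitute-cong e) (substitute-cong e′)
substitute-cong (⊕-cong e e′) = ⊕-cong (substitute-cong e) (substitute-cong e′)
substitute-cong (⊗-cong e e′) = ⊗-cong (substitute-cong e) (substitute-cong e′)
substitute-cong (⊝-cong e) = ⊝-cong (substitute-cong e)
substitute-cong (⊕-assoc f g h) = ⊕-assoc _ _ _
substitute-cong (⊕-comm f g) = ⊕-comm _ _
substitute-cong (⊕-identityˡ f) = ⊕-identityˡ _
substitute-cong (⊝-inverseˡ f) = ⊝-inverseˡ _
substitute-cong (⊗-assoc f g h) = ⊗-assoc _ _ _
substitute-cong (⊗-comm f g) = ⊗-comm _ _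
substitute-cong (⊗-identityˡ f) = ⊗-identityˡ _
substitute-cong (⊗-distribˡ-⊕ f g h) = ⊗-distribˡ-⊕ _ _ _
substitute-cong (con-⊕ c d) = con-⊕ c d
substitute-cong (con-⊗ c d) = con-⊗ c d

substitute-≗ : ∀ {σ τ : V → Poly W} → (∀ v → σ v ≈ τ v) → ∀ f → substitute σ f ≈ substitute τ f
substitute-≗ e (con q) = ≈-refl
substitute-≗ e (var v) = e v
substitute-≗ e (f ⊕ g) = ⊕-cong (substitute-≗ e f) (substitute-≗ e g)
substitute-≗ e (f ⊗ g) = ⊗-cong (substitute-≗ e f) (substitute-≗ e g)
substitute-≗ e (⊝ f)   = ⊝-cong (substitute-≗ e f)

substitute-∘ : ∀ {U} (σ : V → Poly W) (τ : U → Poly V) f →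
               substitute σ (substitute τ f) ≡ substitute (substitute σ ∘ τ) f
substitute-∘ σ τ (con q) = refl
substitute-∘ σ τ (var v) = refl
substitute-∘ σ τ (f ⊕ g) = cong₂ _⊕_ (substitute-∘ σ τ f) (substitute-∘ σ τ g)
substitute-∘ σ τ (f ⊗ g) = cong₂ _⊗_ (substitute-∘ σ τ f) (substitute-∘ σ τ g)
substitute-∘ σ τ (⊝ f)   = cong ⊝_ (substitute-∘ σ τ f)

substitute-↑ : ∀ (σ : V → Poly W) f k → substitute σ (f ↑ k) ≡ substitute σ f ↑ k
substitute-↑ σ f zero    = refl
substitute-↑ σ f (suc k) = cong (_ ⊗_) (substitute-↑ σ f k)

-- The group 𝒟ₙ and its descents

𝒟-ext : {u v : 𝒟 n} → (∀ i → u ⟨ i ⟩ ≡ v ⟨ i ⟩) → u ≡ v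
𝒟-ext {u = u} {v} e = window-injective
  (trans (sym (Vec.tabulate∘lookup (window u)))
         (trans (Vec.tabulate-cong (λ i → e (Sign.+ , i))) (Vec.tabulate∘lookup (window v))))

ε-action : ∀ (i : ± n) → ε ⟨ i ⟩ ≡ i
ε-action (σ , i) =
  trans (cong (λ y → σ Sign.* proj₁ y , proj₂ y) (Vec.lookup∘tabulate (Sign.+ ,_) i))
        (cong (_, i) (Sign.*-identityʳ σ))

∙-identityˡ : (w : 𝒟 n) → ε ∙ w ≡ w
∙-identityˡ w = 𝒟-ext λ i → trans (∙-action ε w i) (ε-action _)

∙-identityʳ : (w : 𝒟 n) → w ∙ ε ≡ w
∙-identityʳ w = 𝒟-ext λ i → trans (∙-action w ε i) (cong (w ⟨_⟩) (ε-action i))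

∙-assoc : (u v w : 𝒟 n) → (u ∙ v) ∙ w ≡ u ∙ (v ∙ w)
∙-assoc u v w = 𝒟-ext λ i → begin
  ((u ∙ v) ∙ w) ⟨ i ⟩   ≡⟨ ∙-action (u ∙ v) w i ⟩
  (u ∙ v) ⟨ w ⟨ i ⟩ ⟩   ≡⟨ ∙-action u v (w ⟨ i ⟩) ⟩
  u ⟨ v ⟨ w ⟨ i ⟩ ⟩ ⟩   ≡⟨ cong (u ⟨_⟩) (∙-action v w i) ⟨
  u ⟨ (v ∙ w) ⟨ i ⟩ ⟩   ≡⟨ ∙-action u (v ∙ w) i ⟨
  (u ∙ (v ∙ w)) ⟨ i ⟩ ∎
  where open ≡.≡-Reasoning

infix 8 -±_
-±_ : ± n → ± n
-± (σ , i) = opposite σ , i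

-±-involutive : (i : ± n) → -± -± i ≡ i
-±-involutive (Sign.+ , i) = refl
-±-involutive (Sign.- , i) = refl

⟨⟩-neg : (w : 𝒟 n) (i : ± n) → w ⟨ -± i ⟩ ≡ -± (w ⟨ i ⟩)
⟨⟩-neg w (Sign.+ , i) = refl
⟨⟩-neg w (Sign.- , i) = cong (_, proj₂ (w ⟨ Sign.+ , i ⟩)) (sym (Sign.opposite-selfInverse refl))

⟨⟩-injective : (w : 𝒟 n) {i j : ± n} → w ⟨ i ⟩ ≡ w ⟨ j ⟩ → i ≡ j
⟨⟩-injective w@(mk𝒟 _ b _) = proj₁ (recompute (bijective? (w ⟨_⟩)) b)

same-index : {i j : ± n} → proj₂ i ≡ proj₂ j → i ≡ j ⊎ i ≡ -± j
same-index {i = Sign.+ , _} {Sign.+ , _} refl = inj₁ refl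
same-index {i = Sign.+ , _} {Sign.- , _} refl = inj₂ refl
same-index {i = Sign.- , _} {Sign.+ , _} refl = inj₂ refl
same-index {i = Sign.- , _} {Sign.- , _} refl = inj₁ refl

⟨⟩-index-injective : (w : 𝒟 n) {i j : ± n} → proj₂ (w ⟨ i ⟩) ≡ proj₂ (w ⟨ j ⟩) → proj₂ i ≡ proj₂ j
⟨⟩-index-injective w {i} {j} e with same-index {i = w ⟨ i ⟩} {w ⟨ j ⟩} e
... | inj₁ e′ = cong proj₂ (⟨⟩-injective w {i} {j} e′)
... | inj₂ e′ = cong proj₂ (⟨⟩-injective w {i} { -± j} (trans e′ (sym (⟨⟩-neg w j))))

swap-left : ∀ i → swap i i ≡ suc i
swap-left i rewrite dec-true (i ℕ.≟ i) refl = refl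

swap-right : ∀ i → swap i (suc i) ≡ i
swap-right i rewrite dec-false (suc i ℕ.≟ i) (ℕ.1+n≢n) | dec-true (suc i ℕ.≟ suc i) refl = refl

swap-other : ∀ i {j} → j ≢ i → j ≢ suc i → swap i j ≡ j
swap-other i {j} ≢i ≢1+i rewrite dec-false (j ℕ.≟ i) ≢i | dec-false (j ℕ.≟ suc i) ≢1+i = refl

-- The graph of `swap i`: matching on it together with the value settles both equality tests at
-- once.
data Swap (i : ℕ) : ℕ → ℕ → Set where
  left  : Swap i i (suc i)
  right : Swap i (suc i) i
  other : ∀ {j} → j ≢ i → j ≢ suc i → Swap i j j

swap-view : ∀ i j → Swap i j (swap i j)
swap-view i j with j ℕ.≟ i
... | yes refl = subst (Swap i i) (sym (swap-left i)) left
... | no ≢i with j ℕ.≟ suc i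
...   | yes refl = subst (Swap i (suc i)) (sym (swap-right i)) right
...   | no ≢1+i  = subst (Swap i j) (sym (swap-other i ≢i ≢1+i)) (other ≢i ≢1+i)

toℕ-transpose : ∀ (i : Fin n) j → toℕ (PC.transpose (inject₁ i) (suc i) j) ≡ swap (toℕ i) (toℕ j)
toℕ-transpose i j with j Fin.≟ inject₁ i
... | yes refl = sym (trans (cong (swap (toℕ i)) (Fin.toℕ-inject₁ i)) (swap-left (toℕ i)))
... | no ≢i with j Fin.≟ suc i
...   | yes refl  = trans (Fin.toℕ-inject₁ i) (sym (swap-right (toℕ i)))
...   | no ≢1+i = sym (swap-other (toℕ i) (λ e → ≢i (Fin.toℕ-injective (trans e (sym (Fin.toℕ-inject₁ i)))))
                                          (λ e → ≢1+i (Fin.toℕ-injective e)))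

generator-s : ∀ (i : Fin n) σ j → generator (s i) ⟨ σ , j ⟩ ≡ (σ , PC.transpose (inject₁ i) (suc i) j)
generator-s i σ j =
  trans (cong (λ y → σ Sign.* proj₁ y , proj₂ y) (Vec.lookup∘tabulate (λ k → Sign.+ , PC.transpose (inject₁ i) (suc i) k) j))
        (cong (_, PC.transpose (inject₁ i) (suc i) j) (Sign.*-identityʳ σ))

generator-ŝ : ∀ σ (i : Fin n) → generator ŝ ⟨ σ , suc (suc i) ⟩ ≡ (σ , suc (suc i))
generator-ŝ σ i =
  trans (cong (λ y → σ Sign.* proj₁ y , proj₂ y) (Vec.lookup∘tabulate _ i))
        (cong (_, _) (Sign.*-identityʳ σ))

swap-involutive : ∀ i j → swap i (swap i j) ≡ j
swap-involutive i j with j | swap i j | swap-view i j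
... | _ | _ | left           = swap-right i
... | _ | _ | right          = swap-left i
... | _ | _ | other ≢i ≢1+i  = swap-other i ≢i ≢1+i

swap-inversion : ∀ i {j k} → j < k → swap i k < swap i j → j ≡ i × k ≡ suc i
swap-inversion i {j} {k} j<k <′ with swap i j | swap i k | swap-view i j | swap-view i k
... | _ | _ | left          | left         = ⊥-elim (ℕ.<-irrefl refl j<k)
... | _ | _ | left          | right        = refl , refl
... | _ | _ | left          | other _ _    = ⊥-elim (ℕ.<⇒≱ j<k (ℕ.s≤s⁻¹ <′))
... | _ | _ | right         | left         = ⊥-elim (ℕ.<-asym j<k ℕ.≤-refl)
... | _ | _ | right         | right        = ⊥-elim (ℕ.<-irrefl refl j<k)
... | _ | _ | right         | other _ _    = ⊥-elim (ℕ.<-asym (ℕ.<-trans j<k <′) ℕ.≤-refl)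
... | _ | _ | other _ _     | left         = ⊥-elim (ℕ.<-asym (ℕ.<-trans j<k ℕ.≤-refl) <′)
... | _ | _ | other _ _     | right        = ⊥-elim (ℕ.<⇒≱ j<k <′)
... | _ | _ | other _ _     | other _ _    = ⊥-elim (ℕ.<-asym j<k <′)

-- The pair (i , j) stands for the root e_i + e_j, where e_{-i} = -e_i. Its sign
-- is that of the entry with the larger absolute value.
HasSign : Sign → ± n → ± n → Set
HasSign ρ (σ , i) (τ , j) = (toℕ i < toℕ j × τ ≡ ρ) ⊎ (toℕ j < toℕ i × σ ≡ ρ)

HasSign-sym : ∀ {ρ} {i j : ± n} → HasSign ρ i j → HasSign ρ j i
HasSign-sym (inj₁ e) = inj₂ e
HasSign-sym (inj₂ e) = inj₁ e

HasSign-neg : ∀ {ρ} {i j : ± n} → HasSign ρ i j → HasSign (opposite ρ) (-± i) (-± j)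
HasSign-neg (inj₁ (lt , e)) = inj₁ (lt , cong opposite e)
HasSign-neg (inj₂ (lt , e)) = inj₂ (lt , cong opposite e)

sign? : (i j : ± n) → proj₂ i ≢ proj₂ j → HasSign Sign.+ i j ⊎ HasSign Sign.- i j
sign? (σ , i) (τ , j) ne with ℕ.<-cmp (toℕ i) (toℕ j)
sign? (σ , i) (Sign.+ , j) ne | tri< lt _ _ = inj₁ (inj₁ (lt , refl))
sign? (σ , i) (Sign.- , j) ne | tri< lt _ _ = inj₂ (inj₁ (lt , refl))
sign? (Sign.+ , i) (τ , j) ne | tri> _ _ gt = inj₁ (inj₂ (gt , refl))
sign? (Sign.- , i) (τ , j) ne | tri> _ _ gt = inj₂ (inj₂ (gt , refl))
sign? _ _ ne | tri≈ _ e _ = ⊥-elim (ne (Fin.toℕ-injective e))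

-- The simple root of a is e_{α a} + e_{β a}.
α β : Letter n → ± n
α (s i) = Sign.+ , suc i
α ŝ     = Sign.+ , zero
β (s i) = Sign.- , inject₁ i
β ŝ     = Sign.+ , suc zero

-- With `generator-β` this shows that the reflection sends e_α to -e_β and e_β to -e_α, hence
-- negates its simple root e_α + e_β.
generator-α : (a : Letter n) → generator a ⟨ α a ⟩ ≡ -± (β a)
generator-α (s i) = trans (generator-s i Sign.+ (suc i))
  (cong (Sign.+ ,_) (Fin.toℕ-injective (trans (toℕ-transpose i (suc i))
                                              (trans (swap-right (toℕ i)) (sym (Fin.toℕ-inject₁ i))))))
generator-α ŝ = refl

generator-β : (a : Letter n) → generator a ⟨ β a ⟩ ≡ -± (α a)
generator-β (s i) = trans (generator-s i Sign.- (inject₁ i))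
  (cong (Sign.- ,_) (Fin.toℕ-injective (trans (toℕ-transpose i (inject₁ i))
    (trans (cong (swap (toℕ i)) (Fin.toℕ-inject₁ i)) (swap-left (toℕ i))))))
generator-β ŝ = refl

generator-other : (a : Letter n) (i : ± n) → proj₂ i ≢ proj₂ (α a) → proj₂ i ≢ proj₂ (β a) →
                  generator a ⟨ i ⟩ ≡ i
generator-other (s i) (σ , j) ≢α ≢β = trans (generator-s i σ j)
  (cong (σ ,_) (Fin.toℕ-injective (trans (toℕ-transpose i j)
    (swap-other (toℕ i) (λ e → ≢β (Fin.toℕ-injective (trans e (sym (Fin.toℕ-inject₁ i)))))
                        (λ e → ≢α (Fin.toℕ-injective e))))))
generator-other ŝ (σ , zero)        ≢α ≢β = ⊥-elim (≢α refl)
generator-other ŝ (σ , suc zero)    ≢α ≢β = ⊥-elim (≢β refl)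
generator-other ŝ (σ , suc (suc i)) ≢α ≢β = generator-ŝ σ i

α≢β : (a : Letter n) → proj₂ (α a) ≢ proj₂ (β a)
α≢β (s i) e = ℕ.1+n≢n (trans (cong toℕ e) (Fin.toℕ-inject₁ i))
α≢β ŝ ()

generator-involutive : (a : Letter n) → generator a ∙ generator a ≡ ε
generator-involutive a = 𝒟-ext λ i →
  trans (∙-action (generator a) (generator a) i) (trans (twice i) (sym (ε-action i)))
  where
  ±α : ∀ i → generator a ⟨ generator a ⟨ i ⟩ ⟩ ≡ i → generator a ⟨ generator a ⟨ -± i ⟩ ⟩ ≡ -± i
  ±α i e = trans (cong (generator a ⟨_⟩) (⟨⟩-neg (generator a) i))
                 (trans (⟨⟩-neg (generator a) (generator a ⟨ i ⟩)) (cong -±_ e))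
  atα : generator a ⟨ generator a ⟨ α a ⟩ ⟩ ≡ α a
  atα = trans (cong (generator a ⟨_⟩) (generator-α a))
              (trans (⟨⟩-neg (generator a) (β a)) (trans (cong -±_ (generator-β a)) (-±-involutive (α a))))
  atβ : generator a ⟨ generator a ⟨ β a ⟩ ⟩ ≡ β a
  atβ = trans (cong (generator a ⟨_⟩) (generator-β a))
              (trans (⟨⟩-neg (generator a) (α a)) (trans (cong -±_ (generator-α a)) (-±-involutive (β a))))
  twice : ∀ i → generator a ⟨ generator a ⟨ i ⟩ ⟩ ≡ i
  twice i with proj₂ i Fin.≟ proj₂ (α a) | proj₂ i Fin.≟ proj₂ (β a)
  ... | no ≢α | no ≢β = trans (cong (generator a ⟨_⟩) (generator-other a i ≢α ≢β)) (generator-other a i ≢α ≢β)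
  ... | yes e | _ with same-index {i = i} {α a} e
  ...   | inj₁ refl = atα
  ...   | inj₂ refl = ±α (α a) atα
  twice i | no _ | yes e with same-index {i = i} {β a} e
  ...   | inj₁ refl = atβ
  ...   | inj₂ refl = ±α (β a) atβ

SimpleRoot : Letter n → ± n → ± n → Set
SimpleRoot a i j = (i ≡ α a × j ≡ β a) ⊎ (i ≡ β a × j ≡ α a)

private
  -- The entry of larger absolute value decides the sign, so the sign changes only if the two
  -- absolute values change order or the deciding entry is itself negated. For s_q the order is
  -- reversed only between neighbours (`swap-inversion`); ŝ alters nothing beyond the absolute
  -- values 1 and 2.
  only-simple< : (a : Letter n) (σ : Sign) {i j : Fin n} → toℕ i < toℕ j →
                 HasSign Sign.- (generator a ⟨ σ , i ⟩) (generator a ⟨ Sign.+ , j ⟩) →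
                 SimpleRoot a (σ , i) (Sign.+ , j)
  only-simple< (s q) σ {i} {j} i<j neg with subst₂ (HasSign Sign.-) (generator-s q σ i) (generator-s q Sign.+ j) neg
  ... | inj₂ (lt , refl) with swap-inversion (toℕ q) i<j (subst₂ _<_ (toℕ-transpose q j) (toℕ-transpose q i) lt)
  ...   | ei , ej = inj₂ (cong (Sign.- ,_) (Fin.toℕ-injective (trans ei (sym (Fin.toℕ-inject₁ q))))
                         , cong (Sign.+ ,_) (Fin.toℕ-injective ej))
  only-simple< ŝ Sign.+ {zero} {suc zero} i<j neg = inj₁ (refl , refl)
  only-simple< ŝ Sign.- {zero} {suc zero} i<j (inj₁ (() , _))
  only-simple< ŝ Sign.- {zero} {suc zero} i<j (inj₂ (_ , ()))
  only-simple< ŝ σ {suc i} {suc zero} (s≤s ()) neg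
  only-simple< ŝ σ {zero} {suc (suc j)} i<j neg
    with subst (HasSign Sign.- _) (generator-ŝ Sign.+ j) neg
  ... | inj₁ (_ , ())
  ... | inj₂ (s≤s () , _)
  only-simple< ŝ σ {suc zero} {suc (suc j)} i<j neg
    with subst (HasSign Sign.- _) (generator-ŝ Sign.+ j) neg
  ... | inj₁ (_ , ())
  ... | inj₂ (() , _)
  only-simple< ŝ σ {suc (suc i)} {suc (suc j)} i<j neg
    with subst₂ (HasSign Sign.-) (generator-ŝ σ i) (generator-ŝ Sign.+ j) neg
  ... | inj₁ (_ , ())
  ... | inj₂ (gt , _) = ⊥-elim (ℕ.<-asym i<j gt)

only-simple : (a : Letter n) {i j : ± n} → HasSign Sign.+ i j →
              HasSign Sign.- (generator a ⟨ i ⟩) (generator a ⟨ j ⟩) → SimpleRoot a i j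
only-simple a {σ , _} (inj₁ (lt , refl)) neg = only-simple< a σ lt neg
only-simple a {_} {τ , _} (inj₂ (lt , refl)) neg with only-simple< a τ lt (HasSign-sym neg)
... | inj₁ (ei , ej) = inj₂ (ej , ei)
... | inj₂ (ei , ej) = inj₁ (ej , ei)

-- Conjugation by u carries the reflection in a root to the reflection in its image.
conjugate : (u : 𝒟 n) (a b : Letter n) → SimpleRoot b (u ⟨ α a ⟩) (u ⟨ β a ⟩) →
            u ∙ generator a ≡ generator b ∙ u
conjugate u a b root = 𝒟-ext λ i →
  trans (∙-action u (generator a) i) (trans (commutes i) (sym (∙-action (generator b) u i)))
  where
  Commutes : ± _ → Set
  Commutes i = u ⟨ generator a ⟨ i ⟩ ⟩ ≡ generator b ⟨ u ⟨ i ⟩ ⟩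
  negate : ∀ i → Commutes i → Commutes (-± i)
  negate i e = begin
    u ⟨ generator a ⟨ -± i ⟩ ⟩    ≡⟨ cong (u ⟨_⟩) (⟨⟩-neg (generator a) i) ⟩
    u ⟨ -± (generator a ⟨ i ⟩) ⟩  ≡⟨ ⟨⟩-neg u (generator a ⟨ i ⟩) ⟩
    -± (u ⟨ generator a ⟨ i ⟩ ⟩)  ≡⟨ cong -±_ e ⟩
    -± (generator b ⟨ u ⟨ i ⟩ ⟩)  ≡⟨ ⟨⟩-neg (generator b) (u ⟨ i ⟩) ⟨
    generator b ⟨ -± (u ⟨ i ⟩) ⟩  ≡⟨ cong (generator b ⟨_⟩) (⟨⟩-neg u i) ⟨
    generator b ⟨ u ⟨ -± i ⟩ ⟩ ∎
    where open ≡.≡-Reasoning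
  image-α : SimpleRoot b (u ⟨ α a ⟩) (u ⟨ β a ⟩) → generator b ⟨ u ⟨ α a ⟩ ⟩ ≡ -± (u ⟨ β a ⟩)
  image-α (inj₁ (eα , eβ)) = trans (cong (generator b ⟨_⟩) eα) (trans (generator-α b) (cong -±_ (sym eβ)))
  image-α (inj₂ (eα , eβ)) = trans (cong (generator b ⟨_⟩) eα) (trans (generator-β b) (cong -±_ (sym eβ)))
  image-β : SimpleRoot b (u ⟨ α a ⟩) (u ⟨ β a ⟩) → generator b ⟨ u ⟨ β a ⟩ ⟩ ≡ -± (u ⟨ α a ⟩)
  image-β (inj₁ (eα , eβ)) = trans (cong (generator b ⟨_⟩) eβ) (trans (generator-β b) (cong -±_ (sym eα)))
  image-β (inj₂ (eα , eβ)) = trans (cong (generator b ⟨_⟩) eβ) (trans (generator-α b) (cong -±_ (sym eα)))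
  at-α : Commutes (α a)
  at-α = trans (cong (u ⟨_⟩) (generator-α a)) (trans (⟨⟩-neg u (β a)) (sym (image-α root)))
  at-β : Commutes (β a)
  at-β = trans (cong (u ⟨_⟩) (generator-β a)) (trans (⟨⟩-neg u (α a)) (sym (image-β root)))
  not-simple : SimpleRoot b (u ⟨ α a ⟩) (u ⟨ β a ⟩) → ∀ i → proj₂ i ≢ proj₂ (α a) → proj₂ i ≢ proj₂ (β a) →
               proj₂ (u ⟨ i ⟩) ≢ proj₂ (α b) × proj₂ (u ⟨ i ⟩) ≢ proj₂ (β b)
  not-simple (inj₁ (eα , eβ)) i ≢α ≢β =
    (λ e → ≢α (⟨⟩-index-injective u {i} {α a} (trans e (cong proj₂ (sym eα))))) ,
    (λ e → ≢β (⟨⟩-index-injective u {i} {β a} (trans e (cong proj₂ (sym eβ)))))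
  not-simple (inj₂ (eα , eβ)) i ≢α ≢β =
    (λ e → ≢β (⟨⟩-index-injective u {i} {β a} (trans e (cong proj₂ (sym eβ))))) ,
    (λ e → ≢α (⟨⟩-index-injective u {i} {α a} (trans e (cong proj₂ (sym eα)))))
  commutes : ∀ i → Commutes i
  commutes i with proj₂ i Fin.≟ proj₂ (α a) | proj₂ i Fin.≟ proj₂ (β a)
  ... | no ≢α | no ≢β = trans (cong (u ⟨_⟩) (generator-other a i ≢α ≢β))
                              (let ≢α′ , ≢β′ = not-simple root i ≢α ≢β in sym (generator-other b (u ⟨ i ⟩) ≢α′ ≢β′))
  ... | yes e | _ with same-index {i = i} {α a} e
  ...   | inj₁ refl = at-α
  ...   | inj₂ refl = negate (α a) at-α
  commutes i | no _ | yes e with same-index {i = i} {β a} e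
  ...   | inj₁ refl = at-β
  ...   | inj₂ refl = negate (β a) at-β

positive-simple : (a : Letter n) → ¬ HasSign Sign.- (α a) (β a)
positive-simple (s i) (inj₁ (lt , _)) =
  ℕ.<-asym (ℕ.≤-reflexive (cong suc (Fin.toℕ-inject₁ i))) lt
positive-simple (s i) (inj₂ (_ , ()))
positive-simple ŝ (inj₁ (_ , ()))
positive-simple ŝ (inj₂ (_ , ()))

-- A simple reflection makes only its own simple root negative, so the letter at which the root of a
-- changes sign can be deleted.
exchange-condition : ∀ (as : List (Letter n)) a → HasSign Sign.- (⟦ as ⟧ ⟨ α a ⟩) (⟦ as ⟧ ⟨ β a ⟩) →
                     Σ (List (Letter n)) λ bs → suc (length bs) ≡ length as × ⟦ bs ⟧ ≡ ⟦ as ⟧ ∙ generator a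
exchange-condition [] a neg =
  ⊥-elim (positive-simple a (subst₂ (HasSign Sign.-) (ε-action (α a)) (ε-action (β a)) neg))
exchange-condition {n} (b ∷ as) a neg =
  by-sign (sign? (⟦ as ⟧ ⟨ α a ⟩) (⟦ as ⟧ ⟨ β a ⟩) (λ e → α≢β a (⟨⟩-index-injective ⟦ as ⟧ {α a} {β a} e)))
  where
  open ≡.≡-Reasoning
  neg′ : HasSign Sign.- (generator b ⟨ ⟦ as ⟧ ⟨ α a ⟩ ⟩) (generator b ⟨ ⟦ as ⟧ ⟨ β a ⟩ ⟩)
  neg′ = subst₂ (HasSign Sign.-) (∙-action (generator b) ⟦ as ⟧ (α a)) (∙-action (generator b) ⟦ as ⟧ (β a)) neg
  by-sign : HasSign Sign.+ (⟦ as ⟧ ⟨ α a ⟩) (⟦ as ⟧ ⟨ β a ⟩) ⊎ HasSign Sign.- (⟦ as ⟧ ⟨ α a ⟩) (⟦ as ⟧ ⟨ β a ⟩) →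
            Σ (List (Letter n)) λ bs → suc (length bs) ≡ suc (length as) × ⟦ bs ⟧ ≡ ⟦ b ∷ as ⟧ ∙ generator a
  by-sign (inj₂ neg″) = let bs , e , e′ = exchange-condition as a neg″ in
    b ∷ bs , cong suc e , trans (cong (generator b ∙_) e′) (sym (∙-assoc (generator b) ⟦ as ⟧ (generator a)))
  -- Here the root has become the simple root of `b`, so `⟦ as ⟧` turns the reflection in `a` into
  -- that in `b`; the two copies of `b` cancel and `as` itself is the shorter word.
  by-sign (inj₁ pos) = as , refl , (begin
    ⟦ as ⟧                                    ≡⟨ ∙-identityˡ ⟦ as ⟧ ⟨
    ε ∙ ⟦ as ⟧                                ≡⟨ cong (_∙ ⟦ as ⟧) (generator-involutive b) ⟨
    generator b ∙ generator b ∙ ⟦ as ⟧        ≡⟨ ∙-assoc (generator b) (generator b) ⟦ as ⟧ ⟩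
    generator b ∙ (generator b ∙ ⟦ as ⟧)      ≡⟨ cong (generator b ∙_) (conjugate ⟦ as ⟧ a b (only-simple b pos neg′)) ⟨
    generator b ∙ (⟦ as ⟧ ∙ generator a)      ≡⟨ ∙-assoc (generator b) ⟦ as ⟧ (generator a) ⟨
    generator b ∙ ⟦ as ⟧ ∙ generator a ∎)

⟦⟧-++ : (as bs : List (Letter n)) → ⟦ as ++ bs ⟧ ≡ ⟦ as ⟧ ∙ ⟦ bs ⟧
⟦⟧-++ []       bs = sym (∙-identityˡ ⟦ bs ⟧)
⟦⟧-++ (a ∷ as) bs = trans (cong (generator a ∙_) (⟦⟧-++ as bs)) (sym (∙-assoc (generator a) ⟦ as ⟧ ⟦ bs ⟧))

⟦⟧-∷ʳ : (as : List (Letter n)) (a : Letter n) → ⟦ as ++ a ∷ [] ⟧ ≡ ⟦ as ⟧ ∙ generator a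
⟦⟧-∷ʳ as a = trans (⟦⟧-++ as (a ∷ [])) (cong (⟦ as ⟧ ∙_) (∙-identityʳ (generator a)))

reducedWord : (w : 𝒟 n) → Σ (List (Letter n)) λ as → length as ≡ ℓ w × ⟦ as ⟧ ≡ w
reducedWord w = proj₁ (proj₂ (coxeterLength w))

ℓ-minimal : (w : 𝒟 n) (as : List (Letter n)) → ⟦ as ⟧ ≡ w → ℓ w ≤ length as
ℓ-minimal w = proj₂ (proj₂ (coxeterLength w))

∙-generator-cancel : (w : 𝒟 n) (a : Letter n) → w ∙ generator a ∙ generator a ≡ w
∙-generator-cancel w a = trans (∙-assoc w (generator a) (generator a))
    (trans (cong (w ∙_) (generator-involutive a)) (∙-identityʳ w))

ℓ-generator : (w : 𝒟 n) (a : Letter n) → ℓ (w ∙ generator a) ≤ suc (ℓ w)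
ℓ-generator w a = let as , e , e′ = reducedWord w in
  subst (ℓ (w ∙ generator a) ≤_) (trans (List.length-++ as) (trans (ℕ.+-comm _ 1) (cong suc e)))
    (ℓ-minimal _ (as ++ a ∷ []) (trans (⟦⟧-∷ʳ as a) (cong (_∙ generator a) e′)))

ℓ-generator′ : (w : 𝒟 n) (a : Letter n) → ℓ w ≤ suc (ℓ (w ∙ generator a))
ℓ-generator′ w a = subst (λ v → ℓ v ≤ suc (ℓ (w ∙ generator a))) (∙-generator-cancel w a) (ℓ-generator (w ∙ generator a) a)

negative⇒descent : (w : 𝒟 n) (a : Letter n) → HasSign Sign.- (w ⟨ α a ⟩) (w ⟨ β a ⟩) → ℓ (w ∙ generator a) < ℓ w
negative⇒descent w a neg = let as , e , e′ = reducedWord w in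
  by-exchange as e e′ (exchange-condition as a
    (subst (λ v → HasSign Sign.- (v ⟨ α a ⟩) (v ⟨ β a ⟩)) (sym e′) neg))
  where
  by-exchange : ∀ as → length as ≡ ℓ w → ⟦ as ⟧ ≡ w →
    (Σ (List (Letter _)) λ bs → suc (length bs) ≡ length as × ⟦ bs ⟧ ≡ ⟦ as ⟧ ∙ generator a) →
    ℓ (w ∙ generator a) < ℓ w
  by-exchange as e e′ (bs , e″ , e‴) =
    ℕ.≤-trans (s≤s (ℓ-minimal _ bs (trans e‴ (cong (_∙ generator a) e′)))) (ℕ.≤-reflexive (trans e″ e))

-- Multiplying by `generator a` negates the image of the root, so this is `negative⇒descent` for
-- `w ∙ generator a`.
positive⇒ascent : (w : 𝒟 n) (a : Letter n) → HasSign Sign.+ (w ⟨ α a ⟩) (w ⟨ β a ⟩) → ℓ w < ℓ (w ∙ generator a)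
positive⇒ascent w a pos = subst (λ v → ℓ v < ℓ (w ∙ generator a)) (∙-generator-cancel w a)
  (negative⇒descent (w ∙ generator a) a
    (subst₂ (HasSign Sign.-) (sym (moves (α a) (β a) (generator-α a))) (sym (moves (β a) (α a) (generator-β a)))
            (HasSign-sym (HasSign-neg {i = w ⟨ α a ⟩} {w ⟨ β a ⟩} pos))))
  where
  moves : ∀ i j → generator a ⟨ i ⟩ ≡ -± j → (w ∙ generator a) ⟨ i ⟩ ≡ -± (w ⟨ j ⟩)
  moves i j e = trans (∙-action w (generator a) i) (trans (cong (w ⟨_⟩) e) (⟨⟩-neg w j))

-- Functionals on the free algebra

Word : ℕ → Set
Word n = List (Letter n)

-- A factor is an element of the free algebra on the letters, a list of words with coefficients.
Factor : ℕ → Set → Set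
Factor n V = List (Word n × Poly V)

-- The linear functional T applied to the product of the factors.
apply : List (Factor n V) → (Word n → Poly V) → Poly V
apply []       T = T []
apply (F ∷ Fs) T = ∑ F λ (u , c) → c ⊗ apply Fs (λ r → T (u ++ r))

apply-cong : (Fs : List (Factor n V)) {T U : Word n → Poly V} → (∀ a → T a ≈ U a) → apply Fs T ≈ apply Fs U
apply-cong []       e = e []
apply-cong (F ∷ Fs) e = ∑-cong F λ (u , c) → ⊗-congˡ (apply-cong Fs (λ r → e (u ++ r)))

apply-⊕ : (Fs : List (Factor n V)) {T U : Word n → Poly V} →
          apply Fs (λ a → T a ⊕ U a) ≈ apply Fs T ⊕ apply Fs U
apply-⊕ []       = ≈-refl
apply-⊕ (F ∷ Fs) = ≈-trans
  (∑-cong F λ (u , c) → ≈-trans (⊗-congˡ (apply-⊕ Fs)) (⊗-distribˡ-⊕ _ _ _)) (∑-⊕ F)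

apply-⊗ : ∀ (Fs : List (Factor n V)) c {T : Word n → Poly V} → apply Fs (λ a → c ⊗ T a) ≈ c ⊗ apply Fs T
apply-⊗ []       c = ≈-refl
apply-⊗ (F ∷ Fs) c = ≈-trans
  (∑-cong F λ (u , d) → ≈-trans (⊗-congˡ (apply-⊗ Fs c))
    (solve 3 (λ a b c → (a :* (b :* c)) := (b :* (a :* c))) ≈-refl d c _))
  (≈-sym (∑-⊗ˡ F c))

apply-zero : (Fs : List (Factor n V)) {T : Word n → Poly V} → (∀ a → T a ≈ 𝟘) → apply Fs T ≈ 𝟘
apply-zero []       e = e []
apply-zero (F ∷ Fs) e = ∑-zero F λ (u , c) → ≈-trans (⊗-congˡ (apply-zero Fs (λ r → e (u ++ r)))) (⊗-zeroʳ c)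

apply-∑ : (Fs : List (Factor n V)) (as : List A) {T : A → Word n → Poly V} →
          apply Fs (λ a → ∑ as (λ i → T i a)) ≈ ∑ as (λ i → apply Fs (T i))
apply-∑ Fs []       = apply-zero Fs (λ _ → ≈-refl)
apply-∑ Fs (a ∷ as) = ≈-trans (apply-⊕ Fs) (⊕-congˡ (apply-∑ Fs as))

apply-when : (Fs : List (Factor n V)) {P : Set} (P? : Dec P) {T : Word n → Poly V} →
             apply Fs (λ a → when P? (T a)) ≈ when P? (apply Fs T)
apply-when Fs (yes _) = ≈-refl
apply-when Fs (no _)  = apply-zero Fs (λ _ → ≈-refl)

apply-++ : (Fs Gs : List (Factor n V)) {T : Word n → Poly V} →
           apply (Fs ++ Gs) T ≈ apply Fs (λ a → apply Gs (λ b → T (a ++ b)))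
apply-++ []       Gs = ≈-refl
apply-++ (F ∷ Fs) Gs {T} = ∑-cong F λ (u , c) → ⊗-congˡ (≈-trans (apply-++ Fs Gs)
  (apply-cong Fs λ a → apply-cong Gs λ b → ≡⇒≈ (cong T (sym (List.++-assoc u a b)))))

linear : Letter n × Poly V → Factor n V
linear (a , t) = ([] , 𝟙) ∷ (a ∷ [] , t) ∷ []

apply-linear : (a : Letter n) (t : Poly V) (Fs : List (Factor n V)) {T : Word n → Poly V} →
               apply (linear (a , t) ∷ Fs) T ≈ apply Fs T ⊕ t ⊗ apply Fs (λ r → T (a ∷ r))
apply-linear a t Fs = solve 3 (λ f t g → (:con 1ℚ :* f :+ (t :* g :+ :con 0ℚ)) := (f :+ t :* g)) ≈-refl _ t _

-- Reduced words and the nil-Coxeter algebra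

reduced? : (w : 𝒟 n) (a : Word n) → Dec (IsReducedWordOf w a)
reduced? w a = (⟦ a ⟧ ≟𝒟 w) ×-dec (length a ℕ.≟ ℓ w)

-- As a functional this is the coefficient of u_w after passing to the nil-Coxeter algebra, where a
-- reduced word of v becomes u_v and every other word becomes 0.
reduced : 𝒟 n → Word n → Poly V
reduced w a = when (reduced? w a) 𝟙

length-∷ʳ : (r : List A) (a : A) → length (r ++ a ∷ []) ≡ suc (length r)
length-∷ʳ r a = trans (List.length-++ r) (ℕ.+-comm (length r) 1)

module _ (w : 𝒟 n) (r : Word n) (a : Letter n) where

  -- A generator changes the length by at most one, so dropping the last letter of a shortest word
  -- leaves a shortest word. With the converse below this is the rule that u_v u_a is u_{va} or 0.
  reduced-∷ʳ⁻ : IsReducedWordOf w (r ++ a ∷ []) →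
                ℓ (w ∙ generator a) < ℓ w × IsReducedWordOf (w ∙ generator a) r
  reduced-∷ʳ⁻ (e , l) = shorter , e′ ,
    ℕ.≤-antisym (ℕ.s≤s⁻¹ (subst (_≤ suc (ℓ (w ∙ generator a))) l′ (ℓ-generator′ w a))) (ℓ-minimal _ r e′)
    where
    e′ : ⟦ r ⟧ ≡ w ∙ generator a
    e′ = trans (sym (∙-generator-cancel ⟦ r ⟧ a)) (cong (_∙ generator a) (trans (sym (⟦⟧-∷ʳ r a)) e))
    l′ : ℓ w ≡ suc (length r)
    l′ = trans (sym l) (length-∷ʳ r a)
    shorter : ℓ (w ∙ generator a) < ℓ w
    shorter = subst (ℓ (w ∙ generator a) <_) (sym l′) (s≤s (ℓ-minimal _ r e′))

  reduced-∷ʳ⁺ : ℓ (w ∙ generator a) < ℓ w → IsReducedWordOf (w ∙ generator a) r →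
                IsReducedWordOf w (r ++ a ∷ [])
  reduced-∷ʳ⁺ lt (e , l) =
    trans (⟦⟧-∷ʳ r a) (trans (cong (_∙ generator a) e) (∙-generator-cancel w a)) ,
    trans (length-∷ʳ r a) (trans (cong suc l) (ℕ.≤-antisym lt (ℓ-generator′ w a)))

-- Right multiplication by 1 + t a in the nil-Coxeter algebra, on coefficient functions.
step : (𝒟 n → Poly V) → Letter n × Poly V → 𝒟 n → Poly V
step M (a , t) w = M w ⊕ when (ℓ (w ∙ generator a) ℕ.<? ℓ w) (t ⊗ M (w ∙ generator a))

steps : (𝒟 n → Poly V) → List (Letter n × Poly V) → 𝒟 n → Poly V
steps M []      = M
steps M (l ∷ L) = steps (step M l) L

step-cong : {M N : 𝒟 n → Poly V} (l : Letter n × Poly V) → (∀ w → M w ≈ N w) → ∀ w → step M l w ≈ step N l w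
step-cong (a , t) e w = ⊕-cong (e w) (when-congˡ (ℓ (w ∙ generator a) ℕ.<? ℓ w) (⊗-congˡ (e (w ∙ generator a))))

steps-cong : {M N : 𝒟 n → Poly V} (L : List (Letter n × Poly V)) → (∀ w → M w ≈ N w) → ∀ w → steps M L w ≈ steps N L w
steps-cong []      e = e
steps-cong (l ∷ L) e = steps-cong L (step-cong l e)

steps-++ : (M : 𝒟 n → Poly V) (L L′ : List (Letter n × Poly V)) → steps M (L ++ L′) ≡ steps (steps M L) L′
steps-++ M []      L′ = refl
steps-++ M (l ∷ L) L′ = steps-++ (step M l) L L′

ℓ-ε : ∀ {n} → ℓ (ε {n}) ≡ 0
ℓ-ε {n} = ℕ.n≤0⇒n≡0 (ℓ-minimal (ε {n}) [] refl)

unit : 𝒟 n → Poly V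
unit w = when (w ≟𝒟 ε) 𝟙

-- The induction is on the last factor: `step` multiplies on the right, whereas `apply` consumes
-- factors from the left, and the last-letter recursion for reduced words reconciles the two.
steps-unit : (L : List (Letter n × Poly V)) (w : 𝒟 n) → steps unit L w ≈ apply (map linear L) (reduced w)
steps-unit {n} {V} L = by-last (reverseView L)
  where
  by-last : ∀ {L} → Reverse L → (w : 𝒟 n) → steps unit L w ≈ apply (map linear L) (reduced w)
  by-last [] w = when-cong (w ≟𝒟 ε) (reduced? w [])
    (λ e → sym e , sym (trans (cong ℓ e) (ℓ-ε {n}))) (λ (e , _) → sym e) (λ _ → ≈-refl)
  by-last (L ∶ rev ∶ʳ (a , t)) w = begin
    steps unit (L ++ (a , t) ∷ []) w
      ≡⟨ cong (λ M → M w) (steps-++ unit L ((a , t) ∷ [])) ⟩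
    steps unit L w ⊕ when desc? (t ⊗ steps unit L (w ∙ generator a))
      ≈⟨ ⊕-cong (by-last rev w) (when-congˡ desc? (⊗-congˡ (by-last rev (w ∙ generator a)))) ⟩
    apply Fs (reduced w) ⊕ when desc? (t ⊗ apply Fs (reduced (w ∙ generator a)))
      ≈⟨ ⊕-congˡ (when-⊗ desc?) ⟩
    apply Fs (reduced w) ⊕ t ⊗ when desc? (apply Fs (reduced (w ∙ generator a)))
      ≈⟨ ⊕-congˡ (⊗-congˡ (apply-when Fs desc?)) ⟨
    apply Fs (reduced w) ⊕ t ⊗ apply Fs (λ r → when desc? (reduced (w ∙ generator a) r))
      ≈⟨ ⊕-cong (apply-cong Fs λ r → ≡⇒≈ (cong (reduced w) (List.++-identityʳ r)))
                (⊗-congˡ (apply-cong Fs last-letter)) ⟨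
    apply Fs (λ r → reduced w (r ++ [])) ⊕ t ⊗ apply Fs (λ r → reduced w (r ++ a ∷ []))
      ≈⟨ ⊕-congˡ (apply-⊗ Fs t) ⟨
    apply Fs (λ r → reduced w (r ++ [])) ⊕ apply Fs (λ r → t ⊗ reduced w (r ++ a ∷ []))
      ≈⟨ apply-⊕ Fs ⟨
    apply Fs (λ r → reduced w (r ++ []) ⊕ t ⊗ reduced w (r ++ a ∷ []))
      ≈⟨ apply-cong Fs (λ r → apply-linear a t [] {λ b → reduced w (r ++ b)}) ⟨
    apply Fs (λ r → apply (linear (a , t) ∷ []) (λ b → reduced w (r ++ b)))
      ≈⟨ apply-++ Fs (linear (a , t) ∷ []) ⟨
    apply (Fs ++ linear (a , t) ∷ []) (reduced w)
      ≡⟨ cong (λ Gs → apply Gs (reduced w)) (List.map-++ linear L ((a , t) ∷ [])) ⟨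
    apply (map linear (L ++ (a , t) ∷ [])) (reduced w) ∎
    where
    open ≈-Reasoning
    Fs = map linear L
    desc? = ℓ (w ∙ generator a) ℕ.<? ℓ w
    last-letter : ∀ r → reduced w (r ++ a ∷ []) ≈ when desc? (reduced (w ∙ generator a) r)
    last-letter r = by-descent desc?
      where
      by-descent : ∀ d → reduced {V = V} w (r ++ a ∷ []) ≈ when d (reduced (w ∙ generator a) r)
      by-descent (yes lt) = when-cong (reduced? w _) (reduced? (w ∙ generator a) r)
        (λ red → proj₂ (reduced-∷ʳ⁻ w r a red)) (reduced-∷ʳ⁺ w r a lt) (λ _ → ≈-refl)
      by-descent (no ¬lt) = when-no (reduced? w _) (λ red → ¬lt (proj₁ (reduced-∷ʳ⁻ w r a red)))

-- Evaluations of a Schubert family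

lift : Letter n → Letter (suc n)
lift (s i) = s (inject₁ i)
lift ŝ     = ŝ

embed : ± n → ± (suc n)
embed (σ , i) = σ , inject₁ i

generator-lift : (a : Letter n) (i : ± n) → generator (lift a) ⟨ embed i ⟩ ≡ embed (generator a ⟨ i ⟩)
generator-lift (s i) (σ , j) = trans (generator-s (inject₁ i) σ (inject₁ j))
  (trans (cong (σ ,_) (Fin.toℕ-injective (begin
      _                                       ≡⟨ toℕ-transpose (inject₁ i) (inject₁ j) ⟩
      swap (toℕ (inject₁ i)) (toℕ (inject₁ j)) ≡⟨ cong₂ swap (Fin.toℕ-inject₁ i) (Fin.toℕ-inject₁ j) ⟩
      swap (toℕ i) (toℕ j)                    ≡⟨ toℕ-transpose i j ⟨
      _                                       ≡⟨ Fin.toℕ-inject₁ _ ⟨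
      _ ∎)))
    (cong embed (sym (generator-s i σ j))))
  where open ≡.≡-Reasoning
generator-lift ŝ (σ , zero)        = refl
generator-lift ŝ (σ , suc zero)    = refl
generator-lift ŝ (σ , suc (suc i)) = trans (generator-ŝ σ (inject₁ i)) (cong embed (sym (generator-ŝ σ i)))

generator-lift-last : (a : Letter n) → generator (lift a) ⟨ Sign.+ , fromℕ n ⟩ ≡ (Sign.+ , fromℕ n)
generator-lift-last {suc n} (s i) = trans (generator-s (inject₁ i) Sign.+ (fromℕ (suc n)))
  (cong (Sign.+ ,_) (Fin.toℕ-injective (trans (toℕ-transpose (inject₁ i) (fromℕ (suc n)))
    (swap-other _ (λ e → ℕ.<⇒≢ (ℕ.m<n⇒m<1+n i<n) (sym (trans (sym last) e)))
                  (λ e → ℕ.<⇒≢ (s≤s i<n) (sym (trans (sym last) e)))))))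
  where
  last : toℕ (fromℕ (suc n)) ≡ suc n
  last = Fin.toℕ-fromℕ (suc n)
  i<n : toℕ (inject₁ i) < n
  i<n = subst (_< n) (sym (Fin.toℕ-inject₁ i)) (Fin.toℕ<n i)
generator-lift-last {suc (suc n)} ŝ = generator-ŝ Sign.+ (fromℕ n)

extend-word : (as : List (Letter n)) → Extends ⟦ as ⟧ ⟦ map lift as ⟧
extend-word {n} [] =
  (λ σ i → trans (ε-action (embed (σ , i))) (cong embed (sym (ε-action (σ , i))))) , ε-action (Sign.+ , fromℕ n)
extend-word {n} (a ∷ as) =
  (λ σ i → begin
    ⟦ map lift (a ∷ as) ⟧ ⟨ embed (σ , i) ⟩
      ≡⟨ ∙-action (generator (lift a)) ⟦ map lift as ⟧ (embed (σ , i)) ⟩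
    generator (lift a) ⟨ ⟦ map lift as ⟧ ⟨ embed (σ , i) ⟩ ⟩
      ≡⟨ cong (generator (lift a) ⟨_⟩) (proj₁ (extend-word as) σ i) ⟩
    generator (lift a) ⟨ embed (⟦ as ⟧ ⟨ σ , i ⟩) ⟩             ≡⟨ generator-lift a (⟦ as ⟧ ⟨ σ , i ⟩) ⟩
    embed (generator a ⟨ ⟦ as ⟧ ⟨ σ , i ⟩ ⟩)                    ≡⟨ cong embed (∙-action (generator a) ⟦ as ⟧ (σ , i)) ⟨
    embed (⟦ a ∷ as ⟧ ⟨ σ , i ⟩) ∎) ,
  trans (∙-action (generator (lift a)) ⟦ map lift as ⟧ (Sign.+ , fromℕ n))
        (trans (cong (generator (lift a) ⟨_⟩) (proj₂ (extend-word as))) (generator-lift-last a))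
  where open ≡.≡-Reasoning

-- Lifting a reduced word letter by letter yields bijectivity and evenness of the extended map
-- without further proof.
extension : (w : 𝒟 n) → Σ (𝒟 (suc n)) (Extends w)
extension w = let as , _ , e = reducedWord w in
  ⟦ map lift as ⟧ , subst (λ v → Extends v ⟦ map lift as ⟧) e (extend-word as)

-- In the image of the root the entry of larger absolute value is the new last element, which w′
-- fixes with sign +, so the root stays positive.
extension-ascent : (w : 𝒟 (suc n)) (w′ : 𝒟 (2 + n)) → Extends w w′ →
                   ¬ ℓ (w′ ∙ generator (s (fromℕ n))) < ℓ w′
extension-ascent {n} w w′ (act , fix) lt = ℕ.<-asym lt (positive⇒ascent w′ (s (fromℕ n))
  (subst₂ (HasSign Sign.+) (sym fix) (sym (act Sign.- (fromℕ n)))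
    (inj₂ (subst₂ _<_ (sym (Fin.toℕ-inject₁ _)) (sym (Fin.toℕ-fromℕ (suc n))) (Fin.toℕ<n _) , refl))))

-- Values in ℚ give access to division and to 1 ≠ 0, neither of which can be read off from the
-- generated congruence `_≈_`.
eval : (V → ℚ) → Poly V → ℚ
eval ρ (con q) = q
eval ρ (var v) = ρ v
eval ρ (f ⊕ g) = eval ρ f ℚ.+ eval ρ g
eval ρ (f ⊗ g) = eval ρ f ℚ.* eval ρ g
eval ρ (⊝ f)   = ℚ.- eval ρ f

eval-cong : ∀ (ρ : V → ℚ) {f g} → f ≈ g → eval ρ f ≡ eval ρ g
eval-cong ρ ≈-refl = refl
eval-cong ρ (≈-sym e) = sym (eval-cong ρ e)
eval-cong ρ (≈-trans e e′) = trans (eval-cong ρ e) (eval-cong ρ e′)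
eval-cong ρ (⊕-cong e e′) = cong₂ ℚ._+_ (eval-cong ρ e) (eval-cong ρ e′)
eval-cong ρ (⊗-cong e e′) = cong₂ ℚ._*_ (eval-cong ρ e) (eval-cong ρ e′)
eval-cong ρ (⊝-cong e) = cong ℚ.-_ (eval-cong ρ e)
eval-cong ρ (⊕-assoc f g h) = ℚ.+-assoc (eval ρ f) (eval ρ g) (eval ρ h)
eval-cong ρ (⊕-comm f g) = ℚ.+-comm (eval ρ f) (eval ρ g)
eval-cong ρ (⊕-identityˡ f) = ℚ.+-identityˡ (eval ρ f)
eval-cong ρ (⊝-inverseˡ f) = ℚ.+-inverseˡ (eval ρ f)
eval-cong ρ (⊗-assoc f g h) = ℚ.*-assoc (eval ρ f) (eval ρ g) (eval ρ h)
eval-cong ρ (⊗-comm f g) = ℚ.*-comm (eval ρ f) (eval ρ g)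
eval-cong ρ (⊗-identityˡ f) = ℚ.*-identityˡ (eval ρ f)
eval-cong ρ (⊗-distribˡ-⊕ f g h) = ℚ.*-distribˡ-+ (eval ρ f) (eval ρ g) (eval ρ h)
eval-cong ρ (con-⊕ c d) = refl
eval-cong ρ (con-⊗ c d) = refl

eval-substitute : ∀ (ρ : W → ℚ) (σ : V → Poly W) f → eval ρ (substitute σ f) ≡ eval (eval ρ ∘ σ) f
eval-substitute ρ σ (con q) = refl
eval-substitute ρ σ (var v) = refl
eval-substitute ρ σ (f ⊕ g) = cong₂ ℚ._+_ (eval-substitute ρ σ f) (eval-substitute ρ σ g)
eval-substitute ρ σ (f ⊗ g) = cong₂ ℚ._*_ (eval-substitute ρ σ f) (eval-substitute ρ σ g)
eval-substitute ρ σ (⊝ f)   = cong ℚ.-_ (eval-substitute ρ σ f)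

-- A point off the reflecting hyperplanes z_i = ± z_j.
Regular : (ZP → ℚ) → Set
Regular ρ = ∀ i j → ℚ.∣ ρ (z i) ∣ ≡ ℚ.∣ ρ (z j) ∣ → i ≡ j

regular-point : Σ (ZP → ℚ) Regular
regular-point = ρ , λ i j e → ℤ.+-injective (cong ℚ.↥_ e)
  where
  ρ : ZP → ℚ
  -- The integer i as a fraction in lowest terms, so that equality of absolute values can be tested
  -- on numerators.
  ρ (z i) = mkℚ (ℤ.+ i) 0 (Coprimality.sym (Coprimality.1-coprimeTo i))
  ρ (p j) = 0ℚ

swap-injective : ∀ i {j k} → swap i j ≡ swap i k → j ≡ k
swap-injective i {j} {k} e = trans (sym (swap-involutive i j)) (trans (cong (swap i) e) (swap-involutive i k))

-- The action permutes the z_i up to sign, which is why regularity is expressed by absolute values;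
-- it then excludes zeros of both kinds of denominators.
regular-image : ∀ {ρ} (a : Letter n) → Regular ρ → Regular (eval ρ ∘ image a)
regular-image (s i) reg j k e = swap-injective (toℕ i) (reg _ _ e)
regular-image {ρ = ρ} ŝ reg j k e = swap-injective 0 (reg (swap 0 j) (swap 0 k) (trans (sym (abs j)) (trans e (abs k))))
  where
  abs : ∀ j → ℚ.∣ eval ρ (image ŝ (z j)) ∣ ≡ ℚ.∣ ρ (z (swap 0 j)) ∣
  abs zero          = ℚ.∣-p∣≡∣p∣ (ρ (z 1))
  abs (suc zero)    = ℚ.∣-p∣≡∣p∣ (ρ (z 0))
  abs (suc (suc j)) = refl

ℚ-x-y≡0 : ∀ c d → c ℚ.+ ℚ.- d ≡ 0ℚ → c ≡ d
ℚ-x-y≡0 = GroupProperties.x∙y⁻¹≈ε⇒x≈y ℚ.+-0-group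

regular-denominator : ∀ {ρ} (a : Letter n) → Regular ρ → eval ρ (denominator a) ≢ 0ℚ
regular-denominator {ρ = ρ} (s i) reg e =
  ℕ.1+n≢n (sym (reg (toℕ i) (suc (toℕ i)) (cong ℚ.∣_∣ (ℚ-x-y≡0 (ρ (z (toℕ i))) (ρ (z (suc (toℕ i)))) e))))
regular-denominator {ρ = ρ} ŝ reg e with reg 0 1 (trans (sym (ℚ.∣-p∣≡∣p∣ (ρ (z 0)))) (cong ℚ.∣_∣ (ℚ-x-y≡0 (ℚ.- ρ (z 0)) (ρ (z 1)) e)))
... | ()

*-zero-cancel : ∀ c d → c ≢ 0ℚ → c ℚ.* d ≡ 0ℚ → d ≡ 0ℚ
*-zero-cancel c d c≢0 e = begin
  d                       ≡⟨ ℚ.*-identityˡ d ⟨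
  1ℚ ℚ.* d                ≡⟨ cong (ℚ._* d) (ℚ.*-inverseˡ c) ⟨
  (ℚ.1/ c) ℚ.* c ℚ.* d    ≡⟨ ℚ.*-assoc (ℚ.1/ c) c d ⟩
  (ℚ.1/ c) ℚ.* (c ℚ.* d)  ≡⟨ cong ((ℚ.1/ c) ℚ.*_) e ⟩
  (ℚ.1/ c) ℚ.* 0ℚ         ≡⟨ ℚ.*-zeroʳ (ℚ.1/ c) ⟩
  0ℚ ∎
  where
  open ≡.≡-Reasoning
  instance
    nonZero : ℚ.NonZero c
    nonZero = ℚ.≢-nonZero c≢0

exists-descent : (w : 𝒟 n) → w ≢ ε → Σ (Letter n) λ a → ℓ (w ∙ generator a) < ℓ w
exists-descent w w≢ε = let as , e , e′ = reducedWord w in by-last (reverseView as) e e′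
  where
  by-last : ∀ {as} → Reverse as → length as ≡ ℓ w → ⟦ as ⟧ ≡ w → Σ (Letter _) λ a → ℓ (w ∙ generator a) < ℓ w
  by-last [] _ e = ⊥-elim (w≢ε (sym e))
  by-last (as ∶ _ ∶ʳ a) l e = a , proj₁ (reduced-∷ʳ⁻ w as a (e , l))

-- A bound for the term, not for its class modulo `_≈_`: no z_j with j at or above it is written in
-- the term. It starts the induction in `independent`.
maximum-z : Poly ZP → ℕ
maximum-z (con q)     = 0
maximum-z (var (z i)) = suc i
maximum-z (var (p j)) = 0
maximum-z (f ⊕ g)     = maximum-z f ⊔ maximum-z g
maximum-z (f ⊗ g)     = maximum-z f ⊔ maximum-z g
maximum-z (⊝ f)       = maximum-z f

record AgreeBelow (i : ℕ) (σ τ : ZP → Poly W) : Set where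
  field
    at-z : ∀ j → j < i → σ (z j) ≈ τ (z j)
    at-p : ∀ j → σ (p j) ≈ τ (p j)

open AgreeBelow

substitute-agree : ∀ {i} {σ τ : ZP → Poly W} → AgreeBelow i σ τ → ∀ f → maximum-z f ≤ i → substitute σ f ≈ substitute τ f
substitute-agree ag (con q)     le = ≈-refl
substitute-agree ag (var (z i)) le = at-z ag i le
substitute-agree ag (var (p j)) le = at-p ag j
substitute-agree ag (f ⊕ g)     le = ⊕-cong (substitute-agree ag f (ℕ.m⊔n≤o⇒m≤o _ _ le))
    (substitute-agree ag g (ℕ.m⊔n≤o⇒n≤o _ _ le))
substitute-agree ag (f ⊗ g)     le = ⊗-cong (substitute-agree ag f (ℕ.m⊔n≤o⇒m≤o _ _ le))
    (substitute-agree ag g (ℕ.m⊔n≤o⇒n≤o _ _ le))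
substitute-agree ag (⊝ f)       le = ⊝-cong (substitute-agree ag f le)

transposition : ℕ → ZP → Poly ZP
transposition i (z j) = var (z (swap i j))
transposition i (p j) = var (p j)

-- A polynomial invariant under the exchanges of z_k and z_{k+1} for all k ≥ i does not
-- involve z_k for k ≥ i: a value at z_i can be exchanged with an irrelevant one at z_{i+1}.
independent : (f : Poly ZP) (b : ℕ) → (∀ k → b ≤ k → substitute (transposition k) f ≈ f) →
              ∀ {σ τ : ZP → Poly W} → AgreeBelow b σ τ → substitute σ f ≈ substitute τ f
independent {W} f b inv = from (maximum-z f) b ℕ.≤-refl (ℕ.m≤m+n _ b)
  where
  -- `d` bounds how far i still is below the syntactic bound; at distance 0 no disputed variable is
  -- written in f. The hypothesis for i + 1 is what makes the value at z_{i+1} arbitrary.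
  from : ∀ d i → b ≤ i → maximum-z f ≤ d + i → {σ τ : ZP → Poly W} →
         AgreeBelow i σ τ → substitute σ f ≈ substitute τ f
  from zero    i b≤i le ag = substitute-agree ag f le
  from (suc d) i b≤i le {σ} {τ} ag = begin
    substitute σ f
      ≈⟨ next {σ} {σ₁} (record { at-z = λ j lt → ≡⇒≈ (sym (σ₁-other j (ℕ.<⇒≢ lt))) ; at-p = λ j → ≈-refl }) ⟩
    substitute σ₁ f                                ≈⟨ substitute-cong (inv i b≤i) ⟨
    substitute σ₁ (substitute (transposition i) f) ≡⟨ substitute-∘ σ₁ (transposition i) f ⟩
    substitute (substitute σ₁ ∘ transposition i) f
      ≈⟨ next {substitute σ₁ ∘ transposition i} {τ} (record { at-z = swapped ; at-p = at-p ag }) ⟩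
    substitute τ f ∎
    where
    open ≈-Reasoning
    next : {σ τ : ZP → Poly W} → AgreeBelow (suc i) σ τ → substitute σ f ≈ substitute τ f
    next = from d (suc i) (ℕ.m≤n⇒m≤1+n b≤i) (subst (maximum-z f ≤_) (sym (ℕ.+-suc d i)) le)
    σ₁ : ZP → Poly W
    σ₁ (p j) = σ (p j)
    σ₁ (z j) with j ℕ.≟ suc i
    ... | yes _ = τ (z i)
    ... | no _  = σ (z j)
    σ₁-same : σ₁ (z (suc i)) ≡ τ (z i)
    σ₁-same with suc i ℕ.≟ suc i
    ... | yes _ = refl
    ... | no ne = ⊥-elim (ne refl)
    σ₁-other : ∀ j → j ≢ suc i → σ₁ (z j) ≡ σ (z j)
    σ₁-other j ne with j ℕ.≟ suc i
    ... | yes e = ⊥-elim (ne e)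
    ... | no _  = refl
    swapped : ∀ j → j < suc i → σ₁ (z (swap i j)) ≈ τ (z j)
    swapped j lt with swap i j | swap-view i j
    ... | _ | left          = ≡⇒≈ σ₁-same
    ... | _ | right         = ⊥-elim (ℕ.<-irrefl refl lt)
    ... | _ | other ≢i ≢1+i = ≈-trans (≡⇒≈ (σ₁-other j ≢1+i)) (at-z ag j (ℕ.≤∧≢⇒< (ℕ.s≤s⁻¹ lt) ≢i))

degree>0 : ∀ v → degree v ≢ 0
degree>0 (p j) e = ℕ.1+n≢0 (trans (ℕ.+-comm 1 (2 * j)) e)

-- Consequences of the divided difference equations

module Family (𝔇 : ∀ {n} → 𝒟 n → Poly ZP) (fam : IsSchubertFamily 𝔇) where
  open IsSchubertFamily fam

  -- The divided difference equations solved for the transformed polynomial. Descents and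
  -- nondescents merge into one formula, a `step` with coefficient `⊝ denominator a`.
  divided : (w : 𝒟 n) (a : Letter n) →
            a · 𝔇 w ≈ 𝔇 w ⊕ when (ℓ (w ∙ generator a) ℕ.<? ℓ w) (⊝ denominator a ⊗ 𝔇 (w ∙ generator a))
  divided {n} w a = by-descent (ℓ (w ∙ generator a) ℕ.<? ℓ w)
    where
    rearrange : ∀ {f g} → g ≈ f ⊖ a · f → a · f ≈ f ⊕ ⊝ g
    rearrange {f} e = ≈-trans (solve 2 (λ f g → g := (f :+ (:- (f :+ (:- g))))) ≈-refl f (a · f))
        (⊕-congˡ (⊝-cong (≈-sym e)))
    by-descent : (d : Dec (ℓ (w ∙ generator a) < ℓ w)) →
                 a · 𝔇 w ≈ 𝔇 w ⊕ when d (⊝ denominator a ⊗ 𝔇 (w ∙ generator a))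
    by-descent (yes lt) = ≈-trans (rearrange (descent w a lt))
      (⊕-congˡ (solve 2 (λ f g → (:- (f :* g)) := ((:- f) :* g)) ≈-refl _ _))
    by-descent (no ¬lt) = ≈-trans (rearrange (nondescent w a ¬lt))
      (⊕-congˡ (solve 1 (λ f → (:- (f :* :con 0ℚ)) := :con 0ℚ) ≈-refl _))

  -- For d = 0 the exchange is the last generator of the next larger group; it is an ascent of the
  -- extended element, so its divided difference vanishes. Larger d are reached by extending
  -- further.
  invariant : ∀ d (w : 𝒟 (suc n)) → substitute (transposition (d + n)) (𝔇 w) ≈ 𝔇 w
  invariant {n} zero w = begin
    substitute (transposition n) (𝔇 w)          ≈⟨ substitute-cong (compatible w w′ ext) ⟨
    substitute (transposition n) (𝔇 w′)         ≈⟨ substitute-≗ (λ v → ≡⇒≈ (same v)) (𝔇 w′) ⟩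
    s (fromℕ n) · 𝔇 w′                          ≈⟨ divided w′ (s (fromℕ n)) ⟩
    _ ≈⟨ ⊕-congˡ (when-no (ℓ (w′ ∙ generator (s (fromℕ n))) ℕ.<? ℓ w′) (extension-ascent w w′ ext)) ⟩
    𝔇 w′ ⊕ 𝟘                                    ≈⟨ ⊕-identityʳ _ ⟩
    𝔇 w′                                        ≈⟨ compatible w w′ ext ⟩
    𝔇 w ∎
    where
    open ≈-Reasoning
    w′ = proj₁ (extension w)
    ext = proj₂ (extension w)
    same : ∀ v → transposition n v ≡ image (s (fromℕ n)) v
    same (z j) = cong (λ i → var (z (swap i j))) (sym (Fin.toℕ-fromℕ n))
    same (p j) = refl
  invariant {n} (suc d) w = begin
    substitute (transposition (suc d + n)) (𝔇 w)   ≡⟨ cong (λ i → substitute (transposition i) (𝔇 w)) (sym (ℕ.+-suc d n)) ⟩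
    substitute (transposition (d + suc n)) (𝔇 w)   ≈⟨ substitute-cong (compatible w w′ ext) ⟨
    substitute (transposition (d + suc n)) (𝔇 w′)  ≈⟨ invariant d w′ ⟩
    𝔇 w′                                           ≈⟨ compatible w w′ ext ⟩
    𝔇 w ∎
    where
    open ≈-Reasoning
    w′ = proj₁ (extension w)
    ext = proj₂ (extension w)

  𝔇-independent : (w : 𝒟 (suc n)) {σ τ : ZP → Poly W} → AgreeBelow n σ τ → substitute σ (𝔇 w) ≈ substitute τ (𝔇 w)
  𝔇-independent {n} w = independent (𝔇 w) n λ k n≤k →
    subst (λ i → substitute (transposition i) (𝔇 w) ≈ 𝔇 w) (ℕ.m∸n+n≡m n≤k) (invariant (k ℕ.∸ n) w)

  -- If 𝔇_w were constant, 𝔇_{ws_a} would vanish at all regular points for a descent a, and by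
  -- induction so would 𝔇_ε = 1.
  nonconstant : ∀ l (w : 𝒟 n) → ℓ w ≤ l → w ≢ ε → ∀ c → ¬ (∀ ρ → Regular ρ → eval ρ (𝔇 w) ≡ c)
  nonconstant {n} l w ℓ≤l w≢ε c const = by-descent l ℓ≤l (exists-descent w w≢ε)
    where
    by-descent : ∀ l → ℓ w ≤ l → (Σ (Letter n) λ a → ℓ (w ∙ generator a) < ℓ w) → ⊥
    by-descent zero    le (a , lt) = ℕ.<⇒≱ lt (ℕ.≤-trans le z≤n)
    by-descent (suc l) le (a , lt) = by-identity ((w ∙ generator a) ≟𝒟 ε)
      where
      vanishes : ∀ ρ → Regular ρ → eval ρ (𝔇 (w ∙ generator a)) ≡ 0ℚ
      vanishes ρ reg = *-zero-cancel (eval ρ (denominator a)) _ (regular-denominator a reg) (begin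
        eval ρ (denominator a) ℚ.* eval ρ (𝔇 (w ∙ generator a))  ≡⟨ eval-cong ρ (descent w a lt) ⟩
        eval ρ (𝔇 w) ℚ.+ ℚ.- eval ρ (a · 𝔇 w)
          ≡⟨ cong (λ d → eval ρ (𝔇 w) ℚ.+ ℚ.- d) (eval-substitute ρ (image a) (𝔇 w)) ⟩
        -- Acting by `a` moves the regular point to another regular point, where the value is again
        -- `c`, so the numerator of the divided difference vanishes.
        eval ρ (𝔇 w) ℚ.+ ℚ.- eval (eval ρ ∘ image a) (𝔇 w)
          ≡⟨ cong₂ (λ d e → d ℚ.+ ℚ.- e) (const ρ reg) (const _ (regular-image a reg)) ⟩
        c ℚ.+ ℚ.- c                                              ≡⟨ ℚ.+-inverseʳ c ⟩
        0ℚ ∎)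
        where open ≡.≡-Reasoning
      by-identity : Dec ((w ∙ generator a) ≡ ε) → ⊥
      by-identity (no ≢ε) = nonconstant l (w ∙ generator a) (ℕ.s≤s⁻¹ (ℕ.≤-trans lt le)) ≢ε 0ℚ vanishes
      by-identity (yes e) = 1≢0 (trans (sym (eval-cong ρ (identity {n})))
                                       (trans (cong (λ v → eval ρ (𝔇 v)) (sym e)) (vanishes ρ (proj₂ regular-point))))
        where
        ρ = proj₁ regular-point
        1≢0 : 1ℚ ≢ 0ℚ
        1≢0 ()

  -- A homogeneous polynomial of positive degree vanishes at the origin, but the family only
  -- guarantees that some degree exists. Degree 0 would make 𝔇_w constant, against `nonconstant`.
  constant-term : (w : 𝒟 n) → substitute {W = W} (λ _ → 𝟘) (𝔇 w) ≈ unit w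
  constant-term {n} {W} w = by-identity (w ≟𝒟 ε)
    where
    terms : List (ℚ × List ZP) → Poly ZP
    terms ts = ∑ ts λ (c , m) → con c ⊗ ∏ m var
    positive-degree : ∀ d ts → All (λ (c , m) → sum (map degree m) ≡ suc d) ts → substitute {W = W} (λ _ → 𝟘) (terms ts) ≈ 𝟘
    positive-degree d []                 []       = ≈-refl
    positive-degree d ((c , []) ∷ ts)    (() ∷ _)
    positive-degree d ((c , v ∷ m) ∷ ts) (_ ∷ es) =
      ≈-trans (⊕-cong (≈-trans (⊗-congˡ (⊗-zeroˡ _)) (⊗-zeroʳ _)) (positive-degree d ts es)) (⊕-identityˡ _)
    degree-zero : ∀ ts → All (λ (c , m) → sum (map degree m) ≡ 0) ts → ∀ ρ ρ′ → eval ρ (terms ts) ≡ eval ρ′ (terms ts)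
    degree-zero []                 []       ρ ρ′ = refl
    degree-zero ((c , []) ∷ ts)    (_ ∷ es) ρ ρ′ = cong (c ℚ.* 1ℚ ℚ.+_) (degree-zero ts es ρ ρ′)
    degree-zero ((c , v ∷ m) ∷ ts) (e ∷ es) ρ ρ′ = ⊥-elim (degree>0 v (ℕ.m+n≡0⇒m≡0 (degree v) e))
    by-degree : w ≢ ε → (∃ λ d → Homogeneous degree d (𝔇 w)) → substitute {W = W} (λ _ → 𝟘) (𝔇 w) ≈ 𝟘
    by-degree w≢ε (suc d , ts , es , e) = ≈-trans (substitute-cong e) (positive-degree d ts es)
    by-degree w≢ε (zero  , ts , es , e) = ⊥-elim (nonconstant (ℓ w) w ℕ.≤-refl w≢ε (eval ρ₀ (terms ts))
      (λ ρ _ → trans (eval-cong ρ e) (degree-zero ts es ρ ρ₀)))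
      where ρ₀ = proj₁ regular-point
    by-identity : (d : Dec (w ≡ ε)) → substitute {W = W} (λ _ → 𝟘) (𝔇 w) ≈ when d 𝟙
    by-identity (yes e) = ≈-trans (≡⇒≈ (cong (λ v → substitute (λ _ → 𝟘) (𝔇 v)) e)) (substitute-cong (identity {n}))
    by-identity (no ne) = by-degree ne (homogeneous w)

-- Walks of evaluation points

allFin-suc : ∀ n → allFin (suc n) ≡ zero ∷ map suc (allFin n)
allFin-suc n = cong (zero ∷_) (sym (List.map-tabulate id suc))

reverse-allFin-suc : ∀ n → reverse (allFin (suc n)) ≡ map suc (reverse (allFin n)) ++ zero ∷ []
reverse-allFin-suc n = begin
  reverse (allFin (suc n))                    ≡⟨ cong reverse (allFin-suc n) ⟩
  reverse (zero ∷ map suc (allFin n))         ≡⟨ List.unfold-reverse zero (map suc (allFin n)) ⟩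
  reverse (map suc (allFin n)) ++ zero ∷ []   ≡⟨ cong (_++ zero ∷ []) (List.reverse-map suc (allFin n)) ⟨
  map suc (reverse (allFin n)) ++ zero ∷ [] ∎
  where open ≡.≡-Reasoning

-- A point of the walk: y at z_i, zero at the other z_j with j ≥ r, and b elsewhere.
point : (ℕ → Poly W) → (ℕ → Poly W) → ℕ → Poly W → ℕ → ZP → Poly W
point P b r y i (p j) = P j
point P b r y i (z j) with j ℕ.<? r | j ℕ.≟ i
... | yes _ | _     = b j
... | no _  | yes _ = y
... | no _  | no _  = 𝟘

module _ {P b : ℕ → Poly W} {r : ℕ} {y : Poly W} where

  point-base : ∀ {i j} → j < r → point P b r y i (z j) ≡ b j
  point-base {i} {j} lt with j ℕ.<? r | j ℕ.≟ i
  ... | yes _  | _ = refl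
  ... | no ¬lt | _ = ⊥-elim (¬lt lt)

  point-value : ∀ {i j} → r ≤ j → j ≡ i → point P b r y i (z j) ≡ y
  point-value {i} {j} le e with j ℕ.<? r | j ℕ.≟ i
  ... | yes lt | _      = ⊥-elim (ℕ.<⇒≱ lt le)
  ... | no _   | yes _  = refl
  ... | no _   | no ¬e  = ⊥-elim (¬e e)

  point-zero : ∀ {i j} → r ≤ j → j ≢ i → point P b r y i (z j) ≡ 𝟘
  point-zero {i} {j} le ne with j ℕ.<? r | j ℕ.≟ i
  ... | yes lt | _      = ⊥-elim (ℕ.<⇒≱ lt le)
  ... | no _   | yes e  = ⊥-elim (ne e)
  ... | no _   | no _   = refl

  point-swap : ∀ i → r ≤ i → ∀ v → substitute (point P b r y (suc i)) (transposition i v) ≈ point P b r y i v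
  point-swap i r≤i (p j) = ≈-refl
  point-swap i r≤i (z j) with swap i j | swap-view i j
  ... | _ | left          = ≡⇒≈ (trans (point-value (ℕ.m≤n⇒m≤1+n r≤i) refl) (sym (point-value r≤i refl)))
  ... | _ | right         = ≡⇒≈ (trans (point-zero r≤i (ℕ.1+n≢n ∘ sym)) (sym (point-zero (ℕ.m≤n⇒m≤1+n r≤i) ℕ.1+n≢n)))
  ... | _ | other ≢i ≢1+i = by-base (ℕ.<-≤-connex j r)
    where
    by-base : j < r ⊎ r ≤ j → point P b r y (suc i) (z j) ≈ point P b r y i (z j)
    by-base (inj₁ lt) = ≡⇒≈ (trans (point-base lt) (sym (point-base lt)))
    by-base (inj₂ le) = ≡⇒≈ (trans (point-zero le ≢1+i) (sym (point-zero le ≢i)))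

  point-swap′ : ∀ i → r ≤ i → ∀ v → substitute (point P b r y i) (transposition i v) ≈ point P b r y (suc i) v
  point-swap′ i r≤i (p j) = ≈-refl
  point-swap′ i r≤i (z j) = begin
    point P b r y i (z (swap i j))                ≈⟨ point-swap i r≤i (z (swap i j)) ⟨
    point P b r y (suc i) (z (swap i (swap i j))) ≡⟨ cong (λ l → point P b r y (suc i) (z l)) (swap-involutive i j) ⟩
    point P b r y (suc i) (z j) ∎
    where open ≈-Reasoning

module Walks (𝔇 : ∀ {n} → 𝒟 n → Poly ZP) (fam : IsSchubertFamily 𝔇) {W : Set} where
  open IsSchubertFamily fam
  open Family 𝔇 fam

  value : (ZP → Poly W) → 𝒟 n → Poly W
  value σ w = substitute σ (𝔇 w)

  -- All w are treated at once, since a single step for w already involves `w ∙ generator a`. The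
  -- record keeps both points and the factors visible to unification, which `value` alone would not.
  record Walk (σ : ZP → Poly W) (L : List (Letter n × Poly W)) (τ : ZP → Poly W) : Set where
    constructor walk
    field values : ∀ w → value τ w ≈ steps (value σ) L w

  open Walk public

  infixr 5 _then_
  _then_ : ∀ {σ τ υ} {L L′ : List (Letter n × Poly W)} → Walk σ L τ → Walk τ L′ υ → Walk σ (L ++ L′) υ
  _then_ {σ = σ} {L = L} {L′} f g = walk λ w →
    ≈-trans (values g w) (≈-trans (steps-cong L′ (values f) w) (≡⇒≈ (cong (λ M → M w) (sym (steps-++ (value σ) L L′)))))

  -- This is `divided` evaluated at σ: composing with `image a` moves the point, and the coefficient
  -- becomes the negated value of the denominator.
  walk-step : ∀ {σ τ} (a : Letter n) t → ⊝ substitute σ (denominator a) ≈ t →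
              (∀ v → substitute σ (image a v) ≈ τ v) → Walk σ ((a , t) ∷ []) τ
  values (walk-step {σ = σ} {τ} a t den pt) w = begin
    substitute τ (𝔇 w)                      ≈⟨ substitute-≗ pt (𝔇 w) ⟨
    substitute (substitute σ ∘ image a) (𝔇 w) ≡⟨ substitute-∘ σ (image a) (𝔇 w) ⟨
    substitute σ (a · 𝔇 w)                  ≈⟨ substitute-cong (divided w a) ⟩
    value σ w ⊕ substitute σ (when desc? (⊝ denominator a ⊗ 𝔇 (w ∙ generator a)))
                                            ≈⟨ ⊕-congˡ (when-homo desc? {h = substitute σ} ≈-refl) ⟩
    value σ w ⊕ when desc? (⊝ substitute σ (denominator a) ⊗ value σ (w ∙ generator a))
                                            ≈⟨ ⊕-congˡ (when-congˡ desc? (⊗-congʳ den)) ⟩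
    value σ w ⊕ when desc? (t ⊗ value σ (w ∙ generator a)) ∎
    where
    open ≈-Reasoning
    desc? = ℓ (w ∙ generator a) ℕ.<? ℓ w

  -- A move without any factor: values at z_j with j ≥ n (counted from 0) do not matter for elements
  -- of 𝒟 (suc n). This is how a moving value enters and leaves.
  walk-agree : ∀ {σ τ} → AgreeBelow n σ τ → Walk {suc n} σ [] τ
  walk-agree ag = walk λ w → ≈-sym (𝔇-independent w ag)

  walk-≡ : ∀ {σ τ} {L L′ : List (Letter n × Poly W)} → L ≡ L′ → Walk σ L τ → Walk σ L′ τ
  walk-≡ refl f = f

  module _ {P b : ℕ → Poly W} {r : ℕ} where

    -- Before the move z_i is 0 and z_{i+1} is y, so the negated denominator is y. In `step-up` the
    -- roles are exchanged and it is -y.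
    step-down : ∀ {y} (i : Fin n) → r ≤ toℕ i →
                Walk (point P b r y (suc (toℕ i))) ((s i , y) ∷ []) (point P b r y (toℕ i))
    step-down {y = y} i r≤i = walk-step (s i) y
      (≈-trans (⊝-cong (⊕-cong (≡⇒≈ (point-zero {P = P} {b} {r} {y} r≤i (ℕ.1+n≢n ∘ sym)))
          (⊝-cong (≡⇒≈ (point-value {P = P} {b} {r} {y} (ℕ.m≤n⇒m≤1+n r≤i) refl)))))
               (solve 1 (λ y → (:- (:con 0ℚ :+ (:- y))) := y) ≈-refl y))
      λ { (z j) → point-swap {P = P} {b} {r} {y} (toℕ i) r≤i (z j) ; (p j) → ≈-refl }

    step-up : ∀ {y t} (i : Fin n) → ⊝ y ≈ t → r ≤ toℕ i →
              Walk (point P b r y (toℕ i)) ((s i , t) ∷ []) (point P b r y (suc (toℕ i)))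
    step-up {y = y} {t} i -y≈t r≤i = walk-step (s i) t
      (≈-trans (⊝-cong (⊕-cong (≡⇒≈ (point-value {P = P} {b} {r} {y} r≤i refl))
          (⊝-cong (≡⇒≈ (point-zero {P = P} {b} {r} {y} (ℕ.m≤n⇒m≤1+n r≤i) ℕ.1+n≢n)))))
               (≈-trans (solve 1 (λ y → (:- (y :+ (:- :con 0ℚ))) := (:- y)) ≈-refl y) -y≈t))
      λ { (z j) → point-swap′ {P = P} {b} {r} {y} (toℕ i) r≤i (z j) ; (p j) → ≈-refl }

    start : ∀ {y i j τ} {L : List (Letter n × Poly W)} → i ≡ j →
            Walk (point P b r y i) L τ → Walk (point P b r y j) L τ
    start refl f = f

    end : ∀ {y i j σ} {L : List (Letter n × Poly W)} → i ≡ j →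
          Walk σ L (point P b r y i) → Walk σ L (point P b r y j)
    end refl f = f

    -- The letters are met with falling index while y descends, which is the right-to-left reading
    -- of a row of boxes.
    walk-down : ∀ {y} k q (f : Fin k → Fin n) → r ≤ q → (∀ j → toℕ (f j) ≡ q + toℕ j) →
                Walk (point P b r y (q + k)) (map (λ j → s (f j) , y) (reverse (allFin k))) (point P b r y q)
    walk-down {y = y} zero    q f r≤q e = walk λ w → ≡⇒≈ (cong (λ i → value (point P b r y i) w) (sym (ℕ.+-identityʳ q)))
    walk-down {n = n} {y = y} (suc k) q f r≤q e =
      walk-≡ (sym (trans (cong (map g) (reverse-allFin-suc k))
                  (trans (List.map-++ g (map suc (reverse (allFin k))) (zero ∷ []))
                         (cong (_++ g zero ∷ []) (sym (List.map-∘ (reverse (allFin k))))))))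
        (start (sym (ℕ.+-suc q k))
               (walk-down {y = y} k (suc q) (f ∘ suc) (ℕ.m≤n⇒m≤1+n r≤q) (λ j → trans (e (suc j)) (ℕ.+-suc q (toℕ j))))
         then start (cong suc f0≡q) (end f0≡q (step-down {y = y} (f zero) (subst (r ≤_) (sym f0≡q) r≤q))))
      where
      g : Fin (suc k) → Letter (suc n) × Poly W
      g j = s (f j) , y
      f0≡q : toℕ (f zero) ≡ q
      f0≡q = trans (e zero) (ℕ.+-identityʳ q)

    walk-up : ∀ {y t} k q (f : Fin k → Fin n) → ⊝ y ≈ t → r ≤ q → (∀ j → toℕ (f j) ≡ q + toℕ j) →
              Walk (point P b r y q) (map (λ j → s (f j) , t) (allFin k)) (point P b r y (q + k))
    walk-up {y = y} zero    q f _ r≤q e = walk λ w → ≡⇒≈ (cong (λ i → value (point P b r y i) w) (ℕ.+-identityʳ q))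
    walk-up {n = n} {y = y} {t} (suc k) q f -y≈t r≤q e =
      walk-≡ (sym (trans (cong (map g) (allFin-suc k)) (cong (g zero ∷_) (sym (List.map-∘ (allFin k))))))
        (start f0≡q (end (cong suc f0≡q) (step-up {y = y} (f zero) -y≈t (subst (r ≤_) (sym f0≡q) r≤q)))
         then end (sym (ℕ.+-suc q k))
               (walk-up {y = y} k (suc q) (f ∘ suc) -y≈t (ℕ.m≤n⇒m≤1+n r≤q) (λ j → trans (e (suc j)) (ℕ.+-suc q (toℕ j)))))
      where
      g : Fin (suc k) → Letter (suc n) × Poly W
      g j = s (f j) , t
      f0≡q : toℕ (f zero) ≡ q
      f0≡q = trans (e zero) (ℕ.+-identityʳ q)

-- In the nil-Coxeter algebra the four terms of the corner's product (1 + x u_{s₁})(1 + x u_ŝ) are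
-- its four tiles, the last one being the elbow with two faucets of weight 2.
boxLetters : Box m k → List (Letter (2 + m) × Poly XZ)
boxLetters (corner c)         = (s zero , var (x (toℕ c))) ∷ (ŝ , var (x (toℕ c))) ∷ []
boxLetters b@(stair _ _)      = (boxLetter b , var (boxVariable b)) ∷ []
boxLetters b@(horizontal _ _) = (boxLetter b , var (boxVariable b)) ∷ []
boxLetters b@(vertical _ _)   = (boxLetter b , var (boxVariable b)) ∷ []

Γ-boxes : Fin k → List (Box m k)
Γ-boxes {m = m} c = map (horizontal c) (reverse (allFin m)) ++ corner c ∷ map (vertical c) (allFin m)

stair-row : Fin (suc m) → List (Box m k)
stair-row {m} i = map (stair i) (reverse (allFin (suc m ∸ toℕ i)))

concatMap-map : ∀ {B C : Set} {h : A → B} {f : B → List C} {g : A → C} → (∀ a → f (h a) ≡ g a ∷ []) →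
                ∀ as → concatMap f (map h as) ≡ map g as
concatMap-map e []       = refl
concatMap-map {f = f} e (a ∷ as) = cong₂ _++_ (e a) (concatMap-map {f = f} e as)

Γ-letters : ∀ (c : Fin k) → concatMap boxLetters (Γ-boxes {m = m} c) ≡
  map (λ j → s (suc j) , var (x (toℕ c))) (reverse (allFin m)) ++
  (s zero , var (x (toℕ c))) ∷ (ŝ , var (x (toℕ c))) ∷ map (λ j → s (suc j) , var (x (toℕ c))) (allFin m)
Γ-letters {m = m} c = begin
  concatMap boxLetters (Γ-boxes c)
    ≡⟨ List.concatMap-++ boxLetters (map (horizontal c) (reverse (allFin m))) _ ⟩
  concatMap boxLetters (map (horizontal c) (reverse (allFin m))) ++
  concatMap boxLetters (corner c ∷ map (vertical c) (allFin m))
    ≡⟨ cong₂ (λ as bs → as ++ (s zero , var (x (toℕ c))) ∷ (ŝ , var (x (toℕ c))) ∷ bs)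
           (concatMap-map {h = horizontal c} {boxLetters} (λ _ → refl) (reverse (allFin m)))
           (concatMap-map {h = vertical c} {boxLetters} (λ _ → refl) (allFin m)) ⟩
  _ ∎
  where open ≡.≡-Reasoning

zero-↑ : ∀ j → 𝟘 {V} ↑ (2 * j + 1) ≈ 𝟘
zero-↑ j rewrite ℕ.+-comm (2 * j) 1 = ⊗-zeroˡ _

letter-index : Letter (suc (suc n)) → Fin (suc n)
letter-index (s i) = i
letter-index ŝ     = zero

toℕ-stair : ∀ (i : Fin (suc m)) j → toℕ (letter-index (boxLetter {m} {k} (stair i j))) ≡ toℕ i + toℕ j
toℕ-stair i j = Fin.toℕ-fromℕ< _

-- The walk through the base

module Truncation (𝔇 : ∀ {n} → 𝒟 n → Poly ZP) (fam : IsSchubertFamily 𝔇) where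
  open Walks 𝔇 fam {XZ}
  open Family 𝔇 fam using (constant-term)

  origin : (ℕ → Poly XZ) → ZP → Poly XZ
  origin P (z j) = 𝟘
  origin P (p j) = P j

  walk-block : ∀ (P : ℕ → Poly XZ) (c : Fin k) →
    Walk (origin P) (concatMap boxLetters (Γ-boxes {m = m} c)) (origin (λ j → P j ⊕ var (x (toℕ c)) ↑ (2 * j + 1)))
  walk-block {m = m} P c = walk-≡
      (trans (cong (λ L → map (λ j → s (suc j) , X) (reverse (allFin m)) ++ (s zero , X) ∷ (ŝ , X) ∷ L)
                                 (List.++-identityʳ (map (λ j → s (suc j) , X) (allFin m))))
                           (sym (Γ-letters {m = m} c)))
    (walk-agree (record { at-z = λ j lt → ≡⇒≈ (sym (point-zero {P = P} {b} z≤n (ℕ.<⇒≢ lt))) ; at-p = λ j → ≈-refl })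
     then walk-down {P = P} {b} {y = X} m 1 suc z≤n (λ j → refl)
     then step-down {P = P} {b} {y = X} zero z≤n
     -- Now z₁ = x and z₂ = 0: the negated denominator z₁ + z₂ is x, each p_j gains its odd power of
     -- x, and -x arrives at z₂ rather than z₁. So the way back starts with s₂, as the vertical part
     -- does below the corner, and moving -x upwards gives the coefficient -(-x) = x again.
     then walk-step {τ = point P′ b 0 (⊝ X) 1} ŝ X
       (solve 1 (λ y → (:- ((:- y) :+ (:- :con 0ℚ))) := y) ≈-refl X)
       (λ { (z zero)          → solve 0 ((:- :con 0ℚ) := :con 0ℚ) ≈-refl
          ; (z (suc zero))    → ≈-refl
          ; (z (suc (suc j))) → ≈-refl
          ; (p j) → ⊕-congˡ (≈-trans (⊕-cong (≡⇒≈ (substitute-↑ (point P b 0 X 0) (var (z 0)) (2 * j + 1)))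
                                             (≈-trans (≡⇒≈ (substitute-↑ (point P b 0 X 0) (var (z 1)) (2 * j + 1)))
                                                 (zero-↑ j)))
                                     (⊕-identityʳ _)) })
     then walk-up {P = P′} {b} {y = ⊝ X} {X} m 1 suc (solve 1 (λ y → (:- (:- y)) := y) ≈-refl X) z≤n (λ j → refl)
     then walk-agree (record { at-z = λ j lt → ≡⇒≈ (point-zero {P = P′} {b} z≤n (ℕ.<⇒≢ lt)) ; at-p = λ j → ≈-refl }))
    where
    X : Poly XZ
    X = var (x (toℕ c))
    b P′ : ℕ → Poly XZ
    b j  = 𝟘
    P′ j = P j ⊕ X ↑ (2 * j + 1)

  walk-blocks : ∀ (P : ℕ → Poly XZ) (cs : List (Fin k)) →
    Walk (origin P) (concatMap boxLetters (concatMap (Γ-boxes {m = m}) cs))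
         (origin (λ j → P j ⊕ ∑ cs λ c → var (x (toℕ c)) ↑ (2 * j + 1)))
  walk-blocks P [] = walk-agree (record { at-z = λ j lt → ≈-refl ; at-p = λ j → ≈-sym (⊕-identityʳ _) })
  walk-blocks {m = m} P (c ∷ cs) = walk-≡
    (trans (cong (concatMap boxLetters (Γ-boxes {m = m} c) ++_)
        (List.++-identityʳ (concatMap boxLetters (concatMap (Γ-boxes {m = m}) cs))))
           (sym (List.concatMap-++ boxLetters (Γ-boxes {m = m} c) (concatMap (Γ-boxes {m = m}) cs))))
    (walk-block P c then walk-blocks (λ j → P j ⊕ var (x (toℕ c)) ↑ (2 * j + 1)) cs
     then walk-agree (record { at-z = λ j lt → ≈-refl ; at-p = λ j → ⊕-assoc _ _ _ }))

  -- The point reached after r rows of the staircase: the first r variables have their final values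
  -- and the others are 0. The moving value is 0 here, so position 0 is a placeholder.
  partial : (ℕ → Poly XZ) → ℕ → ZP → Poly XZ
  partial P r = point P (var ∘ z) r 𝟘 0

  partial-zero : ∀ P {r j} → r ≤ j → partial P r (z j) ≡ 𝟘
  partial-zero P {r} {j} le = by-zero (j ℕ.≟ 0)
    where
    by-zero : Dec (j ≡ 0) → partial P r (z j) ≡ 𝟘
    by-zero (yes e) = point-value {P = P} {var ∘ z} le e
    by-zero (no ne) = point-zero {P = P} {var ∘ z} le ne

  walk-row : ∀ (P : ℕ → Poly XZ) (i : Fin (suc m)) →
    Walk (partial P (toℕ i)) (concatMap boxLetters (stair-row {k = k} i)) (partial P (suc (toℕ i)))
  walk-row {m} {k} P i = walk-≡
    (trans (List.++-identityʳ (map (λ j → boxLetter {m} {k} (stair i j) , var (z r)) (reverse (allFin (suc m ∸ r)))))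
           (sym (concatMap-map {h = stair {k = k} i} {boxLetters} (λ _ → refl) (reverse (allFin (suc m ∸ r))))))
    (walk-agree (record { at-z = λ j lt → ≡⇒≈ (enter j lt (ℕ.<-≤-connex j r)) ; at-p = λ j → ≈-refl })
     then start r+m (walk-down {P = P} {var ∘ z} {y = var (z r)} (suc m ∸ r) r
                       (λ j → letter-index (boxLetter {m} {k} (stair i j))) ℕ.≤-refl (toℕ-stair {k = k} i))
     then walk-agree (record { at-z = λ j lt → ≡⇒≈ (leave j (ℕ.<-cmp j r)) ; at-p = λ j → ≈-refl }))
    where
    r = toℕ i
    r+m : r + (suc m ∸ r) ≡ suc m
    r+m = ℕ.m+[n∸m]≡n (ℕ.<⇒≤ (Fin.toℕ<n i))
    enter : ∀ j → j < suc m → j < r ⊎ r ≤ j → partial P r (z j) ≡ point P (var ∘ z) r (var (z r)) (suc m) (z j)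
    enter j _  (inj₁ lt) = trans (point-base {P = P} lt) (sym (point-base {P = P} lt))
    enter j lt (inj₂ le) = trans (partial-zero P le) (sym (point-zero {P = P} le (ℕ.<⇒≢ lt)))
    leave : ∀ j → Tri (j < r) (j ≡ r) (r < j) → point P (var ∘ z) r (var (z r)) r (z j) ≡ partial P (suc r) (z j)
    leave j (tri< lt _ _)   = trans (point-base {P = P} lt) (sym (point-base {P = P} (ℕ.m<n⇒m<1+n lt)))
    leave j (tri≈ _ refl _) = trans (point-value {P = P} {var ∘ z} {r} {var (z r)} {r} ℕ.≤-refl refl)
                                    (sym (point-base {P = P} {var ∘ z} {suc r} {𝟘} {0} ℕ.≤-refl))
    leave j (tri> _ ne gt)  = trans (point-zero {P = P} {var ∘ z} (ℕ.<⇒≤ gt) ne) (sym (partial-zero P gt))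

  walk-rows : ∀ (P : ℕ → Poly XZ) l q (f : Fin l → Fin (suc m)) → (∀ j → toℕ (f j) ≡ q + toℕ j) →
    Walk (partial P q) (concatMap boxLetters (concatMap (stair-row {k = k}) (map f (allFin l)))) (partial P (q + l))
  walk-rows P zero q f e = walk-agree (record
    { at-z = λ j _ → ≡⇒≈ (cong (λ r → partial P r (z j)) (sym (ℕ.+-identityʳ q))) ; at-p = λ j → ≈-refl })
  walk-rows {m} {k} P (suc l) q f e = walk-≡ letters-≡
    (subst (λ r → Walk (partial P r) (concatMap boxLetters (stair-row {k = k} (f zero))) (partial P (suc r))) f0≡q
        (walk-row P (f zero))
     then subst (λ r → Walk (partial P (suc q)) rest (partial P r)) (sym (ℕ.+-suc q l))
            (walk-rows {k = k} P l (suc q) (f ∘ suc) (λ j → trans (e (suc j)) (ℕ.+-suc q (toℕ j)))))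
    where
    rest : List (Letter (2 + m) × Poly XZ)
    rest = concatMap boxLetters (concatMap (stair-row {k = k}) (map (f ∘ suc) (allFin l)))
    f0≡q : toℕ (f zero) ≡ q
    f0≡q = trans (e zero) (ℕ.+-identityʳ q)
    letters-≡ : concatMap boxLetters (stair-row {k = k} (f zero)) ++ rest ≡
                concatMap boxLetters (concatMap (stair-row {k = k}) (map f (allFin (suc l))))
    letters-≡ = begin
      _ ≡⟨ List.concatMap-++ boxLetters (stair-row {k = k} (f zero))
          (concatMap (stair-row {k = k}) (map (f ∘ suc) (allFin l))) ⟨
      concatMap boxLetters (stair-row {k = k} (f zero) ++ concatMap (stair-row {k = k}) (map (f ∘ suc) (allFin l)))
        ≡⟨ cong (λ is → concatMap boxLetters (stair-row {k = k} (f zero) ++ concatMap (stair-row {k = k}) is))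
           (List.map-∘ (allFin l)) ⟩
      concatMap boxLetters (concatMap (stair-row {k = k}) (map f (zero ∷ map suc (allFin l))))
        ≡⟨ cong (λ is → concatMap boxLetters (concatMap (stair-row {k = k}) (map f is))) (allFin-suc l) ⟨
      _ ∎
      where open ≡.≡-Reasoning

  base-letters : ∀ m k → List (Letter (2 + m) × Poly XZ)
  base-letters m k = concatMap boxLetters (base m k)

  -- Gives a name to the substitution that `truncate` defines by an anonymous function.
  truncation-point : ∀ k → Σ (ZP → Poly XZ) λ σ → ∀ f → truncate k f ≡ substitute σ f
  truncation-point k = _ , λ f → refl

  power-sum : ℕ → ℕ → Poly XZ
  power-sum k j = ∑ (reverse (allFin k)) λ c → var (x (toℕ c)) ↑ (2 * j + 1)

  power-sum-upTo : ∀ k j → power-sum k j ≈ ∑ (upTo k) λ i → var (x i) ↑ (2 * j + 1)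
  power-sum-upTo k j = begin
    power-sum k j                                         ≈⟨ ∑-reverse (allFin k) ⟩
    ∑ (allFin k) (λ c → var (x (toℕ c)) ↑ (2 * j + 1))    ≡⟨ ∑-map toℕ (allFin k) ⟨
    ∑ (map toℕ (allFin k)) (λ i → var (x i) ↑ (2 * j + 1))
      ≡⟨ cong (λ is → ∑ is (λ i → var (x i) ↑ (2 * j + 1))) (map-toℕ k) ⟩
    ∑ (upTo k) (λ i → var (x i) ↑ (2 * j + 1)) ∎
    where
    open ≈-Reasoning
    tabulate-applyUpTo : ∀ k (f : ℕ → ℕ) → List.tabulate {n = k} (f ∘ toℕ) ≡ List.applyUpTo f k
    tabulate-applyUpTo zero    f = refl
    tabulate-applyUpTo (suc k) f = cong (f 0 ∷_) (tabulate-applyUpTo k (f ∘ suc))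
    map-toℕ : ∀ k → map toℕ (allFin k) ≡ upTo k
    map-toℕ k = trans (List.map-tabulate id toℕ) (tabulate-applyUpTo k id)

  walk-base : ∀ m k → Walk (λ _ → 𝟘) (base-letters m k) (proj₁ (truncation-point k))
  walk-base m k = walk-≡ letters-≡
    (walk-agree (record { at-z = λ j _ → ≈-refl ; at-p = λ j → ≈-refl })
     then walk-blocks (λ _ → 𝟘) (reverse (allFin k))
     then walk-agree (record { at-z = λ j _ → ≡⇒≈ (sym (partial-zero P {j = j} z≤n)) ; at-p = λ j → ⊕-identityˡ _ })
     then walk-rows {m} {k} P (suc m) 0 id (λ j → refl)
     -- The m + 1 rows have set z_j for j ≤ m (counted from 0); an element of 𝒟 (2 + m) involves no
     -- later variable, so the point may be replaced by the truncation point.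
     then walk-agree (record { at-z = λ j lt → ≡⇒≈ (point-base {P = P} {var ∘ z} lt) ; at-p = power-sum-upTo k }))
    where
    P : ℕ → Poly XZ
    P = power-sum k
    Γs : List (Box m k)
    Γs = concatMap (Γ-boxes {m = m}) (reverse (allFin k))
    letters-≡ : concatMap boxLetters Γs ++
                concatMap boxLetters (concatMap (stair-row {k = k}) (map id (allFin (suc m)))) ++ [] ≡ base-letters m k
    letters-≡ = begin
      _ ≡⟨ cong (λ L → concatMap boxLetters Γs ++ L)
          (List.++-identityʳ (concatMap boxLetters (concatMap (stair-row {k = k}) (map id (allFin (suc m)))))) ⟩
      _ ≡⟨ cong (λ is → concatMap boxLetters Γs ++ concatMap boxLetters (concatMap (stair-row {k = k}) is))
          (List.map-id (allFin (suc m))) ⟩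
      _ ≡⟨ List.concatMap-++ boxLetters Γs (concatMap (stair-row {k = k}) (allFin (suc m))) ⟨
      base-letters m k ∎
      where open ≡.≡-Reasoning

  truncate-≈ : ∀ m k (w : 𝒟 (2 + m)) → truncate k (𝔇 w) ≈ apply (map linear (base-letters m k)) (reduced w)
  truncate-≈ m k w = begin
    truncate k (𝔇 w)                                          ≡⟨ proj₂ (truncation-point k) (𝔇 w) ⟩
    value (proj₁ (truncation-point k)) w                      ≈⟨ values (walk-base m k) w ⟩
    steps (value (λ _ → 𝟘)) (base-letters m k) w              ≈⟨ steps-cong (base-letters m k) constant-term w ⟩
    steps unit (base-letters m k) w                           ≈⟨ steps-unit (base-letters m k) w ⟩
    apply (map linear (base-letters m k)) (reduced w) ∎
    where open ≈-Reasoning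

-- Pipe dreams

-- For an elbow with two faucets both words must satisfy the condition, while the product of factors
-- contains only one of them. This property identifies the two, and it survives fixing a prefix, as
-- the induction over boxes requires.
Commuting : (Word (2 + m) → Set) → Set
Commuting R = ∀ u v → (R (u ++ s zero ∷ ŝ ∷ v) → R (u ++ ŝ ∷ s zero ∷ v)) ×
    (R (u ++ ŝ ∷ s zero ∷ v) → R (u ++ s zero ∷ ŝ ∷ v))

Commuting-prefix : ∀ {R : Word (2 + m) → Set} u → Commuting R → Commuting (R ∘ (u ++_))
Commuting-prefix {R = R} u com v v′ =
  (λ r → subst R (List.++-assoc u v _) (proj₁ (com (u ++ v) v′) (subst R (sym (List.++-assoc u v _)) r))) ,
  (λ r → subst R (List.++-assoc u v _) (proj₂ (com (u ++ v) v′) (subst R (sym (List.++-assoc u v _)) r)))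

module _ (R : Word (2 + m) → Set) (R? : ∀ a → Dec (R a)) where

  fillingSum : (bs : List (Box m k)) → Poly XZ
  fillingSum bs = ∑ (fillings bs) λ D → when (All.all? R? (words D)) (weightMonomial D)

  indicator : Word (2 + m) → Poly XZ
  indicator a = when (R? a) 𝟙

single-word : ∀ (R : Word (2 + m) → Set) u ws →
              (All R (cartesianProductWith _++_ (u ∷ []) ws) → All (R ∘ (u ++_)) ws) ×
              (All (R ∘ (u ++_)) ws → All R (cartesianProductWith _++_ (u ∷ []) ws))
single-word R u ws =
  (λ r → All.map⁻ (All.++⁻ˡ (map (u ++_) ws) r)) , (λ r → All.++⁺ (All.map⁺ r) [])

-- The last hypothesis allows one representative `u` to replace the set of words of the tile.
tileSum : ∀ (R : Word (2 + m) → Set) (R? : ∀ a → Dec (R a)) {b : Box m k} (bs : List (Box m k)) (t : Tile b) u →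
  (∀ ws → (All R (cartesianProductWith _++_ (tileWords t) ws) → All (R ∘ (u ++_)) ws) ×
          (All (R ∘ (u ++_)) ws → All R (cartesianProductWith _++_ (tileWords t) ws))) →
  ∑ (fillings bs) (λ D → when (All.all? R? (words (t ∷ D))) (weightMonomial (t ∷ D))) ≈
  var (boxVariable b) ↑ weight t ⊗ fillingSum (R ∘ (u ++_)) (R? ∘ (u ++_)) bs
tileSum R R? {b} bs t u same = ≈-trans
  (∑-cong (fillings bs) λ D → ≈-trans
    (when-cong (All.all? R? (words (t ∷ D))) (All.all? (R? ∘ (u ++_)) (words D))
               (proj₁ (same (words D))) (proj₂ (same (words D))) (λ _ → ≈-refl))
    (when-⊗ (All.all? (R? ∘ (u ++_)) (words D))))
  (≈-sym (∑-⊗ˡ (fillings bs) (var (boxVariable b) ↑ weight t)))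

-- Choosing a tile for the first box is choosing a term from its one or two factors. The generality
-- in `R` absorbs the letters already read.
fillingSum-≈ : ∀ (bs : List (Box m k)) {R : Word (2 + m) → Set} (R? : ∀ a → Dec (R a)) → Commuting R →
               fillingSum R R? bs ≈ apply (map linear (concatMap boxLetters bs)) (indicator R R?)

private
  plain-box : ∀ (b : Box m k) (bs : List (Box m k)) {R : Word (2 + m) → Set} (R? : ∀ a → Dec (R a)) → Commuting R →
    tiles b ≡ elbow ∷ cross ∷ [] →
    fillingSum R R? (b ∷ bs) ≈ apply (linear (boxLetter b , var (boxVariable b)) ∷ map linear (concatMap boxLetters bs))
        (indicator R R?)
  plain-box b bs {R} R? com e = begin
    fillingSum R R? (b ∷ bs)
      ≈⟨ ∑-cartesianProductWith _∷_ (tiles b) (fillings bs) ⟩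
    ∑ (tiles b) sum-over
      ≡⟨ cong (λ ts → ∑ ts sum-over) e ⟩
    sum-over elbow ⊕ (sum-over cross ⊕ 𝟘)
      ≈⟨ ⊕-cong (tileSum R R? {b} bs elbow [] (single-word R []))
         (⊕-congʳ (tileSum R R? {b} bs cross (boxLetter b ∷ []) (single-word R (boxLetter b ∷ [])))) ⟩
    𝟙 ⊗ fillingSum R R? bs ⊕ ((X ⊗ 𝟙) ⊗ fillingSum (R ∘ (boxLetter b ∷_)) (R? ∘ (boxLetter b ∷_)) bs ⊕ 𝟘)
      ≈⟨ solve 3 (λ f x g → (:con 1ℚ :* f :+ ((x :* :con 1ℚ) :* g :+ :con 0ℚ)) := (f :+ x :* g)) ≈-refl _ X _ ⟩
    fillingSum R R? bs ⊕ X ⊗ fillingSum (R ∘ (boxLetter b ∷_)) (R? ∘ (boxLetter b ∷_)) bs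
      ≈⟨ ⊕-cong (fillingSum-≈ bs R? com)
         (⊗-congˡ (fillingSum-≈ bs (R? ∘ (boxLetter b ∷_)) (Commuting-prefix {R = R} (boxLetter b ∷ []) com))) ⟩
    _ ≈⟨ apply-linear (boxLetter b) X (map linear (concatMap boxLetters bs)) ⟨
    _ ∎
    where
    open ≈-Reasoning
    X : Poly XZ
    X = var (boxVariable b)
    sum-over : Tile b → Poly XZ
    sum-over t = ∑ (fillings bs) (λ D → when (All.all? R? (words (t ∷ D))) (weightMonomial (t ∷ D)))

fillingSum-≈ [] R? com = ≈-trans (⊕-identityʳ _)
  (when-cong (All.all? R? ([] ∷ [])) (R? []) (λ { (r ∷ []) → r }) (λ r → r ∷ []) (λ _ → ≈-refl))
fillingSum-≈ (b@(stair _ _) ∷ bs)      R? com = plain-box b bs R? com refl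
fillingSum-≈ (b@(horizontal _ _) ∷ bs) R? com = plain-box b bs R? com refl
fillingSum-≈ (b@(vertical _ _) ∷ bs)   R? com = plain-box b bs R? com refl
fillingSum-≈ (b@(corner c) ∷ bs) {R} R? com = begin
  fillingSum R R? (b ∷ bs)
    ≈⟨ ∑-cartesianProductWith _∷_ (tiles b) (fillings bs) ⟩
  sum-over elbow ⊕ (sum-over cross ⊕ (sum-over faucetCross ⊕ (sum-over faucetsElbow ⊕ 𝟘)))
    ≈⟨ ⊕-cong (tileSum R R? {b} bs elbow [] (single-word R []))
      (⊕-cong (tileSum R R? {b} bs cross (s zero ∷ []) (single-word R (s zero ∷ [])))
      (⊕-cong (tileSum R R? {b} bs faucetCross (ŝ ∷ []) (single-word R (ŝ ∷ [])))
      (⊕-congʳ (tileSum R R? {b} bs faucetsElbow (s zero ∷ ŝ ∷ []) both-words)))) ⟩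
  𝟙 ⊗ S [] ⊕ ((X ⊗ 𝟙) ⊗ S (s zero ∷ []) ⊕ ((X ⊗ 𝟙) ⊗ S (ŝ ∷ []) ⊕ ((X ⊗ (X ⊗ 𝟙)) ⊗ S (s zero ∷ ŝ ∷ []) ⊕ 𝟘)))
    ≈⟨ solve 5 (λ x f g h j → (:con 1ℚ :* f :+ ((x :* :con 1ℚ) :* g :+
       ((x :* :con 1ℚ) :* h :+ ((x :* (x :* :con 1ℚ)) :* j :+ :con 0ℚ))))
                              := ((f :+ x :* h) :+ x :* (g :+ x :* j))) ≈-refl X _ _ _ _ ⟩
  (S [] ⊕ X ⊗ S (ŝ ∷ [])) ⊕ X ⊗ (S (s zero ∷ []) ⊕ X ⊗ S (s zero ∷ ŝ ∷ []))
    ≈⟨ ⊕-cong (⊕-cong (ih []) (⊗-congˡ (ih (ŝ ∷ []))))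
       (⊗-congˡ (⊕-cong (ih (s zero ∷ [])) (⊗-congˡ (ih (s zero ∷ ŝ ∷ []))))) ⟩
  (T [] ⊕ X ⊗ T (ŝ ∷ [])) ⊕ X ⊗ (T (s zero ∷ []) ⊕ X ⊗ T (s zero ∷ ŝ ∷ []))
    ≈⟨ ⊕-cong (apply-linear ŝ X Fs) (⊗-congˡ (apply-linear ŝ X Fs)) ⟨
  _ ≈⟨ apply-linear (s zero) X (linear (ŝ , X) ∷ Fs) ⟨
  _ ∎
  where
  open ≈-Reasoning
  X : Poly XZ
  X = var (x (toℕ c))
  Fs = map linear (concatMap boxLetters bs)
  S T : Word _ → Poly XZ
  S u = fillingSum (R ∘ (u ++_)) (R? ∘ (u ++_)) bs
  T u = apply Fs (indicator (R ∘ (u ++_)) (R? ∘ (u ++_)))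
  ih : ∀ u → S u ≈ T u
  ih u = fillingSum-≈ bs (R? ∘ (u ++_)) (Commuting-prefix {R = R} u com)
  sum-over : Tile b → Poly XZ
  sum-over t = ∑ (fillings bs) (λ D → when (All.all? R? (words (t ∷ D))) (weightMonomial (t ∷ D)))
  both-words : ∀ ws →
    (All R (cartesianProductWith _++_ (tileWords {b = b} faucetsElbow) ws) → All (R ∘ ((s zero ∷ ŝ ∷ []) ++_)) ws) ×
    (All (R ∘ ((s zero ∷ ŝ ∷ []) ++_)) ws → All R (cartesianProductWith _++_ (tileWords {b = b} faucetsElbow) ws))
  both-words ws =
    (λ r → All.map⁻ (All.++⁻ˡ (map ((s zero ∷ ŝ ∷ []) ++_) ws) r)) ,
    (λ r → All.++⁺ (All.map⁺ r) (All.++⁺ (All.map⁺ (All.map (λ {v} → proj₁ (com [] v)) r)) []))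

-- s₁ exchanges the two entries of the root e₁ + e₂ of ŝ and thus fixes this root, so conjugation by
-- s₁ fixes ŝ.
s₁-ŝ-commute : generator {2 + m} (s zero) ∙ generator ŝ ≡ generator ŝ ∙ generator (s zero)
s₁-ŝ-commute = conjugate (generator (s zero)) ŝ ŝ (inj₂ (refl , refl))

reduced-commuting : (w : 𝒟 (2 + m)) → Commuting (IsReducedWordOf w)
reduced-commuting w u v = (λ (e , l) → trans (sym ≡-words) e , trans (sym ≡-length) l) ,
                          (λ (e , l) → trans ≡-words e , trans ≡-length l)
  where
  ≡-words : ⟦ u ++ s zero ∷ ŝ ∷ v ⟧ ≡ ⟦ u ++ ŝ ∷ s zero ∷ v ⟧
  ≡-words = begin
    ⟦ u ++ s zero ∷ ŝ ∷ v ⟧                               ≡⟨ ⟦⟧-++ u (s zero ∷ ŝ ∷ v) ⟩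
    ⟦ u ⟧ ∙ (generator (s zero) ∙ (generator ŝ ∙ ⟦ v ⟧))
      ≡⟨ cong (⟦ u ⟧ ∙_) (∙-assoc (generator (s zero)) (generator ŝ) ⟦ v ⟧) ⟨
    ⟦ u ⟧ ∙ (generator (s zero) ∙ generator ŝ ∙ ⟦ v ⟧)    ≡⟨ cong (λ t → ⟦ u ⟧ ∙ (t ∙ ⟦ v ⟧)) s₁-ŝ-commute ⟩
    ⟦ u ⟧ ∙ (generator ŝ ∙ generator (s zero) ∙ ⟦ v ⟧)
      ≡⟨ cong (⟦ u ⟧ ∙_) (∙-assoc (generator ŝ) (generator (s zero)) ⟦ v ⟧) ⟩
    ⟦ u ⟧ ∙ (generator ŝ ∙ (generator (s zero) ∙ ⟦ v ⟧))  ≡⟨ ⟦⟧-++ u (ŝ ∷ s zero ∷ v) ⟨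
    ⟦ u ++ ŝ ∷ s zero ∷ v ⟧ ∎
    where open ≡.≡-Reasoning
  ≡-length : length (u ++ s zero ∷ ŝ ∷ v) ≡ length (u ++ ŝ ∷ s zero ∷ v)
  ≡-length = trans (List.length-++ u) (sym (List.length-++ u))

pipeDreamSum-≈ : ∀ k (w : 𝒟 (2 + m)) → pipeDreamSum k w ≈ apply (map linear (concatMap boxLetters (base m k))) (reduced w)
pipeDreamSum-≈ {m} k w = ≈-trans (∑-filter (reducedOfShape? w) (fillings (base m k)))
                                 (fillingSum-≈ (base m k) (reduced? w) (reduced-commuting w))

-- Coefficients of words and factorisations

-- Every element occurs exactly once, in terms of sums.
Enumerates : List A → Set
Enumerates {A} as = ∀ {f : A → Poly XZ} a → (∀ b → b ≢ a → f b ≈ 𝟘) → ∑ as f ≈ f a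

allFin-enumerates : ∀ n → Enumerates (allFin n)
allFin-enumerates (suc n) {f} i e = ≈-trans
  (≡⇒≈ (trans (cong (λ is → ∑ is f) (allFin-suc n)) (cong (f zero ⊕_) (∑-map suc (allFin n))))) (at i e)
  where
  at : ∀ i → (∀ j → j ≢ i → f j ≈ 𝟘) → f zero ⊕ ∑ (allFin n) (f ∘ suc) ≈ f i
  at zero    e = ≈-trans (⊕-congˡ (∑-zero (allFin n) λ j → e (suc j) λ ())) (⊕-identityʳ _)
  at (suc i) e = ≈-trans (⊕-cong (e zero λ ()) (allFin-enumerates n i λ j ne → e (suc j) (ne ∘ Fin.suc-injective)))
      (⊕-identityˡ _)

letters-enumerate : ∀ m → Enumerates (letters (2 + m))
letters-enumerate m ŝ e = ≈-trans
  (⊕-congˡ (≈-trans (≡⇒≈ (∑-map s (allFin (suc m)))) (∑-zero (allFin (suc m)) λ i → e (s i) λ ()))) (⊕-identityʳ _)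
letters-enumerate m (s i) e = ≈-trans
  (⊕-cong (e ŝ λ ()) (≈-trans (≡⇒≈ (∑-map s (allFin (suc m))))
    (allFin-enumerates (suc m) i λ j ne → e (s j) λ { refl → ne refl }))) (⊕-identityˡ _)

signs-enumerate : Enumerates (Sign.+ ∷ Sign.- ∷ [])
signs-enumerate Sign.+ e = ≈-trans (⊕-congˡ (≈-trans (⊕-identityʳ _) (e Sign.- λ ()))) (⊕-identityʳ _)
signs-enumerate Sign.- e = ≈-trans (⊕-cong (e Sign.+ λ ()) (⊕-identityʳ _)) (⊕-identityˡ _)

product-enumerates : ∀ {h : A → B → C} {as bs} → (∀ {a a′ b b′} → h a b ≡ h a′ b′ → a ≡ a′ × b ≡ b′) →
  Enumerates as → Enumerates bs → ∀ {f : C → Poly XZ} a b → (∀ c → c ≢ h a b → f c ≈ 𝟘) →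
  ∑ (cartesianProductWith h as bs) f ≈ f (h a b)
product-enumerates {h = h} {as} {bs} inj enumᵃ enumᵇ a b e = ≈-trans (∑-cartesianProductWith h as bs) (≈-trans
  (enumᵃ a λ a′ ne → ∑-zero bs λ b′ → e (h a′ b′) (λ eq → ne (proj₁ (inj eq))))
  (enumᵇ b λ b′ ne → e (h a b′) (λ eq → ne (proj₂ (inj eq)))))

vectors-enumerate : ∀ {as : List A} → Enumerates as → ∀ l → Enumerates (vectors as l)
vectors-enumerate enum zero    []      e = ⊕-identityʳ _
vectors-enumerate {as = as} enum (suc l) (a ∷ v) e =
  product-enumerates {h = _∷_} {as} {vectors as l} (λ { refl → refl , refl }) enum
      (λ {f} → vectors-enumerate {as = as} enum l {f}) a v e

private
  signed : ∀ n → List (± n)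
  signed n = cartesianProduct (Sign.+ ∷ Sign.- ∷ []) (allFin n)

  -- Gives access to the local function by which elements is defined.
  elements-mapMaybe : ∀ n → Σ (Vec (± n) n → Maybe (𝒟 n)) λ f → elements n ≡ mapMaybe f (vectors (signed n) n)
  elements-mapMaybe n = _ , refl

  element : Vec (± n) n → Maybe (𝒟 n)
  element {n} = proj₁ (elements-mapMaybe n)

  element-window : (w : 𝒟 n) → element (window w) ≡ just w
  element-window (mk𝒟 v b e) with bijective? (oddMap v) | 2 ∣? negatives v
  ... | yes _ | yes _ = refl
  ... | no ¬b | _     = Irrelevant.⊥-elim (¬b b)
  ... | yes _ | no ¬e = Irrelevant.⊥-elim (¬e e)

  window-element : (v : Vec (± n) n) {w : 𝒟 n} → element v ≡ just w → window w ≡ v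
  window-element v e with bijective? (oddMap v) | 2 ∣? negatives v | e
  ... | yes _ | yes _ | refl = refl

elements-enumerate : ∀ n → Enumerates (elements n)
elements-enumerate n {f} w e = begin
  ∑ (elements n) f                                                 ≡⟨ cong (λ ws → ∑ ws f) (proj₂ (elements-mapMaybe n)) ⟩
  ∑ (mapMaybe element (vectors (signed n) n)) f                    ≈⟨ ∑-mapMaybe element (vectors (signed n) n) ⟩
  ∑ (vectors (signed n) n) (λ v → maybe′ f 𝟘 (element v))
    ≈⟨ vectors-enumerate {as = signed n} (λ {f} → signed-enumerates {f}) n (window w)
       (λ v ne → elsewhere v ne (element v) refl) ⟩
  maybe′ f 𝟘 (element (window w))                                  ≡⟨ cong (maybe′ f 𝟘) (element-window w) ⟩
  f w ∎
  where
  open ≈-Reasoning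
  signed-enumerates : Enumerates (signed n)
  signed-enumerates (σ , i) = product-enumerates {h = _,_} {Sign.+ ∷ Sign.- ∷ []} {allFin n} (λ { refl → refl , refl })
    (λ {f} → signs-enumerate {f}) (λ {f} → allFin-enumerates n {f}) σ i
  elsewhere : ∀ v → v ≢ window w → ∀ r → element v ≡ r → maybe′ f 𝟘 r ≈ 𝟘
  elsewhere v ne nothing  eq = ≈-refl
  elsewhere v ne (just u) eq = e u λ u≡w → ne (trans (sym (window-element v eq)) (cong window u≡w))

_≟ˡ_ : (a b : Letter n) → Dec (a ≡ b)
s i ≟ˡ s j = map′ (cong s) (λ { refl → refl }) (i Fin.≟ j)
s i ≟ˡ ŝ   = no λ ()
ŝ   ≟ˡ s j = no λ ()
ŝ   ≟ˡ ŝ   = yes refl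

strip : Word n → Word n → (Word n → Poly XZ) → Poly XZ
strip []      a       g = g a
strip (l ∷ u) []      g = 𝟘
strip (l ∷ u) (b ∷ a) g = when (b ≟ˡ l) (strip u a g)

-- The coefficient of a word in the product in the free algebra, computed by left division by the
-- words of the first factor.
coefficient : List (Factor n XZ) → Word n → Poly XZ
coefficient []       []      = 𝟙
coefficient []       (_ ∷ _) = 𝟘
coefficient (F ∷ Fs) a       = ∑ F λ (u , c) → c ⊗ strip u a (coefficient Fs)

Supported : ℕ → (Word n → Poly XZ) → Set
Supported l T = ∀ a → length a ≢ l → T a ≈ 𝟘

-- The pairing of T with g over all words; it is finite because T will be supported on words of
-- length l.
wordSum : ℕ → (Word n → Poly XZ) → (Word n → Poly XZ) → Poly XZ
wordSum {n} l T g = ∑ (lists (letters n) l) λ a → T a ⊗ g a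

-- Left division by `u` is adjoint to prefixing `u`. Division shortens the words, so the hypothesis
-- that `G` is the pairing with g is made for every length.
wordSum-strip : ∀ (u : Word (2 + m)) l {T g} (G : (Word (2 + m) → Poly XZ) → Poly XZ) →
  (∀ l T → Supported l T → wordSum l T g ≈ G T) → Supported l T →
  wordSum l T (λ a → strip u a g) ≈ G (λ r → T (u ++ r))
wordSum-strip [] l {T} G e supp = e l T supp
wordSum-strip (c ∷ u) zero {T} {g} G e supp = begin
  T [] ⊗ 𝟘 ⊕ 𝟘                       ≈⟨ solve 1 (λ t → (t :* :con 0ℚ :+ :con 0ℚ) := :con 0ℚ) ≈-refl (T []) ⟩
  -- `G` is known only through `e`, so its value at a functional that vanishes is found by pairing
  -- at length 0.
  𝟘                                  ≈⟨ solve 1 (λ t → (:con 0ℚ :* t :+ :con 0ℚ) := :con 0ℚ) ≈-refl (g []) ⟨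
  𝟘 ⊗ g [] ⊕ 𝟘                       ≈⟨ ⊕-congʳ (⊗-congʳ (supp _ λ ())) ⟨
  wordSum 0 (λ r → T (c ∷ u ++ r)) g ≈⟨ e 0 _ (λ a _ → supp _ λ ()) ⟩
  G (λ r → T (c ∷ u ++ r)) ∎
  where open ≈-Reasoning
wordSum-strip {m} (c ∷ u) (suc l) {T} {g} G e supp = begin
  wordSum (suc l) T (λ a → strip (c ∷ u) a g)
    ≈⟨ ∑-cartesianProductWith _∷_ (letters (2 + m)) (lists (letters (2 + m)) l) ⟩
  ∑ (letters (2 + m)) (λ b → ∑ (lists (letters (2 + m)) l) (λ a → T (b ∷ a) ⊗ when (b ≟ˡ c) (strip u a g)))
    ≈⟨ letters-enumerate m c (λ b ne → ∑-zero (lists (letters (2 + m)) l) λ a → ≈-trans (⊗-congˡ (when-no (b ≟ˡ c) ne))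
       (⊗-zeroʳ _)) ⟩
  ∑ (lists (letters (2 + m)) l) (λ a → T (c ∷ a) ⊗ when (c ≟ˡ c) (strip u a g))
    ≈⟨ ∑-cong (lists (letters (2 + m)) l) (λ a → ⊗-congˡ (when-yes (c ≟ˡ c) refl)) ⟩
  wordSum l (T ∘ (c ∷_)) (λ a → strip u a g)
    ≈⟨ wordSum-strip u l {T ∘ (c ∷_)} G e (λ a ne → supp (c ∷ a) (ne ∘ ℕ.suc-injective)) ⟩
  G (λ r → T (c ∷ u ++ r)) ∎
  where open ≈-Reasoning

-- Linearity turns the functional into a sum over words. From here on the middle sum can be treated
-- one word at a time.
wordSum-coefficient : ∀ (Fs : List (Factor (2 + m) XZ)) l T → Supported l T → wordSum l T (coefficient Fs) ≈ apply Fs T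
wordSum-coefficient [] zero T supp = solve 1 (λ t → (t :* :con 1ℚ :+ :con 0ℚ) := t) ≈-refl (T [])
wordSum-coefficient {m} [] (suc l) T supp = begin
  wordSum (suc l) T (coefficient [])
    ≈⟨ ∑-cartesianProductWith _∷_ (letters (2 + m)) (lists (letters (2 + m)) l) ⟩
  _ ≈⟨ ∑-zero (letters (2 + m)) (λ b → ∑-zero (lists (letters (2 + m)) l) λ a → ⊗-zeroʳ _) ⟩
  𝟘 ≈⟨ supp [] (λ ()) ⟨
  T [] ∎
  where open ≈-Reasoning
wordSum-coefficient {m} (F ∷ Fs) l T supp = begin
  wordSum l T (coefficient (F ∷ Fs))
    ≈⟨ ∑-cong ws (λ a → ≈-trans (∑-⊗ˡ F (T a))
       (∑-cong F λ (u , c) → solve 3 (λ t c s → (t :* (c :* s)) := (c :* (t :* s))) ≈-refl (T a) c _)) ⟩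
  ∑ ws (λ a → ∑ F λ (u , c) → c ⊗ (T a ⊗ strip u a (coefficient Fs)))
    ≈⟨ ∑-swap ws F ⟩
  ∑ F (λ (u , c) → ∑ ws λ a → c ⊗ (T a ⊗ strip u a (coefficient Fs)))
    ≈⟨ ∑-cong F (λ (u , c) → ≈-trans (≈-sym (∑-⊗ˡ ws c)) (⊗-congˡ
         (wordSum-strip u l {T} {coefficient Fs} (apply Fs) (wordSum-coefficient Fs) supp))) ⟩
  apply (F ∷ Fs) T ∎
  where
  open ≈-Reasoning
  ws : List (Word (2 + m))
  ws = lists (letters (2 + m)) l

lists-length : ∀ (as : List A) l → All (λ u → length u ≡ l) (lists as l)
lists-length as zero    = refl ∷ []
lists-length as (suc l) = prepend as
  where
  prepend : ∀ bs → All (λ u → length u ≡ suc l) (cartesianProductWith _∷_ bs (lists as l))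
  prepend []       = []
  prepend (b ∷ bs) = All.++⁺ (All.map⁺ (All.map (cong suc) (lists-length as l))) (prepend bs)

-- Agreement with the coefficients is required on reduced words only; the analysis of peaks and of
-- repeated letters depends on this restriction.
R-sum : ∀ (Fs : List (Factor (2 + m) XZ)) (u : 𝒟 (2 + m)) (g : Word (2 + m) → Poly XZ) →
        (∀ a → IsReducedWordOf u a → g a ≈ coefficient Fs a) → ∑ (R u) g ≈ apply Fs (reduced u)
R-sum {m} Fs u g e = begin
  ∑ (R u) g
    ≈⟨ ∑-filter (λ a → ⟦ a ⟧ ≟𝒟 u) (lists (letters (2 + m)) (ℓ u)) ⟩
  ∑ (lists (letters (2 + m)) (ℓ u)) (λ a → when (⟦ a ⟧ ≟𝒟 u) (g a))
    ≈⟨ ∑-cong-All (lists-length (letters (2 + m)) (ℓ u)) (λ a l → ≈-trans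
         (when-cong (⟦ a ⟧ ≟𝒟 u) (reduced? u a) (λ e → e , l) proj₁ (λ e′ → ≈-trans (e a (e′ , l)) (≈-sym (⊗-identityʳ _))))
         (≈-trans (when-⊗ (reduced? u a)) (⊗-comm _ _))) ⟩
  wordSum (ℓ u) (reduced u) (coefficient Fs)
    ≈⟨ wordSum-coefficient Fs (ℓ u) (reduced u) (λ a ne → when-no (reduced? u a) (ne ∘ proj₂)) ⟩
  apply Fs (reduced u) ∎
  where open ≈-Reasoning

-- The constant ½ is 2^{1-2}, the weight 2^{i(α)-o(a)} of a word with one variable and both s₁ and
-- ŝ. Splitting the term x² s₁ŝ evenly between the two orders makes the coefficients match word by
-- word.
cornerFactor : Poly XZ → Factor (2 + m) XZ
cornerFactor t = ([] , 𝟙) ∷ (s zero ∷ [] , t) ∷ (ŝ ∷ [] , t)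
  ∷ (s zero ∷ ŝ ∷ [] , con ½ ⊗ (t ⊗ t)) ∷ (ŝ ∷ s zero ∷ [] , con ½ ⊗ (t ⊗ t)) ∷ []

boxFactor : Box m k → Factor (2 + m) XZ
boxFactor (corner c)         = cornerFactor (var (x (toℕ c)))
boxFactor b@(stair _ _)      = linear (boxLetter b , var (boxVariable b))
boxFactor b@(horizontal _ _) = linear (boxLetter b , var (boxVariable b))
boxFactor b@(vertical _ _)   = linear (boxLetter b , var (boxVariable b))

-- On a functional that does not distinguish s₁ŝ from ŝs₁ the two expansions of a corner agree.
apply-boxFactor : ∀ (bs : List (Box m k)) (T : Word (2 + m) → Poly XZ) →
  (∀ u v → T (u ++ s zero ∷ ŝ ∷ v) ≈ T (u ++ ŝ ∷ s zero ∷ v)) →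
  apply (map boxFactor bs) T ≈ apply (map linear (concatMap boxLetters bs)) T

private
  commute-prefix : ∀ {T : Word (2 + m) → Poly XZ} u → (∀ u v → T (u ++ s zero ∷ ŝ ∷ v) ≈ T (u ++ ŝ ∷ s zero ∷ v)) →
    ∀ v v′ → T (u ++ v ++ s zero ∷ ŝ ∷ v′) ≈ T (u ++ v ++ ŝ ∷ s zero ∷ v′)
  commute-prefix {T = T} u e v v′ = ≈-trans (≡⇒≈ (cong T (sym (List.++-assoc u v _))))
    (≈-trans (e (u ++ v) v′) (≡⇒≈ (cong T (List.++-assoc u v _))))

  linear-box : ∀ (l : Letter (2 + m)) (t : Poly XZ) (bs : List (Box m k)) (T : Word (2 + m) → Poly XZ) →
    (∀ u v → T (u ++ s zero ∷ ŝ ∷ v) ≈ T (u ++ ŝ ∷ s zero ∷ v)) →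
    apply (linear (l , t) ∷ map boxFactor bs) T ≈ apply (linear (l , t) ∷ map linear (concatMap boxLetters bs)) T
  linear-box l t bs T e = ∑-cong (linear (l , t)) λ (u , c) → ⊗-congˡ {f = c}
      (apply-boxFactor bs (T ∘ (u ++_)) (commute-prefix {T = T} u e))

apply-boxFactor []                     T e = ≈-refl
apply-boxFactor (b@(stair _ _) ∷ bs)      T e = linear-box (boxLetter b) (var (boxVariable b)) bs T e
apply-boxFactor (b@(horizontal _ _) ∷ bs) T e = linear-box (boxLetter b) (var (boxVariable b)) bs T e
apply-boxFactor (b@(vertical _ _) ∷ bs)   T e = linear-box (boxLetter b) (var (boxVariable b)) bs T e
apply-boxFactor {m} (b@(corner c) ∷ bs) T e = begin
  apply (cornerFactor X ∷ map boxFactor bs) T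
    ≈⟨ ∑-cong (cornerFactor X) (λ (u , c) → ⊗-congˡ {f = c} (apply-boxFactor bs (T ∘ (u ++_))
       (commute-prefix {T = T} u e))) ⟩
  𝟙 ⊗ S [] ⊕ (X ⊗ S (s zero ∷ []) ⊕ (X ⊗ S (ŝ ∷ []) ⊕ ((con ½ ⊗ (X ⊗ X)) ⊗ S (s zero ∷ ŝ ∷ [])
    ⊕ ((con ½ ⊗ (X ⊗ X)) ⊗ S (ŝ ∷ s zero ∷ []) ⊕ 𝟘))))
    ≈⟨ ⊕-congˡ (⊕-congˡ (⊕-congˡ (⊕-congˡ (⊕-congʳ (⊗-congˡ (apply-cong Fs λ v → ≈-sym (e [] v))))))) ⟩
  𝟙 ⊗ S [] ⊕ (X ⊗ S (s zero ∷ []) ⊕ (X ⊗ S (ŝ ∷ []) ⊕ ((con ½ ⊗ (X ⊗ X)) ⊗ S (s zero ∷ ŝ ∷ [])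
    ⊕ ((con ½ ⊗ (X ⊗ X)) ⊗ S (s zero ∷ ŝ ∷ []) ⊕ 𝟘))))
    ≈⟨ solve 5 (λ x f g h j → (:con 1ℚ :* f :+ (x :* g :+ (x :* h :+
       ((:con ½ :* (x :* x)) :* j :+ ((:con ½ :* (x :* x)) :* j :+ :con 0ℚ)))))
                              := ((f :+ x :* h) :+ x :* (g :+ x :* j))) ≈-refl X _ _ _ _ ⟩
  (S [] ⊕ X ⊗ S (ŝ ∷ [])) ⊕ X ⊗ (S (s zero ∷ []) ⊕ X ⊗ S (s zero ∷ ŝ ∷ []))
    ≈⟨ ⊕-cong (apply-linear ŝ X Fs) (⊗-congˡ (apply-linear ŝ X Fs)) ⟨
  _ ≈⟨ apply-linear (s zero) X (linear (ŝ , X) ∷ Fs) ⟨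
  _ ∎
  where
  open ≈-Reasoning
  X : Poly XZ
  X = var (x (toℕ c))
  Fs = map linear (concatMap boxLetters bs)
  S : Word (2 + m) → Poly XZ
  S u = apply Fs (T ∘ (u ++_))

reduced-commutes : ∀ (w : 𝒟 (2 + m)) u v → reduced w (u ++ s zero ∷ ŝ ∷ v) ≈ reduced {V = XZ} w (u ++ ŝ ∷ s zero ∷ v)
reduced-commutes w u v = when-cong (reduced? w _) (reduced? w _)
  (proj₁ (reduced-commuting w u v)) (proj₂ (reduced-commuting w u v)) (λ _ → ≈-refl)

𝒮-generator : ∀ (v : 𝒟 (suc n)) i → 𝒮 v → 𝒮 (v ∙ generator (s i))
𝒮-generator v i pos j = trans (cong proj₁ (∙-action v (generator (s i)) (Sign.+ , j)))
  (trans (cong (λ y → proj₁ (v ⟨ y ⟩)) (generator-s i Sign.+ j)) (pos _))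

data Plain : Letter n → Set where
  plain : (i : Fin n) → Plain (s i)

plain-word⇒𝒮 : (a : Word n) → All Plain a → 𝒮 ⟦ a ⟧
plain-word⇒𝒮 a = by-last (reverseView a)
  where
  by-last : ∀ {a} → Reverse a → All Plain a → 𝒮 ⟦ a ⟧
  by-last [] [] j = cong proj₁ (ε-action (Sign.+ , j))
  by-last (a ∶ rev ∶ʳ l) ps with All.++⁻ʳ a ps
  ... | plain i ∷ [] = subst 𝒮 (sym (⟦⟧-∷ʳ a (s i))) (𝒮-generator ⟦ a ⟧ i (by-last rev (All.++⁻ˡ a ps)))

-- The last letter of a reduced word is a descent. A permutation with positive values keeps the root
-- e₁ + e₂ positive, so ŝ is an ascent and cannot be this letter.
𝒮⇒plain-word : (v : 𝒟 n) (a : Word n) → 𝒮 v → IsReducedWordOf v a → All Plain a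
𝒮⇒plain-word v a pos red = by-last (reverseView a) v pos red
  where
  by-last : ∀ {a} → Reverse a → (v : 𝒟 _) → 𝒮 v → IsReducedWordOf v a → All Plain a
  by-last [] v pos red = []
  by-last (a ∶ rev ∶ʳ s i) v pos red = All.++⁺
    (by-last rev (v ∙ generator (s i)) (𝒮-generator v i pos) (proj₂ (reduced-∷ʳ⁻ v a (s i) red))) (plain i ∷ [])
  by-last (a ∶ rev ∶ʳ ŝ) v pos red = ⊥-elim (ℕ.<-asym (proj₁ (reduced-∷ʳ⁻ v a ŝ red)) (positive⇒ascent v ŝ positive))
    where
    positive : HasSign Sign.+ (v ⟨ α ŝ ⟩) (v ⟨ β ŝ ⟩)
    positive with sign? (v ⟨ α ŝ ⟩) (v ⟨ β ŝ ⟩) (λ e → α≢β ŝ (⟨⟩-index-injective v {α ŝ} {β ŝ} e))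
    ... | inj₁ e = e
    ... | inj₂ (inj₁ (_ , e)) with trans (sym e) (pos (suc zero))
    ...   | ()
    positive | inj₂ (inj₂ (_ , e)) with trans (sym e) (pos zero)
    ...   | ()

apply-plain : ∀ (L : List (Letter n × Poly XZ)) → All (Plain ∘ proj₁) L → (T : Word n → Poly XZ) →
              (∀ a → All Plain a → T a ≈ 𝟘) → apply (map linear L) T ≈ 𝟘
apply-plain []            []         T e = e [] []
apply-plain ((l , t) ∷ L) (pl ∷ pls) T e = begin
  apply (linear (l , t) ∷ map linear L) T                             ≈⟨ apply-linear l t (map linear L) ⟩
  apply (map linear L) T ⊕ t ⊗ apply (map linear L) (T ∘ (l ∷_))
    ≈⟨ ⊕-cong (apply-plain L pls T e) (⊗-congˡ (apply-plain L pls (T ∘ (l ∷_)) (λ a ps → e (l ∷ a) (pl ∷ ps)))) ⟩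
  𝟘 ⊕ t ⊗ 𝟘
    ≈⟨ solve 1 (λ t → (:con 0ℚ :+ t :* :con 0ℚ) := :con 0ℚ) ≈-refl t ⟩
  𝟘 ∎
  where open ≈-Reasoning

-- Length-additive factorisations

Splits : 𝒟 n → 𝒟 n → 𝒟 n → Set
Splits w u v = u ∙ v ≡ w × ℓ u + ℓ v ≡ ℓ w

splits? : (w u v : 𝒟 n) → Dec (Splits w u v)
splits? w u v = ((u ∙ v) ≟𝒟 w) ×-dec ((ℓ u + ℓ v) ℕ.≟ ℓ w)

-- By subadditivity ℓ w ≤ ℓ ⟦ a ⟧ + ℓ ⟦ b ⟧ ≤ length a + length b = ℓ w, so equality holds
-- throughout.
reduced-split⁻ : ∀ (w : 𝒟 n) a b → IsReducedWordOf w (a ++ b) →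
                 Splits w ⟦ a ⟧ ⟦ b ⟧ × IsReducedWordOf ⟦ a ⟧ a × IsReducedWordOf ⟦ b ⟧ b
reduced-split⁻ w a b (e , l) = (trans (sym (⟦⟧-++ a b)) e , sum≡) , (refl , ℕ.≤-antisym a≤ (ℓ-minimal _ a refl)) ,
                                                                   (refl , ℕ.≤-antisym b≤ (ℓ-minimal _ b refl))
  where
  l′ : length a + length b ≡ ℓ w
  l′ = trans (sym (List.length-++ a)) l
  ℓ-∙ : ∀ u v → ℓ (u ∙ v) ≤ ℓ u + ℓ v
  ℓ-∙ u v = let as , la , ea = reducedWord u ; bs , lb , eb = reducedWord v in
    subst (ℓ (u ∙ v) ≤_) (trans (List.length-++ as) (cong₂ _+_ la lb))
      (ℓ-minimal _ (as ++ bs) (trans (⟦⟧-++ as bs) (cong₂ _∙_ ea eb)))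
  w≤ : ℓ w ≤ ℓ ⟦ a ⟧ + ℓ ⟦ b ⟧
  w≤ = subst (λ v → ℓ v ≤ ℓ ⟦ a ⟧ + ℓ ⟦ b ⟧) (trans (sym (⟦⟧-++ a b)) e) (ℓ-∙ ⟦ a ⟧ ⟦ b ⟧)
  a≤ : length a ≤ ℓ ⟦ a ⟧
  a≤ = ℕ.+-cancelʳ-≤ (length b) _ _
      (subst (_≤ ℓ ⟦ a ⟧ + length b) (sym l′) (ℕ.≤-trans w≤ (ℕ.+-monoʳ-≤ (ℓ ⟦ a ⟧) (ℓ-minimal _ b refl))))
  b≤ : length b ≤ ℓ ⟦ b ⟧
  b≤ = ℕ.+-cancelˡ-≤ (length a) _ _
      (subst (_≤ length a + ℓ ⟦ b ⟧) (sym l′) (ℕ.≤-trans w≤ (ℕ.+-monoˡ-≤ (ℓ ⟦ b ⟧) (ℓ-minimal _ a refl))))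
  sum≡ : ℓ ⟦ a ⟧ + ℓ ⟦ b ⟧ ≡ ℓ w
  sum≡ = ℕ.≤-antisym (subst (ℓ ⟦ a ⟧ + ℓ ⟦ b ⟧ ≤_) l′ (ℕ.+-mono-≤ (ℓ-minimal _ a refl) (ℓ-minimal _ b refl))) w≤

reduced-split⁺ : ∀ (w : 𝒟 n) a b → Splits w ⟦ a ⟧ ⟦ b ⟧ → IsReducedWordOf ⟦ a ⟧ a → IsReducedWordOf ⟦ b ⟧ b →
                 IsReducedWordOf w (a ++ b)
reduced-split⁺ w a b (e , l) (_ , la) (_ , lb) =
  trans (⟦⟧-++ a b) e , trans (List.length-++ a) (trans (cong₂ _+_ la lb) l)

reduced-other : ∀ (u : 𝒟 n) a → u ≢ ⟦ a ⟧ → reduced {V = XZ} u a ≈ 𝟘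
reduced-other u a ne = when-no (reduced? u a) (λ red → ne (sym (proj₁ red)))

-- Only u = ⟦ a ⟧ and v = ⟦ b ⟧ contribute. Summing over all pairs separates the dependence on a
-- from that on b, so that the two groups of factors can be applied independently.
reduced-++ : ∀ (w : 𝒟 n) a b → reduced {V = XZ} w (a ++ b) ≈
  ∑ (elements n) λ u → ∑ (elements n) λ v → when (splits? w u v) (reduced u a ⊗ reduced v b)
reduced-++ {n} w a b = ≈-sym (begin
  ∑ (elements n) (λ u → ∑ (elements n) λ v → when (splits? w u v) (reduced u a ⊗ reduced v b))
    ≈⟨ elements-enumerate n ⟦ a ⟧ (λ u ne → ∑-zero (elements n) λ v →
         when-zero (splits? w u v) (≈-trans (⊗-congʳ (reduced-other u a ne)) (⊗-zeroˡ _))) ⟩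
  ∑ (elements n) (λ v → when (splits? w ⟦ a ⟧ v) (reduced ⟦ a ⟧ a ⊗ reduced v b))
    ≈⟨ elements-enumerate n ⟦ b ⟧ (λ v ne →
         when-zero (splits? w ⟦ a ⟧ v) (≈-trans (⊗-congˡ (reduced-other v b ne)) (⊗-zeroʳ _))) ⟩
  when (splits? w ⟦ a ⟧ ⟦ b ⟧) (reduced ⟦ a ⟧ a ⊗ reduced ⟦ b ⟧ b)
    ≈⟨ combine (splits? w ⟦ a ⟧ ⟦ b ⟧) (reduced? ⟦ a ⟧ a) (reduced? ⟦ b ⟧ b) (reduced? w (a ++ b))
         (reduced-split⁺ w a b) (reduced-split⁻ w a b) ⟩
  reduced w (a ++ b) ∎)
  where
  open ≈-Reasoning
  combine : ∀ {P Q R S : Set} (P? : Dec P) (Q? : Dec Q) (R? : Dec R) (S? : Dec S) →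
            (P → Q → R → S) → (S → P × Q × R) → when P? (when Q? 𝟙 ⊗ when R? 𝟙) ≈ when {V = XZ} S? 𝟙
  combine (yes u) (yes v) (yes w) S? to from = ≈-trans (⊗-identityˡ _) (≈-sym (when-yes S? (to u v w)))
  combine (no ¬u) _       _       S? to from = ≈-sym (when-no S? (¬u ∘ proj₁ ∘ from))
  combine (yes _) (no ¬v) _       S? to from = ≈-trans (⊗-zeroˡ _) (≈-sym (when-no S? (¬v ∘ proj₁ ∘ proj₂ ∘ from)))
  combine (yes _) (yes _) (no ¬w) S? to from = ≈-trans (⊗-zeroʳ _) (≈-sym (when-no S? (¬w ∘ proj₂ ∘ proj₂ ∘ from)))

apply-factorisations : ∀ (Fs Gs : List (Factor n XZ)) (w : 𝒟 n) → apply (Fs ++ Gs) (reduced w) ≈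
  ∑ (elements n) λ u → ∑ (elements n) λ v → when (splits? w u v) (apply Fs (reduced u) ⊗ apply Gs (reduced v))
apply-factorisations {n} Fs Gs w = begin
  apply (Fs ++ Gs) (reduced w)
    ≈⟨ apply-++ Fs Gs ⟩
  apply Fs (λ a → apply Gs (λ b → reduced w (a ++ b)))
    ≈⟨ apply-cong Fs (λ a → ≈-trans (apply-cong Gs (λ b → reduced-++ w a b)) (apply-∑ Gs (elements n))) ⟩
  apply Fs (λ a → ∑ (elements n) λ u → apply Gs λ b → ∑ (elements n) λ v → when (splits? w u v) (reduced u a ⊗ reduced v b))
    ≈⟨ apply-∑ Fs (elements n) ⟩
  ∑ (elements n) (λ u → apply Fs λ a → apply Gs λ b → ∑ (elements n) λ v → when (splits? w u v) (reduced u a ⊗ reduced v b))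
    ≈⟨ ∑-cong (elements n) (λ u → ≈-trans (apply-cong Fs λ a → apply-∑ Gs (elements n)) (apply-∑ Fs (elements n))) ⟩
  ∑ (elements n) (λ u → ∑ (elements n) λ v → apply Fs λ a → apply Gs λ b → when (splits? w u v) (reduced u a ⊗ reduced v b))
    ≈⟨ ∑-cong (elements n) (λ u → ∑-cong (elements n) λ v → factor u v) ⟩
  _ ∎
  where
  open ≈-Reasoning
  factor : ∀ u v → apply Fs (λ a → apply Gs λ b → when (splits? w u v) (reduced u a ⊗ reduced v b)) ≈
                   when (splits? w u v) (apply Fs (reduced u) ⊗ apply Gs (reduced v))
  factor u v = begin
    apply Fs (λ a → apply Gs λ b → when (splits? w u v) (reduced u a ⊗ reduced v b))
      ≈⟨ apply-cong Fs (λ a → ≈-trans (apply-when Gs (splits? w u v))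
         (when-congˡ (splits? w u v) (≈-trans (apply-⊗ Gs (reduced u a)) (⊗-comm _ _)))) ⟩
    apply Fs (λ a → when (splits? w u v) (apply Gs (reduced v) ⊗ reduced u a))
      ≈⟨ apply-when Fs (splits? w u v) ⟩
    when (splits? w u v) (apply Fs (λ a → apply Gs (reduced v) ⊗ reduced u a))
      ≈⟨ when-congˡ (splits? w u v) (≈-trans (apply-⊗ Fs (apply Gs (reduced v))) (⊗-comm _ _)) ⟩
    when (splits? w u v) (apply Fs (reduced u) ⊗ apply Gs (reduced v)) ∎

X-coefficient : ∀ k → Word (2 + m) → Poly XZ
X-coefficient k a = ∑ (𝒜x k a) λ α → con 2^[ variableCount α - o a ] ⊗ x^ α

Z-coefficient : Word n → Poly XZ
Z-coefficient b = ∑ (𝒜z b) z^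

Γ-factors stair-factors : ∀ m k → List (Factor (2 + m) XZ)
Γ-factors m k     = map boxFactor (concatMap (Γ-boxes {m = m}) (reverse (allFin k)))
stair-factors m k = map boxFactor (concatMap (stair-row {m = m} {k}) (allFin (suc m)))

-- Monotone sequences

-- Cuts of a word arise twice: from a product of factors (`coefficient-++`), and from the leading
-- run of equal indices in a monotone sequence (`monotoneSum-split`). Both admissibility proofs
-- match one row or block with one run.
splitSum : List A → (List A → List A → Poly XZ) → Poly XZ
splitSum []      g = g [] []
splitSum (l ∷ a) g = g [] (l ∷ a) ⊕ splitSum a (λ u v → g (l ∷ u) v)

splitSum-cong : ∀ (a : List A) {g h} → (∀ u v → u ++ v ≡ a → g u v ≈ h u v) → splitSum a g ≈ splitSum a h
splitSum-cong []      e = e [] [] refl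
splitSum-cong (l ∷ a) e = ⊕-cong (e [] (l ∷ a) refl) (splitSum-cong a λ u v eq → e (l ∷ u) v (cong (l ∷_) eq))

splitSum-zero : ∀ (a : List A) {g} → (∀ u v → g u v ≈ 𝟘) → splitSum a g ≈ 𝟘
splitSum-zero []      e = e [] []
splitSum-zero (l ∷ a) e = ≈-trans (⊕-cong (e [] (l ∷ a)) (splitSum-zero a λ u v → e (l ∷ u) v)) (⊕-identityˡ 𝟘)

splitSum-⊕ : ∀ (a : List A) {g h} → splitSum a (λ u v → g u v ⊕ h u v) ≈ splitSum a g ⊕ splitSum a h
splitSum-⊕ []      = ≈-refl
splitSum-⊕ (l ∷ a) = ≈-trans (⊕-congˡ (splitSum-⊕ a))
  (solve 4 (λ a b c d → ((a :+ b) :+ (c :+ d)) := ((a :+ c) :+ (b :+ d))) ≈-refl _ _ _ _)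

splitSum-⊗ : ∀ (a : List A) c {g} → splitSum a (λ u v → c ⊗ g u v) ≈ c ⊗ splitSum a g
splitSum-⊗ []      c = ≈-refl
splitSum-⊗ (l ∷ a) c = ≈-trans (⊕-congˡ (splitSum-⊗ a c)) (≈-sym (⊗-distribˡ-⊕ _ _ _))

splitSum-∑ : ∀ (a : List A) (bs : List B) {g : B → List A → List A → Poly XZ} →
             splitSum a (λ u v → ∑ bs (λ b → g b u v)) ≈ ∑ bs (λ b → splitSum a (g b))
splitSum-∑ a []       = splitSum-zero a (λ _ _ → ≈-refl)
splitSum-∑ a (b ∷ bs) = ≈-trans (splitSum-⊕ a) (⊕-congˡ (splitSum-∑ a bs))

splitSum-strip : ∀ (w a : Word n) {g h : Word n → Poly XZ} →
  strip w a (λ r → splitSum r (λ u v → g u ⊗ h v)) ≈ splitSum a (λ u v → strip w u g ⊗ h v)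
splitSum-strip []      a = ≈-refl
splitSum-strip (l ∷ w) [] = ≈-sym (⊗-zeroˡ _)
splitSum-strip (l ∷ w) (b ∷ a) {g} {h} with b ≟ˡ l
... | yes _ = ≈-trans (splitSum-strip w a) (≈-sym (≈-trans (⊕-congʳ (⊗-zeroˡ _)) (⊕-identityˡ _)))
... | no _  = ≈-sym (≈-trans (⊕-cong (⊗-zeroˡ _) (splitSum-zero a λ _ _ → ⊗-zeroˡ _)) (⊕-identityˡ 𝟘))

strip-cong : ∀ (w a : Word n) {g h : Word n → Poly XZ} → (∀ r → g r ≈ h r) → strip w a g ≈ strip w a h
strip-cong []      a       e = e a
strip-cong (l ∷ w) []      e = ≈-refl
strip-cong (l ∷ w) (b ∷ a) e = when-congˡ (b ≟ˡ l) (strip-cong w a e)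

coefficient-++ : ∀ (Fs Gs : List (Factor n XZ)) a →
  coefficient (Fs ++ Gs) a ≈ splitSum a (λ u v → coefficient Fs u ⊗ coefficient Gs v)
coefficient-++ [] Gs []      = ≈-sym (⊗-identityˡ _)
coefficient-++ [] Gs (l ∷ a) = ≈-sym (≈-trans (⊕-cong (⊗-identityˡ _) (splitSum-zero a λ _ _ → ⊗-zeroˡ _)) (⊕-identityʳ _))
coefficient-++ (F ∷ Fs) Gs a = begin
  ∑ F (λ (w , c) → c ⊗ strip w a (coefficient (Fs ++ Gs)))
    ≈⟨ ∑-cong F (λ (w , c) → ⊗-congˡ {f = c} (≈-trans (strip-cong w a (coefficient-++ Fs Gs)) (splitSum-strip w a))) ⟩
  ∑ F (λ (w , c) → c ⊗ splitSum a (λ u v → strip w u (coefficient Fs) ⊗ coefficient Gs v))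
    ≈⟨ ∑-cong F (λ (w , c) → ≈-trans (≈-sym (splitSum-⊗ a c)) (splitSum-cong a λ u v _ → ≈-sym (⊗-assoc c _ _))) ⟩
  ∑ F (λ (w , c) → splitSum a (λ u v → (c ⊗ strip w u (coefficient Fs)) ⊗ coefficient Gs v))
    ≈⟨ splitSum-∑ a F ⟨
  splitSum a (λ u v → ∑ F λ (w , c) → (c ⊗ strip w u (coefficient Fs)) ⊗ coefficient Gs v)
    ≈⟨ splitSum-cong a (λ u v _ → ∑-⊗ʳ F (coefficient Gs v)) ⟨
  splitSum a (λ u v → coefficient (F ∷ Fs) u ⊗ coefficient Gs v) ∎
  where open ≈-Reasoning

coefficient-linear-[] : ∀ (l : Letter n) t Fs → coefficient (linear (l , t) ∷ Fs) [] ≈ coefficient Fs []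
coefficient-linear-[] l t Fs = solve 2 (λ f t → (:con 1ℚ :* f :+ (t :* :con 0ℚ :+ :con 0ℚ)) := f) ≈-refl _ t

coefficient-linear-∷ : ∀ (l : Letter n) t Fs b a →
  coefficient (linear (l , t) ∷ Fs) (b ∷ a) ≈ coefficient Fs (b ∷ a) ⊕ t ⊗ when (b ≟ˡ l) (coefficient Fs a)
coefficient-linear-∷ l t Fs b a = solve 3 (λ f t g → (:con 1ℚ :* f :+ (t :* g :+ :con 0ℚ)) := (f :+ t :* g)) ≈-refl _ t _

module _ {_≺_ : Letter n → Letter n → Set} (≺? : ∀ a b → Dec (a ≺ b)) (asym : ∀ {a b} → a ≺ b → ¬ b ≺ a) where

  open import Data.List.Membership.DecPropositional (_≟ˡ_ {n}) using (_∈?_)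

  Chain : List (Letter n) → Word n → Set
  Chain ls u = AllPairs _≺_ u × All (_∈ ls) u

  chain? : ∀ ls u → Dec (Chain ls u)
  chain? ls u = allPairs? ≺? u ×-dec All.all? (_∈? ls) u

  -- In a product of factors 1 + t l with increasing letters exactly the increasing words occur.
  coefficient-chain : ∀ ls → AllPairs _≺_ ls → ∀ t u →
    coefficient (map (λ l → linear (l , t)) ls) u ≈ when (chain? ls u) (t ↑ length u)
  coefficient-chain []       []           t []      = ≈-refl
  coefficient-chain []       []           t (a ∷ u) = ≈-sym (when-no (chain? [] (a ∷ u)) λ { (_ , () ∷ _) })
  coefficient-chain (l ∷ ls) (l≺ ∷ sorted) t []      =
    ≈-trans (coefficient-linear-[] l t (map (λ l → linear (l , t)) ls)) (coefficient-chain ls sorted t [])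
  coefficient-chain (l ∷ ls) (l≺ ∷ sorted) t (a ∷ u) =
    ≈-trans (coefficient-linear-∷ l t Fs a u) (by-head (a ≟ˡ l))
    where
    Fs = map (λ l → linear (l , t)) ls
    -- If the word starts with a letter beyond `l`, then `l` cannot occur later, for it would both
    -- precede and follow `a`.
    rest : a ≢ l → Chain (l ∷ ls) (a ∷ u) → Chain ls (a ∷ u)
    rest ne (a≺ ∷ ap , there a∈ ∷ ∈s) = a≺ ∷ ap , a∈ ∷ All.map strengthen (All.zip (a≺ , ∈s))
      where
      strengthen : ∀ {b} → a ≺ b × b ∈ l ∷ ls → b ∈ ls
      strengthen (a≺b , here refl) = ⊥-elim (asym a≺b (All.lookup l≺ a∈))
      strengthen (a≺b , there b∈)  = b∈
    rest ne (_ , here e ∷ _) = ⊥-elim (ne e)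
    by-head : (d : Dec (a ≡ l)) → coefficient Fs (a ∷ u) ⊕ t ⊗ when d (coefficient Fs u) ≈
              when (chain? (l ∷ ls) (a ∷ u)) (t ↑ length (a ∷ u))
    by-head (no ne) = begin
      coefficient Fs (a ∷ u) ⊕ t ⊗ 𝟘 ≈⟨ ≈-trans (⊕-congˡ (⊗-zeroʳ t)) (⊕-identityʳ _) ⟩
      coefficient Fs (a ∷ u)         ≈⟨ coefficient-chain ls sorted t (a ∷ u) ⟩
      _ ≈⟨ when-cong (chain? ls (a ∷ u)) (chain? (l ∷ ls) (a ∷ u)) (λ (ap , ∈s) → ap , All.map there ∈s) (rest ne)
          (λ _ → ≈-refl) ⟩
      _ ∎
      where open ≈-Reasoning
    by-head (yes refl) = begin
      coefficient Fs (a ∷ u) ⊕ t ⊗ coefficient Fs u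
        ≈⟨ ⊕-cong (≈-trans (coefficient-chain ls sorted t (a ∷ u))
           (when-no (chain? ls (a ∷ u)) λ { (_ , a∈ ∷ _) → asym (All.lookup l≺ a∈) (All.lookup l≺ a∈) }))
                  (⊗-congˡ (coefficient-chain ls sorted t u)) ⟩
      𝟘 ⊕ t ⊗ when (chain? ls u) (t ↑ length u)
        ≈⟨ ≈-trans (⊕-identityˡ _) (≈-sym (when-⊗ (chain? ls u))) ⟩
      when (chain? ls u) (t ⊗ t ↑ length u)
        ≈⟨ when-cong (chain? ls u) (chain? (a ∷ ls) (a ∷ u))
             (λ (ap , ∈s) → All.map (All.lookup l≺) ∈s ∷ ap , here refl ∷ All.map there ∈s)
             (λ { (a≺ ∷ ap , _ ∷ ∈s) → ap , All.map strengthen (All.zip (a≺ , ∈s)) }) (λ _ → ≈-refl) ⟩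
      when (chain? (a ∷ ls) (a ∷ u)) (t ⊗ t ↑ length u) ∎
      where
      open ≈-Reasoning
      strengthen : ∀ {b} → a ≺ b × b ∈ a ∷ ls → b ∈ ls
      strengthen (a≺b , here refl) = ⊥-elim (asym a≺b a≺b)
      strengthen (a≺b , there b∈)  = b∈

-- Sums over the weakly monotone sequences of length l with entries in cs.
monotoneSum : List A → ℕ → (List A → Poly XZ) → Poly XZ
monotoneSum []       zero    f = f []
monotoneSum []       (suc l) f = 𝟘
monotoneSum (c ∷ cs) zero    f = f []
monotoneSum (c ∷ cs) (suc l) f = monotoneSum (c ∷ cs) l (f ∘ (c ∷_)) ⊕ monotoneSum cs (suc l) f

monotoneSum-cong : ∀ {P : A → Set} (cs : List A) → All P cs → ∀ l {f g} →
  (∀ js → All P js → length js ≡ l → f js ≈ g js) → monotoneSum cs l f ≈ monotoneSum cs l g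
monotoneSum-cong []       ps       zero    e = e [] [] refl
monotoneSum-cong []       ps       (suc l) e = ≈-refl
monotoneSum-cong (c ∷ cs) ps       zero    e = e [] [] refl
monotoneSum-cong (c ∷ cs) (pc ∷ ps) (suc l) e = ⊕-cong
  (monotoneSum-cong (c ∷ cs) (pc ∷ ps) l λ js pjs len → e (c ∷ js) (pc ∷ pjs) (cong suc len))
  (monotoneSum-cong cs ps (suc l) e)

monotoneSum-⊗ : ∀ (cs : List A) l t {f} → monotoneSum cs l (λ js → t ⊗ f js) ≈ t ⊗ monotoneSum cs l f
monotoneSum-⊗ []       zero    t = ≈-refl
monotoneSum-⊗ []       (suc l) t = ≈-sym (⊗-zeroʳ t)
monotoneSum-⊗ (c ∷ cs) zero    t = ≈-refl
monotoneSum-⊗ (c ∷ cs) (suc l) t =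
  ≈-trans (⊕-cong (monotoneSum-⊗ (c ∷ cs) l t) (monotoneSum-⊗ cs (suc l) t)) (≈-sym (⊗-distribˡ-⊕ _ _ _))

monotoneSum-split : ∀ (c : A) cs (a : List B) {f} → monotoneSum (c ∷ cs) (length a) f ≈
  splitSum a (λ u v → monotoneSum cs (length v) (λ js → f (replicate (length u) c ++ js)))
monotoneSum-split c []       []      = ≈-refl
monotoneSum-split c (_ ∷ cs) []      = ≈-refl
monotoneSum-split c cs       (l ∷ a) = ≈-trans (⊕-comm _ _) (⊕-congˡ (monotoneSum-split c cs a))

module _ {_≼_ : A → A → Set} (≼? : ∀ i j → Dec (i ≼ j)) (≼-refl : ∀ {i} → i ≼ i) where

  private
    linkedSum : List A → ℕ → A → (List A → Poly XZ) → Poly XZ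
    linkedSum cs l b f = ∑ (lists cs l) λ js → when (linked? ≼? (b ∷ js)) (f js)

    linked-∷ : ∀ b j js {f : Poly XZ} → when (linked? ≼? (b ∷ j ∷ js)) f ≈ when (≼? b j) (when (linked? ≼? (j ∷ js)) f)
    linked-∷ b j js = ≈-trans
      (when-cong (linked? ≼? (b ∷ j ∷ js)) (≼? b j ×-dec linked? ≼? (j ∷ js)) (λ { (e ∷ es) → e , es }) (λ (e , es) → e ∷ es)
          (λ _ → ≈-refl))
      (when-× (≼? b j) (linked? ≼? (j ∷ js)))

    linkedSum-suc : ∀ cs l b {f} → linkedSum cs (suc l) b f ≈ ∑ cs (λ j → when (≼? b j) (linkedSum cs l j (f ∘ (j ∷_))))
    linkedSum-suc cs l b = ≈-trans (∑-cartesianProductWith _∷_ cs (lists cs l))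
      (∑-cong cs λ j → ≈-trans (∑-cong (lists cs l) λ js → linked-∷ b j js) (≈-sym (when-∑ (≼? b j))))
      where
      when-∑ : ∀ {P : Set} (P? : Dec P) {g} → when P? (∑ (lists cs l) g) ≈ ∑ (lists cs l) (λ js → when P? (g js))
      when-∑ (yes _) = ≈-refl
      when-∑ (no _)  = ≈-sym (∑-zero (lists cs l) λ _ → ≈-refl)

    linkedSum-drop : ∀ c cs → All (λ j → ¬ j ≼ c) cs → ∀ l b {f} → ¬ b ≼ c → linkedSum (c ∷ cs) l b f ≈ linkedSum cs l b f
    linkedSum-drop c cs gt zero    b b⋠c = ≈-refl
    linkedSum-drop c cs gt (suc l) b b⋠c = ≈-trans (linkedSum-suc (c ∷ cs) l b) (≈-trans
      (≈-trans (⊕-cong (when-no (≼? b c) b⋠c) (∑-cong-All gt λ j j⋠c → when-congˡ (≼? b j) (linkedSum-drop c cs gt l j j⋠c)))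
          (⊕-identityˡ _))
      (≈-sym (linkedSum-suc cs l b)))

    linkedSum-≈ : ∀ cs → AllPairs (λ c j → c ≼ j × ¬ j ≼ c) cs → ∀ l b {f} → All (b ≼_) cs →
        linkedSum cs l b f ≈ monotoneSum cs l f
    linkedSum-≈ []       sorted       zero    b b≼ = ⊕-identityʳ _
    linkedSum-≈ []       sorted       (suc l) b b≼ = ≈-refl
    linkedSum-≈ (c ∷ cs) sorted       zero    b b≼ = ⊕-identityʳ _
    linkedSum-≈ (c ∷ cs) (c≺ ∷ sorted) (suc l) b {f} (b≼c ∷ b≼) = begin
      linkedSum (c ∷ cs) (suc l) b f
        ≈⟨ linkedSum-suc (c ∷ cs) l b ⟩
      when (≼? b c) (linkedSum (c ∷ cs) l c (f ∘ (c ∷_))) ⊕ ∑ cs (λ j → when (≼? b j) (linkedSum (c ∷ cs) l j (f ∘ (j ∷_))))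
        ≈⟨ ⊕-cong (≈-trans (when-yes (≼? b c) b≼c) (linkedSum-≈ (c ∷ cs) (c≺ ∷ sorted) l c (≼-refl ∷ All.map proj₁ c≺)))
                  (∑-cong-All c≺ λ j (_ , j⋠c) → when-congˡ (≼? b j) (linkedSum-drop c cs (All.map proj₂ c≺) l j j⋠c)) ⟩
      monotoneSum (c ∷ cs) l (f ∘ (c ∷_)) ⊕ ∑ cs (λ j → when (≼? b j) (linkedSum cs l j (f ∘ (j ∷_))))
        ≈⟨ ⊕-congˡ (≈-trans (≈-sym (linkedSum-suc cs l b)) (linkedSum-≈ cs sorted (suc l) b b≼)) ⟩
      monotoneSum (c ∷ cs) (suc l) f ∎
      where open ≈-Reasoning

  -- A monotone sequence begins with the first entry c or never contains it: once an entry fails to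
  -- precede c, so do all later ones (`linkedSum-drop`). `linkedSum` carries the previous entry for
  -- this purpose.
  monotoneSum-≈ : ∀ cs → AllPairs (λ c j → c ≼ j × ¬ j ≼ c) cs → ∀ l {f} →
                  ∑ (lists cs l) (λ js → when (linked? ≼? js) (f js)) ≈ monotoneSum cs l f
  monotoneSum-≈ []       sorted        zero    = ⊕-identityʳ _
  monotoneSum-≈ (c ∷ cs) sorted        zero    = ⊕-identityʳ _
  monotoneSum-≈ []       sorted        (suc l) = ≈-refl
  monotoneSum-≈ (c ∷ cs) (c≺ ∷ sorted) (suc l) {f} = begin
    ∑ (lists (c ∷ cs) (suc l)) (λ js → when (linked? ≼? js) (f js))
      ≈⟨ ∑-cartesianProductWith _∷_ (c ∷ cs) (lists (c ∷ cs) l) ⟩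
    linkedSum (c ∷ cs) l c (f ∘ (c ∷_)) ⊕ ∑ cs (λ j → linkedSum (c ∷ cs) l j (f ∘ (j ∷_)))
      ≈⟨ ⊕-cong (linkedSum-≈ (c ∷ cs) (c≺ ∷ sorted) l c (≼-refl ∷ All.map proj₁ c≺))
                (∑-cong-All c≺ λ j (_ , j⋠c) → linkedSum-drop c cs (All.map proj₂ c≺) l j j⋠c) ⟩
    monotoneSum (c ∷ cs) l (f ∘ (c ∷_)) ⊕ ∑ cs (λ j → linkedSum cs l j (f ∘ (j ∷_)))
      ≈⟨ ⊕-congˡ (≈-trans (≈-sym (∑-cartesianProductWith _∷_ cs (lists cs l))) (monotoneSum-≈ cs sorted (suc l))) ⟩
    monotoneSum (c ∷ cs) (suc l) f ∎
    where open ≈-Reasoning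

-- z-admissible sequences

_>ⁱ_ _<ⁱ_ : Letter n → Letter n → Set
a >ⁱ b = index b < index a
a <ⁱ b = index a < index b

reverse-allFin-fromℕ : ∀ k → reverse (allFin (suc k)) ≡ fromℕ k ∷ map inject₁ (reverse (allFin k))
reverse-allFin-fromℕ zero    = refl
reverse-allFin-fromℕ (suc k) = begin
  reverse (allFin (2 + k))                                       ≡⟨ reverse-allFin-suc (suc k) ⟩
  map suc (reverse (allFin (suc k))) ++ zero ∷ []
    ≡⟨ cong (λ is → map suc is ++ zero ∷ []) (reverse-allFin-fromℕ k) ⟩
  fromℕ (suc k) ∷ map suc (map inject₁ is) ++ zero ∷ []
    ≡⟨ cong (λ js → fromℕ (suc k) ∷ js ++ zero ∷ []) (trans (sym (List.map-∘ is)) (List.map-∘ is)) ⟩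
  fromℕ (suc k) ∷ map inject₁ (map suc is) ++ zero ∷ []
    ≡⟨ cong (fromℕ (suc k) ∷_) (List.map-++ inject₁ (map suc is) (zero ∷ [])) ⟨
  fromℕ (suc k) ∷ map inject₁ (map suc is ++ zero ∷ [])
    ≡⟨ cong (λ js → fromℕ (suc k) ∷ map inject₁ js) (reverse-allFin-suc k) ⟨
  fromℕ (suc k) ∷ map inject₁ (reverse (allFin (suc k))) ∎
  where
  open ≡.≡-Reasoning
  is = reverse (allFin k)

reverse-allFin-descending : ∀ k → AllPairs Fin._>_ (reverse (allFin k))
reverse-allFin-descending zero    = []
reverse-allFin-descending (suc k) = subst (AllPairs Fin._>_) (sym (reverse-allFin-fromℕ k))
  (All.map⁺ (All.universal (λ i → subst₂ _<_ (sym (Fin.toℕ-inject₁ i)) (sym (Fin.toℕ-fromℕ k)) (Fin.toℕ<n i))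
      (reverse (allFin k)))
   ∷ AllPairs.map⁺ (AllPairs.map (λ {i} {j} → subst₂ _<_ (sym (Fin.toℕ-inject₁ j)) (sym (Fin.toℕ-inject₁ i)))
       (reverse-allFin-descending k)))

allFin-ascending : ∀ k → AllPairs Fin._<_ (allFin k)
allFin-ascending k = AllPairs.tabulate⁺-< id

∈-reverse-allFin : ∀ (i : Fin k) → i ∈ reverse (allFin k)
∈-reverse-allFin i = Any.reverse⁺ (∈-allFin i)

module _ {m : ℕ} where

  Bounded : Word (2 + m) → List (Fin (2 + m)) → Set
  Bounded b js = All (λ (a , j) → suc (toℕ j) ≤ index a) (zip b js)

  Strict : Word (2 + m) → List (Fin (2 + m)) → Set
  Strict b js = Linked (λ (a , i) (b , j) → i ≡ j → index b < index a) (zip b js)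

  admissible? : ∀ b js → Dec (Bounded b js × Strict b js)
  admissible? b js = All.all? (λ (a , j) → suc (toℕ j) ℕ.≤? index a) (zip b js)
    ×-dec linked? (λ (a , i) (b , j) → (i Fin.≟ j) →-dec (index b ℕ.<? index a)) (zip b js)

  Z-weight : Word (2 + m) → List (Fin (2 + m)) → Poly XZ
  Z-weight b js = when (admissible? b js) (z^ js)

  Z-monotone : ∀ b → Z-coefficient b ≈ monotoneSum (allFin (2 + m)) (length b) (Z-weight b)
  Z-monotone b = begin
    Z-coefficient b
      ≈⟨ ∑-filter (zAdmissible? b) (lists (allFin (2 + m)) (length b)) ⟩
    ∑ (lists (allFin (2 + m)) (length b)) (λ js → when (zAdmissible? b js) (z^ js))
      ≈⟨ ∑-cong (lists (allFin (2 + m)) (length b)) (λ js → when-× (linked? Fin._≤?_ js) (admissible? b js)) ⟩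
    ∑ (lists (allFin (2 + m)) (length b)) (λ js → when (linked? Fin._≤?_ js) (Z-weight b js))
      ≈⟨ monotoneSum-≈ Fin._≤?_ ℕ.≤-refl (allFin (2 + m))
         (AllPairs.map (λ lt → ℕ.<⇒≤ lt , ℕ.<⇒≱ lt) (allFin-ascending (2 + m))) (length b) ⟩
    monotoneSum (allFin (2 + m)) (length b) (Z-weight b) ∎
    where open ≈-Reasoning

  -- What a run of equal indices c demands of its letters; for plain words this also describes the
  -- words read from the corresponding staircase row.
  Row : Fin (2 + m) → Word (2 + m) → Set
  Row c u = AllPairs _>ⁱ_ u × All (λ a → suc (toℕ c) ≤ index a) u

  row? : ∀ c u → Dec (Row c u)
  row? c u = allPairs? (λ a b → index b ℕ.<? index a) u ×-dec All.all? (λ a → suc (toℕ c) ℕ.≤? index a) u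

  row-split⁻ : ∀ c u v js → All (c ≢_) js →
               Bounded (u ++ v) (replicate (length u) c ++ js) × Strict (u ++ v) (replicate (length u) c ++ js) →
               Row c u × (Bounded v js × Strict v js)
  row-split⁻ c u v js c∉ (bd , st) =
    (Linked⇒AllPairs (λ gt gt′ → ℕ.<-trans gt′ gt) (linked u st) , bounds u bd) , (rest-bounds u bd , rest u st)
    where
    bounds : ∀ u → Bounded (u ++ v) (replicate (length u) c ++ js) → All (λ a → suc (toℕ c) ≤ index a) u
    bounds []      _        = []
    bounds (a ∷ u) (b ∷ bs) = b ∷ bounds u bs
    rest-bounds : ∀ u → Bounded (u ++ v) (replicate (length u) c ++ js) → Bounded v js
    rest-bounds []      bs       = bs
    rest-bounds (a ∷ u) (b ∷ bs) = rest-bounds u bs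
    tail : ∀ {P : Letter (2 + m) × Fin (2 + m) → Letter (2 + m) × Fin (2 + m) → Set} {e es} → Linked P (e ∷ es) → Linked P es
    tail [-]     = []
    tail (e ∷ es) = es
    linked : ∀ u → Strict (u ++ v) (replicate (length u) c ++ js) → Linked _>ⁱ_ u
    linked []           _        = []
    linked (a ∷ [])     _        = [-]
    linked (a ∷ b ∷ u) (e ∷ es) = e refl ∷ linked (b ∷ u) es
    rest : ∀ u → Strict (u ++ v) (replicate (length u) c ++ js) → Strict v js
    rest []      es = es
    rest (a ∷ u) es = rest u (tail es)

  -- Strictness compares neighbours with equal index only. As c does not occur in `js`, nothing is
  -- required across the cut.
  row-split⁺ : ∀ c u v js → All (c ≢_) js → Row c u × (Bounded v js × Strict v js) →
               Bounded (u ++ v) (replicate (length u) c ++ js) × Strict (u ++ v) (replicate (length u) c ++ js)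
  row-split⁺ c u v js c∉ ((ap , bd) , (bs , st)) = bounds u bd , strict u v js c∉ (AllPairs⇒Linked ap) st
    where
    bounds : ∀ u → All (λ a → suc (toℕ c) ≤ index a) u → Bounded (u ++ v) (replicate (length u) c ++ js)
    bounds []      []       = bs
    bounds (a ∷ u) (e ∷ es) = e ∷ bounds u es
    strict : ∀ u v js → All (c ≢_) js → Linked _>ⁱ_ u → Strict v js → Strict (u ++ v) (replicate (length u) c ++ js)
    strict []          v       js       _        _        st = st
    strict (a ∷ [])    []      js       _        _        st = [-]
    strict (a ∷ [])    (b ∷ v) []       _        _        st = [-]
    strict (a ∷ [])    (b ∷ v) (j ∷ js) (ne ∷ _) _        st = (λ e → ⊥-elim (ne e)) ∷ st
    strict (a ∷ b ∷ u) v       js       c∉       (e ∷ es) st = (λ _ → e) ∷ strict (b ∷ u) v js c∉ es st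

  Z-weight-split : ∀ c u v js → All (c ≢_) js →
    Z-weight (u ++ v) (replicate (length u) c ++ js) ≈ when (row? c u) (var (z (toℕ c)) ↑ length u) ⊗ Z-weight v js
  Z-weight-split c u v js c∉ = begin
    Z-weight (u ++ v) (replicate (length u) c ++ js)
      ≈⟨ when-cong (admissible? (u ++ v) (replicate (length u) c ++ js)) (row? c u ×-dec admissible? v js)
           (row-split⁻ c u v js c∉) (row-split⁺ c u v js c∉) (λ _ → z^-split (length u)) ⟩
    when (row? c u ×-dec admissible? v js) (var (z (toℕ c)) ↑ length u ⊗ z^ js)
      ≈⟨ when-× (row? c u) (admissible? v js) ⟩
    when (row? c u) (when (admissible? v js) (var (z (toℕ c)) ↑ length u ⊗ z^ js))
      ≈⟨ when-congˡ (row? c u) (when-⊗ (admissible? v js)) ⟩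
    when (row? c u) (var (z (toℕ c)) ↑ length u ⊗ Z-weight v js)
      ≈⟨ when-homo (row? c u) {h = _⊗ Z-weight v js} (⊗-zeroˡ _) ⟨
    when (row? c u) (var (z (toℕ c)) ↑ length u) ⊗ Z-weight v js ∎
    where
    open ≈-Reasoning
    z^-split : ∀ l → z^ (replicate l c ++ js) ≈ var (z (toℕ c)) ↑ l ⊗ z^ js
    z^-split zero    = ≈-sym (⊗-identityˡ _)
    z^-split (suc l) = ≈-trans (⊗-congˡ (z^-split l)) (≈-sym (⊗-assoc _ _ _))

  -- The row lists its letters with falling index, so `coefficient-chain` applies. Plainness
  -- excludes ŝ, which shares the index 1 with s₁ but is in no row.
  row-coefficient : ∀ {k} (i : Fin (suc m)) (c : Fin (2 + m)) → toℕ c ≡ toℕ i → ∀ u → All Plain u →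
    coefficient (map boxFactor (stair-row {k = k} i)) u ≈ when (row? c u) (var (z (toℕ c)) ↑ length u)
  row-coefficient {k} i c c≡i u ps = begin
    coefficient (map boxFactor (stair-row {k = k} i)) u
      ≡⟨ cong (λ Fs → coefficient Fs u) (trans (sym (List.map-∘ is)) (List.map-∘ is)) ⟩
    coefficient (map (λ l → linear (l , var (z (toℕ i)))) ls) u
      ≈⟨ coefficient-chain (λ a b → index b ℕ.<? index a) ℕ.<-asym ls descending (var (z (toℕ i))) u ⟩
    _ ≈⟨ when-cong (chain? (λ a b → index b ℕ.<? index a) ℕ.<-asym ls u) (row? c u)
           (λ (ap , ∈s) → ap , All.map (λ {a} → in-row⁻ {a}) ∈s)
               (λ (ap , bd) → ap , All.map (λ {a} → in-row⁺ {a}) (All.zip (ps , bd)))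
           (λ _ → ≡⇒≈ (cong (λ j → var (z j) ↑ length u) (sym c≡i))) ⟩
    when (row? c u) (var (z (toℕ c)) ↑ length u) ∎
    where
    open ≈-Reasoning
    is : List (Fin (suc m ∸ toℕ i))
    is = reverse (allFin (suc m ∸ toℕ i))
    letter : Fin (suc m ∸ toℕ i) → Letter (2 + m)
    letter j = boxLetter {m} {k} (stair i j)
    ls : List (Letter (2 + m))
    ls = map letter is
    index-letter : ∀ j → index (letter j) ≡ suc (toℕ i + toℕ j)
    index-letter j = cong suc (toℕ-stair {k = k} i j)
    descending : AllPairs _>ⁱ_ ls
    descending = AllPairs.map⁺ (AllPairs.map (λ {j} {j′} gt → subst₂ _<_ (sym (index-letter j′)) (sym (index-letter j))
      (s≤s (ℕ.+-monoʳ-< (toℕ i) gt))) (reverse-allFin-descending (suc m ∸ toℕ i)))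
    in-row⁻ : ∀ {a} → a ∈ ls → suc (toℕ c) ≤ index a
    in-row⁻ a∈ with ∈-map⁻ letter a∈
    ... | j , _ , refl = subst₂ _≤_ (cong suc (sym c≡i)) (sym (index-letter j)) (s≤s (ℕ.m≤m+n (toℕ i) (toℕ j)))
    in-row⁺ : ∀ {a} → Plain a × suc (toℕ c) ≤ index a → a ∈ ls
    in-row⁺ (plain q , s≤s c≤q) = subst (_∈ ls) letter-q (∈-map⁺ letter (∈-reverse-allFin j))
      where
      i≤q : toℕ i ≤ toℕ q
      i≤q = subst (_≤ toℕ q) c≡i c≤q
      j : Fin (suc m ∸ toℕ i)
      j = fromℕ< (ℕ.∸-monoˡ-< (Fin.toℕ<n q) i≤q)
      letter-q : letter j ≡ s q
      letter-q = cong s (Fin.toℕ-injective (trans (toℕ-stair {k = k} i j)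
        (trans (cong (toℕ i +_) (Fin.toℕ-fromℕ< _)) (ℕ.m+[n∸m]≡n i≤q))))

  index<n : (a : Letter (2 + m)) → index a < 2 + m
  index<n (s i) = s≤s (Fin.toℕ<n i)
  index<n ŝ     = s≤s (s≤s z≤n)

  monotoneSum-zero : ∀ (cs : List A) l {f} → (∀ js → f js ≈ 𝟘) → monotoneSum cs l f ≈ 𝟘
  monotoneSum-zero []       zero    e = e []
  monotoneSum-zero []       (suc l) e = ≈-refl
  monotoneSum-zero (c ∷ cs) zero    e = e []
  monotoneSum-zero (c ∷ cs) (suc l) e =
    ≈-trans (⊕-cong (monotoneSum-zero (c ∷ cs) l (e ∘ (c ∷_))) (monotoneSum-zero cs (suc l) e)) (⊕-identityˡ 𝟘)

  -- There is one more index value than there are rows. The surplus one, j = n, admits no letter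
  -- because j ≤ a < n; this is the base case l = 0.
  rows-coefficient : ∀ {k} l q (f : Fin l → Fin (suc m)) (g : Fin (suc l) → Fin (2 + m)) → q + l ≡ suc m →
    (∀ j → toℕ (f j) ≡ q + toℕ j) → (∀ j → toℕ (g j) ≡ q + toℕ j) → ∀ b → All Plain b →
    coefficient (map boxFactor (concatMap (stair-row {k = k}) (map f (allFin l)))) b ≈
    monotoneSum (map g (allFin (suc l))) (length b) (Z-weight b)
  rows-coefficient zero q f g q+l ef eg [] ps = ≈-sym (when-yes (admissible? [] []) ([] , []))
  rows-coefficient zero q f g q+l ef eg (a ∷ b) ps = ≈-sym (≈-trans (⊕-identityʳ _)
    (monotoneSum-zero (g zero ∷ []) (length b) λ js → when-no (admissible? (a ∷ b) (g zero ∷ js))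
      λ { (le ∷ _ , _) → ℕ.<⇒≱ (index<n a) (subst (λ i → suc i ≤ index a) (trans (eg zero) q+l) le) }))
  rows-coefficient {k} (suc l) q f g q+l ef eg b ps = begin
    coefficient (map boxFactor (concatMap (stair-row {k = k}) (map f (allFin (suc l))))) b
      ≡⟨ cong (λ Fs → coefficient Fs b) factors-≡ ⟩
    coefficient (map boxFactor (stair-row {k = k} (f zero)) ++ rest) b
      ≈⟨ coefficient-++ (map boxFactor (stair-row {k = k} (f zero))) rest b ⟩
    splitSum b (λ u v → coefficient (map boxFactor (stair-row {k = k} (f zero))) u ⊗ coefficient rest v)
      ≈⟨ splitSum-cong b (λ u v e → split u v (subst (All Plain) (sym e) ps) e) ⟩
    splitSum b (λ u v → monotoneSum cs (length v) (λ js → Z-weight b (replicate (length u) (g zero) ++ js)))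
      ≈⟨ monotoneSum-split (g zero) cs b ⟨
    monotoneSum (g zero ∷ cs) (length b) (Z-weight b)
      ≡⟨ cong (λ cs → monotoneSum cs (length b) (Z-weight b))
         (trans (cong (g zero ∷_) (List.map-∘ (allFin (suc l)))) (cong (map g) (sym (allFin-suc (suc l))))) ⟩
    monotoneSum (map g (allFin (2 + l))) (length b) (Z-weight b) ∎
    where
    open ≈-Reasoning
    rest : List (Factor (2 + m) XZ)
    rest = map boxFactor (concatMap (stair-row {k = k}) (map (f ∘ suc) (allFin l)))
    cs : List (Fin (2 + m))
    cs = map (g ∘ suc) (allFin (suc l))
    factors-≡ : map boxFactor (concatMap (stair-row {k = k}) (map f (allFin (suc l)))) ≡
                map boxFactor (stair-row {k = k} (f zero)) ++ rest
    factors-≡ = trans (cong (λ is → map boxFactor (concatMap (stair-row {k = k}) is))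
        (trans (cong (map f) (allFin-suc l)) (cong (f zero ∷_) (sym (List.map-∘ (allFin l))))))
      (List.map-++ boxFactor (stair-row {k = k} (f zero)) _)
    g0≡f0 : toℕ (g zero) ≡ toℕ (f zero)
    g0≡f0 = trans (eg zero) (sym (ef zero))
    g0∉ : All (g zero ≢_) cs
    g0∉ = All.map⁺ (All.universal (λ j e → ℕ.m≢1+m+n q (trans (sym (trans (eg zero) (ℕ.+-identityʳ q)))
      (trans (cong toℕ e) (trans (eg (suc j)) (ℕ.+-suc q (toℕ j)))))) (allFin (suc l)))
    split : ∀ u v → All Plain (u ++ v) → u ++ v ≡ b →
            coefficient (map boxFactor (stair-row {k = k} (f zero))) u ⊗ coefficient rest v ≈
            monotoneSum cs (length v) (λ js → Z-weight b (replicate (length u) (g zero) ++ js))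
    split u v ps refl = begin
      coefficient (map boxFactor (stair-row {k = k} (f zero))) u ⊗ coefficient rest v
        ≈⟨ ⊗-cong (row-coefficient {k} (f zero) (g zero) g0≡f0 u (All.++⁻ˡ u ps))
                  (rows-coefficient {k} l (suc q) (f ∘ suc) (g ∘ suc) (trans (sym (ℕ.+-suc q l)) q+l)
                    (λ j → trans (ef (suc j)) (ℕ.+-suc q (toℕ j))) (λ j → trans (eg (suc j)) (ℕ.+-suc q (toℕ j))) v
                        (All.++⁻ʳ u ps)) ⟩
      when (row? (g zero) u) (var (z (toℕ (g zero))) ↑ length u) ⊗ monotoneSum cs (length v) (Z-weight v)
        ≈⟨ monotoneSum-⊗ cs (length v) _ ⟨
      monotoneSum cs (length v) (λ js → when (row? (g zero) u) (var (z (toℕ (g zero))) ↑ length u) ⊗ Z-weight v js)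
        ≈⟨ monotoneSum-cong cs g0∉ (length v) (λ js c∉ _ → Z-weight-split (g zero) u v js c∉) ⟨
      monotoneSum cs (length v) (λ js → Z-weight (u ++ v) (replicate (length u) (g zero) ++ js)) ∎

  Z-coefficient-≈ : ∀ k b → All Plain b → Z-coefficient b ≈ coefficient (stair-factors m k) b
  Z-coefficient-≈ k b ps = begin
    Z-coefficient b
      ≈⟨ Z-monotone b ⟩
    monotoneSum (allFin (2 + m)) (length b) (Z-weight b)
      ≡⟨ cong (λ cs → monotoneSum cs (length b) (Z-weight b)) (List.map-id (allFin (2 + m))) ⟨
    monotoneSum (map id (allFin (2 + m))) (length b) (Z-weight b)
      ≈⟨ rows-coefficient {k} (suc m) 0 id id refl (λ _ → refl) (λ _ → refl) b ps ⟨
    coefficient (map boxFactor (concatMap (stair-row {k = k}) (map id (allFin (suc m))))) b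
      ≡⟨ cong (λ is → coefficient (map boxFactor (concatMap (stair-row {k = k}) is)) b) (List.map-id (allFin (suc m))) ⟩
    coefficient (stair-factors m k) b ∎
    where open ≈-Reasoning

-- x-admissible sequences

-- Checked on unnormalised fractions, where numerators and denominators multiply separately.
/-* : ∀ a b c d .{{_ : ℕ.NonZero b}} .{{_ : ℕ.NonZero d}} .{{_ : ℕ.NonZero (b * d)}} →
      (ℤ.+ (a * c)) ℚ./ (b * d) ≡ ((ℤ.+ a) ℚ./ b) ℚ.* ((ℤ.+ c) ℚ./ d)
/-* a (suc b) c (suc d) = ℚ.toℚᵘ-injective (begin
  ℚ.toℚᵘ ((ℤ.+ (a * c)) ℚ./ (suc b * suc d))
    ≈⟨ ℚ.toℚᵘ-fromℚᵘ (ℚᵘ.mkℚᵘ (ℤ.+ (a * c)) (d + b * suc d)) ⟩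
  ℚᵘ.mkℚᵘ (ℤ.+ (a * c)) (d + b * suc d)
    ≡⟨ cong (λ i → ℚᵘ.mkℚᵘ i (d + b * suc d)) (ℤ.pos-* a c) ⟩
  ℚᵘ.mkℚᵘ (ℤ.+ a) b ℚᵘ.* ℚᵘ.mkℚᵘ (ℤ.+ c) d
    ≈⟨ ℚᵘ.*-cong (ℚ.toℚᵘ-fromℚᵘ (ℚᵘ.mkℚᵘ (ℤ.+ a) b)) (ℚ.toℚᵘ-fromℚᵘ (ℚᵘ.mkℚᵘ (ℤ.+ c) d)) ⟨
  ℚ.toℚᵘ ((ℤ.+ a) ℚ./ suc b) ℚᵘ.* ℚ.toℚᵘ ((ℤ.+ c) ℚ./ suc d)
    ≈⟨ ℚ.toℚᵘ-homo-* ((ℤ.+ a) ℚ./ suc b) ((ℤ.+ c) ℚ./ suc d) ⟨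
  ℚ.toℚᵘ (((ℤ.+ a) ℚ./ suc b) ℚ.* ((ℤ.+ c) ℚ./ suc d)) ∎)
  where open import Relation.Binary.Reasoning.Setoid ℚᵘ.≃-setoid

-- Together with `variableCount-replicate` and `o-++` this makes the weight 2^{i(α)-o(a)}
-- multiplicative over runs of equal indices.
2^-+ : ∀ i i′ j j′ → 2^[ i + i′ - j + j′ ] ≡ 2^[ i - j ] ℚ.* 2^[ i′ - j′ ]
2^-+ i i′ j j′ = trans
  (ℚ./-cong {{ℕ.m^n≢0 2 (j + j′)}} {{nz}} (cong ℤ.+_ (ℕ.^-distribˡ-+-* 2 i i′)) (ℕ.^-distribˡ-+-* 2 j j′))
  (/-* (2 ^ i) (2 ^ j) (2 ^ i′) (2 ^ j′) {{ℕ.m^n≢0 2 j}} {{ℕ.m^n≢0 2 j′}} {{nz}})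
  where
  nz : ℕ.NonZero (2 ^ j * 2 ^ j′)
  nz = subst ℕ.NonZero (ℕ.^-distribˡ-+-* 2 j j′) (ℕ.m^n≢0 2 (j + j′))

o-++ : ∀ (u v : Word n) → o (u ++ v) ≡ o u + o v
o-++ u v = trans (cong length (List.filter-++ (λ a → index a ℕ.≟ 1) u v)) (List.length-++ (filter (λ a → index a ℕ.≟ 1) u))

-- The contribution of one run of equal indices to i(α).
nonempty : List A → ℕ
nonempty []      = 0
nonempty (_ ∷ _) = 1

module _ {k : ℕ} where

  deduplicate-fresh : ∀ (c : Fin k) js → All (c ≢_) js → deduplicate Fin._≟_ (c ∷ js) ≡ c ∷ deduplicate Fin._≟_ js
  deduplicate-fresh c js c∉ = cong (c ∷_) (List.filter-all (¬? ∘ (c Fin.≟_)) (All.deduplicate⁺ Fin._≟_ c∉))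

  deduplicate-replicate : ∀ (c : Fin k) l js → All (c ≢_) js →
    deduplicate Fin._≟_ (replicate (suc l) c ++ js) ≡ c ∷ deduplicate Fin._≟_ js
  deduplicate-replicate c zero    js c∉ = deduplicate-fresh c js c∉
  deduplicate-replicate c (suc l) js c∉ = cong (c ∷_) (trans
    (cong (filter (¬? ∘ (c Fin.≟_))) (deduplicate-replicate c l js c∉))
    (trans (List.filter-reject (¬? ∘ (c Fin.≟_)) (λ ne → ne refl))
           (List.filter-all (¬? ∘ (c Fin.≟_)) (All.deduplicate⁺ Fin._≟_ c∉))))

  variableCount-replicate : ∀ (c : Fin k) (u : List A) js → All (c ≢_) js →
    variableCount (replicate (length u) c ++ js) ≡ nonempty u + variableCount js
  variableCount-replicate c []      js c∉ = refl
  variableCount-replicate c (_ ∷ u) js c∉ = cong length (deduplicate-replicate c (length u) js c∉)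

  -- Gives access to the private decision procedure used in xAdmissible?.
  xAdmissible-dec : ∀ (a : Word n) (js : List (Fin k)) → Σ (Dec (NoForbiddenPeak (zip a js))) λ peak? →
                    xAdmissible? a js ≡ (linked? (λ i j → j Fin.≤? i) js ×-dec peak?)
  xAdmissible-dec a js = _ , refl

  noForbiddenPeak? : ∀ (a : Word n) (js : List (Fin k)) → Dec (NoForbiddenPeak (zip a js))
  noForbiddenPeak? a js = proj₁ (xAdmissible-dec a js)

  X-weight : Word n → List (Fin k) → Poly XZ
  X-weight a js = when (noForbiddenPeak? a js) (con 2^[ variableCount js - o a ] ⊗ x^ js)

  -- x-admissible sequences fall, so they are monotone along the reversed index list, which is also
  -- the order in which the Γ-blocks are read.
  lists-reverse : ∀ (cs : List A) l {f : List A → Poly XZ} → ∑ (lists (reverse cs) l) f ≈ ∑ (lists cs l) f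
  lists-reverse cs zero    = ≈-refl
  lists-reverse cs (suc l) {f} = begin
    ∑ (lists (reverse cs) (suc l)) f
      ≈⟨ ∑-cartesianProductWith _∷_ (reverse cs) (lists (reverse cs) l) ⟩
    ∑ (reverse cs) (λ c → ∑ (lists (reverse cs) l) (λ js → f (c ∷ js)))
      ≈⟨ ∑-cong (reverse cs) (λ c → lists-reverse cs l) ⟩
    ∑ (reverse cs) (λ c → ∑ (lists cs l) (λ js → f (c ∷ js)))              ≈⟨ ∑-reverse cs ⟩
    ∑ cs (λ c → ∑ (lists cs l) (λ js → f (c ∷ js)))                        ≈⟨ ∑-cartesianProductWith _∷_ cs (lists cs l) ⟨
    ∑ (lists cs (suc l)) f ∎
    where open ≈-Reasoning

  X-monotone : ∀ (a : Word (2 + m)) → X-coefficient k a ≈ monotoneSum (reverse (allFin k)) (length a) (X-weight a)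
  X-monotone a = begin
    X-coefficient k a
      ≈⟨ ∑-filter (xAdmissible? a) (lists (allFin k) (length a)) ⟩
    ∑ (lists (allFin k) (length a)) (λ js → when (xAdmissible? a js) (weight′ js))
      ≈⟨ lists-reverse (allFin k) (length a) ⟨
    ∑ (lists (reverse (allFin k)) (length a)) (λ js → when (xAdmissible? a js) (weight′ js))
      ≈⟨ ∑-cong (lists (reverse (allFin k)) (length a)) (λ js → ≈-trans
           (≡⇒≈ (cong (λ d → when d (weight′ js)) (proj₂ (xAdmissible-dec a js))))
           (when-× (linked? (λ i j → j Fin.≤? i) js) (noForbiddenPeak? a js))) ⟩
    ∑ (lists (reverse (allFin k)) (length a)) (λ js → when (linked? (λ i j → j Fin.≤? i) js) (X-weight a js))
      ≈⟨ monotoneSum-≈ (λ i j → j Fin.≤? i) ℕ.≤-refl (reverse (allFin k))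
           (AllPairs.map (λ gt → ℕ.<⇒≤ gt , ℕ.<⇒≱ gt) (reverse-allFin-descending k)) (length a) ⟩
    monotoneSum (reverse (allFin k)) (length a) (X-weight a) ∎
    where
    open ≈-Reasoning
    weight′ : List (Fin k) → Poly XZ
    weight′ js = con 2^[ variableCount js - o a ] ⊗ x^ js

  module _ (c : Fin k) where

    Constant : Word n → Set
    Constant u = NoForbiddenPeak (zip u (replicate (length u) c))

    constant? : (u : Word n) → Dec (Constant u)
    constant? u = noForbiddenPeak? u (replicate (length u) c)

    peak-split⁻ : ∀ (u v : Word n) js → All (c ≢_) js → NoForbiddenPeak (zip (u ++ v) (replicate (length u) c ++ js)) →
                  Constant u × NoForbiddenPeak (zip v js)
    peak-split⁻ []              v           js            c∉ e = tt , e
    peak-split⁻ (a ∷ [])        []          js            c∉ e = tt , tt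
    peak-split⁻ (a ∷ [])        (b ∷ v)     []            c∉ e = tt , tt
    peak-split⁻ (a ∷ [])        (b ∷ [])    (j ∷ js)      c∉ e = tt , tt
    peak-split⁻ (a ∷ [])        (b ∷ b′ ∷ v) (j ∷ [])     c∉ e = tt , tt
    peak-split⁻ (a ∷ [])        (b ∷ b′ ∷ v) (j ∷ j′ ∷ js) c∉ (_ , e) = tt , e
    peak-split⁻ (a ∷ a′ ∷ [])   []          js            c∉ e = tt , tt
    peak-split⁻ (a ∷ a′ ∷ [])   (b ∷ v)     []            c∉ e = tt , tt
    peak-split⁻ (a ∷ a′ ∷ [])   (b ∷ v)     (j ∷ js)      c∉ (_ , e) =
      tt , proj₂ (peak-split⁻ (a′ ∷ []) (b ∷ v) (j ∷ js) c∉ e)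
    peak-split⁻ (a ∷ a′ ∷ a″ ∷ u) v         js            c∉ (e , es) =
      let e₁ , e₂ = peak-split⁻ (a′ ∷ a″ ∷ u) v js c∉ es in (e , e₁) , e₂

    -- A peak is forbidden only under three equal indices. As c does not occur in `js`, no such
    -- triple straddles the cut.
    peak-split⁺ : ∀ (u v : Word n) js → All (c ≢_) js → Constant u → NoForbiddenPeak (zip v js) →
                  NoForbiddenPeak (zip (u ++ v) (replicate (length u) c ++ js))
    peak-split⁺ []              v            js            c∉ e₁ e = e
    peak-split⁺ (a ∷ [])        []           js            c∉ e₁ e = tt
    peak-split⁺ (a ∷ [])        (b ∷ v)      []            c∉ e₁ e = tt
    peak-split⁺ (a ∷ [])        (b ∷ [])     (j ∷ js)      c∉ e₁ e = tt
    peak-split⁺ (a ∷ [])        (b ∷ b′ ∷ v) (j ∷ [])      c∉ e₁ e = tt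
    peak-split⁺ (a ∷ [])        (b ∷ b′ ∷ v) (j ∷ j′ ∷ js) (ne ∷ _) e₁ e = (λ (eq , _) → ⊥-elim (ne eq)) , e
    peak-split⁺ (a ∷ a′ ∷ [])   []           js            c∉ e₁ e = tt
    peak-split⁺ (a ∷ a′ ∷ [])   (b ∷ v)      []            c∉ e₁ e = tt
    peak-split⁺ (a ∷ a′ ∷ [])   (b ∷ v)      (j ∷ js)      c∉@(ne ∷ _) e₁ e =
      (λ (_ , eq) → ⊥-elim (ne eq)) , peak-split⁺ (a′ ∷ []) (b ∷ v) (j ∷ js) c∉ tt e
    peak-split⁺ (a ∷ a′ ∷ a″ ∷ u) v          js            c∉ (e₁ , es₁) e = e₁ , peak-split⁺ (a′ ∷ a″ ∷ u) v js c∉ es₁ e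

    X : Poly XZ
    X = var (x (toℕ c))

    -- The contribution to the middle sum of a run `u` of letters with index `c`, to be matched with
    -- the coefficient of `u` in the block c.
    block-weight : Word n → Poly XZ
    block-weight u = when (constant? u) (con 2^[ nonempty u - o u ] ⊗ X ↑ length u)

    X-weight-split : ∀ (u v : Word n) js → All (c ≢_) js →
      X-weight (u ++ v) (replicate (length u) c ++ js) ≈ block-weight u ⊗ X-weight v js
    X-weight-split u v js c∉ = begin
      X-weight (u ++ v) (replicate (length u) c ++ js)
        ≈⟨ when-cong (noForbiddenPeak? (u ++ v) (replicate (length u) c ++ js)) (constant? u ×-dec noForbiddenPeak? v js)
             (peak-split⁻ u v js c∉) (λ (e₁ , e₂) → peak-split⁺ u v js c∉ e₁ e₂) (λ _ → terms) ⟩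
      when (constant? u ×-dec noForbiddenPeak? v js) (left-term ⊗ right-term)
        ≈⟨ when-× (constant? u) (noForbiddenPeak? v js) ⟩
      when (constant? u) (when (noForbiddenPeak? v js) (left-term ⊗ right-term))
        ≈⟨ when-congˡ (constant? u) (when-⊗ (noForbiddenPeak? v js)) ⟩
      when (constant? u) (left-term ⊗ X-weight v js)
        ≈⟨ when-homo (constant? u) {h = _⊗ X-weight v js} (⊗-zeroˡ _) ⟨
      block-weight u ⊗ X-weight v js ∎
      where
      open ≈-Reasoning
      left-term right-term : Poly XZ
      left-term = con 2^[ nonempty u - o u ] ⊗ X ↑ length u
      right-term = con 2^[ variableCount js - o v ] ⊗ x^ js
      x^-split : ∀ l → x^ (replicate l c ++ js) ≈ X ↑ l ⊗ x^ js
      x^-split zero    = ≈-sym (⊗-identityˡ _)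
      x^-split (suc l) = ≈-trans (⊗-congˡ (x^-split l)) (≈-sym (⊗-assoc _ _ _))
      terms : con 2^[ variableCount (replicate (length u) c ++ js) - o (u ++ v) ] ⊗ x^ (replicate (length u) c ++ js) ≈
              left-term ⊗ right-term
      terms = begin
        con 2^[ variableCount (replicate (length u) c ++ js) - o (u ++ v) ] ⊗ x^ (replicate (length u) c ++ js)
          ≡⟨ cong₂ (λ i j → con 2^[ i - j ] ⊗ x^ (replicate (length u) c ++ js)) (variableCount-replicate c u js c∉)
             (o-++ u v) ⟩
        con 2^[ nonempty u + variableCount js - o u + o v ] ⊗ x^ (replicate (length u) c ++ js)
          ≈⟨ ⊗-cong (≈-trans (≡⇒≈ (cong con (2^-+ (nonempty u) (variableCount js) (o u) (o v)))) (con-⊗ _ _))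
             (x^-split (length u)) ⟩
        (con 2^[ nonempty u - o u ] ⊗ con 2^[ variableCount js - o v ]) ⊗ (X ↑ length u ⊗ x^ js)
          ≈⟨ solve 4 (λ a b c d → ((a :* b) :* (c :* d)) := ((a :* c) :* (b :* d))) ≈-refl _ _ _ _ ⟩
        left-term ⊗ right-term ∎

-- Reduced words without peaks

IsReduced : Word n → Set
IsReduced a = IsReducedWordOf ⟦ a ⟧ a

isReduced-++ : ∀ (u v : Word n) → IsReduced (u ++ v) → IsReduced u × IsReduced v
isReduced-++ u v g = proj₂ (reduced-split⁻ ⟦ u ++ v ⟧ u v g)

isReduced-tail : ∀ (a : Letter n) u → IsReduced (a ∷ u) → IsReduced u
isReduced-tail a u g = proj₂ (isReduced-++ (a ∷ []) u g)

not-shorter : ∀ (a b : Word n) → IsReduced a → ⟦ b ⟧ ≡ ⟦ a ⟧ → ¬ length b < length a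
not-shorter a b (_ , l) e lt = ℕ.<⇒≱ lt (ℕ.≤-trans (ℕ.≤-reflexive l) (ℓ-minimal ⟦ a ⟧ b e))

cancel-square : ∀ (a : Letter n) (w : 𝒟 n) → w ≡ generator a ∙ (generator a ∙ w)
cancel-square a w = trans (sym (∙-identityˡ w))
    (trans (cong (_∙ w) (sym (generator-involutive a))) (∙-assoc (generator a) (generator a) w))

isReduced-≢ : ∀ (a b : Letter n) u → IsReduced (a ∷ b ∷ u) → a ≢ b
isReduced-≢ a .a u g refl = not-shorter (a ∷ a ∷ u) u g (cancel-square a ⟦ u ⟧) (ℕ.m<n⇒m<1+n ℕ.≤-refl)

Low High : Letter n → Set
Low a  = index a ≡ 1
High a = 2 ≤ index a

low? : (a : Letter n) → Low a ⊎ High a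
low? (s zero)    = inj₁ refl
low? (s (suc i)) = inj₂ (s≤s (s≤s z≤n))
low? ŝ           = inj₁ refl

high⇒¬low : {a : Letter n} → High a → ¬ Low a
high⇒¬low le e = ℕ.<⇒≢ le (sym e)

high-injective : {a b : Letter n} → High a → index a ≡ index b → a ≡ b
high-injective {a = s i}        {s j}        h e = cong s (Fin.toℕ-injective (ℕ.suc-injective e))
high-injective {a = s (suc i)}  {ŝ}          h ()
high-injective {a = s zero}     {ŝ}          (s≤s ()) e
high-injective {a = ŝ}          {b}          (s≤s ()) e

twin : Letter (2 + m) → Letter (2 + m)
twin (s _) = ŝ
twin ŝ     = s zero

low-other : {a b : Letter (2 + m)} → Low a → Low b → a ≢ b → b ≡ twin a
low-other {a = s zero} {s zero} la lb ne = ⊥-elim (ne refl)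
low-other {a = s zero} {ŝ}      la lb ne = refl
low-other {a = ŝ}      {s zero} la lb ne = refl
low-other {a = ŝ}      {ŝ}      la lb ne = ⊥-elim (ne refl)

-- Neighbouring letters of a reduced word differ, so three low letters would read a b a; since s₁
-- and ŝ commute, this could be shortened to b.
isReduced-high-third : ∀ (a b c : Letter (2 + m)) u → Low a → Low b → IsReduced (a ∷ b ∷ c ∷ u) → High c
isReduced-high-third {m} a b c u la lb g = by-index (low? c)
  where
  a≢b : a ≢ b
  a≢b = isReduced-≢ a b (c ∷ u) g
  b≢c : b ≢ c
  b≢c = isReduced-≢ b c u (isReduced-tail a (b ∷ c ∷ u) g)
  c≡a : Low c → c ≡ a
  c≡a lc = trans (low-other lb lc b≢c) (sym (low-other lb la (a≢b ∘ sym)))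
  commute : ∀ {a b : Letter (2 + m)} → Low a → Low b → a ≢ b → generator a ∙ generator b ≡ generator b ∙ generator a
  commute {a = s zero} {s zero} _ _ ne = ⊥-elim (ne refl)
  commute {a = s zero} {ŝ}      _ _ ne = s₁-ŝ-commute
  commute {a = ŝ}      {s zero} _ _ ne = sym s₁-ŝ-commute
  commute {a = ŝ}      {ŝ}      _ _ ne = ⊥-elim (ne refl)
  same : c ≡ a → ⟦ b ∷ u ⟧ ≡ ⟦ a ∷ b ∷ c ∷ u ⟧
  same c≡a = begin
    generator b ∙ ⟦ u ⟧                                   ≡⟨ cong (generator b ∙_) (cancel-square a ⟦ u ⟧) ⟩
    generator b ∙ (generator a ∙ (generator a ∙ ⟦ u ⟧))   ≡⟨ ∙-assoc (generator b) (generator a) (generator a ∙ ⟦ u ⟧) ⟨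
    generator b ∙ generator a ∙ (generator a ∙ ⟦ u ⟧)     ≡⟨ cong (_∙ (generator a ∙ ⟦ u ⟧)) (commute la lb a≢b) ⟨
    generator a ∙ generator b ∙ (generator a ∙ ⟦ u ⟧)     ≡⟨ ∙-assoc (generator a) (generator b) (generator a ∙ ⟦ u ⟧) ⟩
    generator a ∙ (generator b ∙ (generator a ∙ ⟦ u ⟧))
      ≡⟨ cong (λ d → generator a ∙ (generator b ∙ (generator d ∙ ⟦ u ⟧))) c≡a ⟨
    ⟦ a ∷ b ∷ c ∷ u ⟧ ∎
    where open ≡.≡-Reasoning
  by-index : Low c ⊎ High c → High c
  by-index (inj₂ hc) = hc
  by-index (inj₁ lc) = ⊥-elim (not-shorter (a ∷ b ∷ c ∷ u) (b ∷ u) g (same (c≡a lc)) (s≤s (ℕ.m<n⇒m<1+n ℕ.≤-refl)))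

Increasing : Word n → Set
Increasing u = Linked _<ⁱ_ u × All High u

increasing? : (u : Word n) → Dec (Increasing u)
increasing? u = linked? (λ a b → index a ℕ.<? index b) u ×-dec All.all? (λ a → 2 ℕ.≤? index a) u

o-high : ∀ (u : Word n) → All High u → o u ≡ 0
o-high u hs = cong length (List.filter-none (λ a → index a ℕ.≟ 1) (All.map (λ {a} → high⇒¬low {a = a}) hs))

o-low-∷ : ∀ (a : Letter n) u → Low a → o (a ∷ u) ≡ suc (o u)
o-low-∷ a u la = cong length (List.filter-accept (λ a → index a ℕ.≟ 1) la)

o-high-∷ : ∀ (a : Letter n) u → High a → o (a ∷ u) ≡ o u
o-high-∷ a u ha = cong length (List.filter-reject (λ a → index a ℕ.≟ 1) (high⇒¬low {a = a} ha))

high-linked : ∀ (a : Letter n) u → 1 ≤ index a → Linked _<ⁱ_ (a ∷ u) → All High u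
high-linked a []      le l        = []
high-linked a (b ∷ u) le (lt ∷ l) = ℕ.≤-trans (s≤s le) lt ∷ high-linked b u (ℕ.≤-trans le (ℕ.<⇒≤ lt)) l

1≤index : (a : Letter n) → 1 ≤ index a
1≤index (s i) = s≤s z≤n
1≤index ŝ     = s≤s z≤n

module _ {k : ℕ} (c : Fin k) where

  -- A fall at the start prevents a peak at the second letter, so the first letter imposes no
  -- condition.
  constant-descent : ∀ (a b : Letter n) u → index b < index a → (Constant c (a ∷ b ∷ u) → Constant c (b ∷ u)) ×
      (Constant c (b ∷ u) → Constant c (a ∷ b ∷ u))
  constant-descent a b []      gt = (λ _ → tt) , (λ _ → tt)
  constant-descent a b (d ∷ u) gt = proj₂ , (λ e → (λ _ (lt , _) → ℕ.<-asym gt lt) , e)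

  -- Once the word rises it goes on rising: a fall would create a peak, and above index 1 equal
  -- indices mean equal letters, which cannot be neighbours in a reduced word.
  constant-ascent⁻ : ∀ (a b : Letter n) u → IsReduced (a ∷ b ∷ u) → index a < index b → Constant c (a ∷ b ∷ u) → Linked _<ⁱ_
      (b ∷ u)
  constant-ascent⁻ a b []      g lt e = [-]
  constant-ascent⁻ a b (d ∷ u) g lt (no-peak , e) = b<d ∷ constant-ascent⁻ b d u g′ b<d e
    where
    g′ : IsReduced (b ∷ d ∷ u)
    g′ = isReduced-tail a (b ∷ d ∷ u) g
    b<d : index b < index d
    b<d = ℕ.≤∧≢⇒< (ℕ.≮⇒≥ λ d<b → no-peak (refl , refl) (lt , d<b))
                  (λ e → isReduced-≢ b d u g′ (high-injective (ℕ.≤-trans (s≤s (1≤index a)) lt) e))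

  constant-ascent⁺ : ∀ (a b : Letter n) u → Linked _<ⁱ_ (b ∷ u) → Constant c (a ∷ b ∷ u)
  constant-ascent⁺ a b []      l         = tt
  constant-ascent⁺ a b (d ∷ u) (lt ∷ l) = (λ _ (_ , gt) → ℕ.<-asym lt gt) , constant-ascent⁺ b d u l

  block-weight-≈ : ∀ (a : Letter n) u {Q : Set} (Q? : Dec Q) j → (Constant c (a ∷ u) → Q) → (Q → Constant c (a ∷ u)) →
      (Q → o (a ∷ u) ≡ j) →
    block-weight c (a ∷ u) ≈ when Q? (con 2^[ 1 - j ] ⊗ X c ↑ suc (length u))
  block-weight-≈ a u Q? j to from e = when-cong (constant? c (a ∷ u)) Q? to from
    (λ con → ≡⇒≈ (cong (λ j → Poly.con 2^[ 1 - j ] ⊗ X c ↑ suc (length u)) (e (to con))))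

  increasing-weight : Word n → Poly XZ
  increasing-weight u = when (increasing? u) (X c ↑ length u)

  -- This and the next five lemmas evaluate the weight of a block by the first one or two letters.
  -- The constants 2, 1 and ½ in them are 2^{1-o} for 0, 1 and 2 low letters.
  block-weight-descent : ∀ (a b : Letter n) u → High a → index b < index a → block-weight c
      (a ∷ b ∷ u) ≈ X c ⊗ block-weight c (b ∷ u)
  block-weight-descent a b u ha gt = begin
    block-weight c (a ∷ b ∷ u)
      ≈⟨ block-weight-≈ a (b ∷ u) (constant? c (b ∷ u)) (o (b ∷ u)) (proj₁ (constant-descent a b u gt))
         (proj₂ (constant-descent a b u gt)) (λ _ → o-high-∷ a (b ∷ u) ha) ⟩
    when (constant? c (b ∷ u)) (con 2^[ 1 - o (b ∷ u) ] ⊗ (X c ⊗ X c ↑ suc (length u)))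
      ≈⟨ when-congˡ (constant? c (b ∷ u)) (solve 3 (λ a b c → (a :* (b :* c)) := (b :* (a :* c))) ≈-refl _ (X c) _) ⟩
    when (constant? c (b ∷ u)) (X c ⊗ (con 2^[ 1 - o (b ∷ u) ] ⊗ X c ↑ suc (length u)))
      ≈⟨ when-⊗ (constant? c (b ∷ u)) ⟩
    X c ⊗ block-weight c (b ∷ u) ∎
    where open ≈-Reasoning

  block-weight-high : ∀ (a : Letter n) → High a → block-weight c (a ∷ []) ≈ con 2^[ 1 - 0 ] ⊗ X c
  block-weight-high a ha = ≈-trans
    (block-weight-≈ a [] (yes tt) 0 (λ _ → tt) (λ _ → tt) (λ _ → o-high (a ∷ []) (ha ∷ [])))
    (⊗-congˡ (⊗-identityʳ _))

  block-weight-low : ∀ (a : Letter n) → Low a → block-weight c (a ∷ []) ≈ X c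
  block-weight-low a la = ≈-trans
    (block-weight-≈ a [] (yes tt) 1 (λ _ → tt) (λ _ → tt) (λ _ → o-low-∷ a [] la))
    (≈-trans (⊗-identityˡ _) (⊗-identityʳ _))

  block-weight-ascent : ∀ (a b : Letter n) u → IsReduced (a ∷ b ∷ u) → High a → index a < index b →
    block-weight c (a ∷ b ∷ u) ≈ con 2^[ 1 - 0 ] ⊗ increasing-weight (a ∷ b ∷ u)
  block-weight-ascent a b u g ha lt = ≈-trans
    (block-weight-≈ a (b ∷ u) (increasing? (a ∷ b ∷ u)) 0
      (λ e → let l = constant-ascent⁻ a b u g lt e in lt ∷ l , ha ∷ high-linked a (b ∷ u) (1≤index a) (lt ∷ l))
      (λ { (_ ∷ l , _) → constant-ascent⁺ a b u l }) (λ (_ , hs) → o-high (a ∷ b ∷ u) hs))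
    (when-⊗ (increasing? (a ∷ b ∷ u)))

  block-weight-low-high : ∀ (a b : Letter n) u → IsReduced (a ∷ b ∷ u) → Low a → High b →
    block-weight c (a ∷ b ∷ u) ≈ X c ⊗ increasing-weight (b ∷ u)
  block-weight-low-high a b u g la hb = ≈-trans
    (block-weight-≈ a (b ∷ u) (increasing? (b ∷ u)) 1
      (λ e → let l = constant-ascent⁻ a b u g lt e in l , hb ∷ high-linked b u (1≤index b) l)
      (λ (l , _) → constant-ascent⁺ a b u l) (λ (_ , hs) → trans (o-low-∷ a (b ∷ u) la) (cong suc (o-high (b ∷ u) hs))))
    (≈-trans (when-congˡ (increasing? (b ∷ u)) (⊗-identityˡ _)) (when-⊗ (increasing? (b ∷ u))))
    where
    lt : index a < index b
    lt = subst (_< index b) (sym la) hb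

  block-weight-low-low : ∀ (a b : Letter (2 + m)) u → IsReduced (a ∷ b ∷ u) → Low a → Low b →
    block-weight c (a ∷ b ∷ u) ≈ (con ½ ⊗ (X c ⊗ X c)) ⊗ increasing-weight u
  block-weight-low-low a b u g la lb = ≈-trans
    (block-weight-≈ a (b ∷ u) (increasing? u) 2 (to u g) (from u) (λ (_ , hs) →
      trans (o-low-∷ a (b ∷ u) la) (cong suc (trans (o-low-∷ b u lb) (cong suc (o-high u hs))))))
    (≈-trans (when-congˡ (increasing? u)
        (solve 2 (λ t v → (:con ½ :* (t :* (t :* v))) := ((:con ½ :* (t :* t)) :* v)) ≈-refl (X c) _))
             (when-⊗ (increasing? u)))
    where
    b<d : ∀ d u → IsReduced (a ∷ b ∷ d ∷ u) → index b < index d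
    b<d d u g = subst (_< index d) (sym lb) (isReduced-high-third a b d u la lb g)
    to : ∀ u → IsReduced (a ∷ b ∷ u) → Constant c (a ∷ b ∷ u) → Increasing u
    to []      g e       = [] , []
    to (d ∷ u) g (_ , e) = let l = constant-ascent⁻ b d u (isReduced-tail a (b ∷ d ∷ u) g) (b<d d u g) e in
      l , isReduced-high-third a b d u la lb g ∷ high-linked d u (1≤index d) l
    from : ∀ u → Increasing u → Constant c (a ∷ b ∷ u)
    from []      _       = tt
    from (d ∷ u) (l , _) = (λ _ (lt , _) → ℕ.<-irrefl (trans la (sym lb)) lt) , constant-ascent⁺ b d u l

-- Γ-blocks

module Block (m : ℕ) {k : ℕ} (c : Fin k) where

  open import Data.List.Membership.DecPropositional (_≟ˡ_ {2 + m}) using (_∈?_)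

  high-letters : List (Fin m) → List (Letter (2 + m))
  high-letters = map (s ∘ suc)

  ∈-high-letters : ∀ {is a} → (∀ i → i ∈ is) → High a → a ∈ high-letters is
  ∈-high-letters {a = s zero}    all (s≤s ())
  ∈-high-letters {a = s (suc i)} all h = ∈-map⁺ (s ∘ suc) (all i)
  ∈-high-letters {a = ŝ}         all (s≤s ())

  high-letters-high : ∀ is → All High (high-letters is)
  high-letters-high is = All.map⁺ (All.universal (λ i → s≤s (s≤s z≤n)) is)

  factor : Letter (2 + m) → Factor (2 + m) XZ
  factor l = linear (l , X c)

  ascending : List (Factor (2 + m) XZ)
  ascending = map factor (high-letters (allFin m))

  block-factors : map boxFactor (Γ-boxes c) ≡ map factor (high-letters (reverse (allFin m))) ++ cornerFactor
      (X c) ∷ ascending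
  block-factors = trans (List.map-++ boxFactor (map (horizontal c) (reverse (allFin m)))
      (corner c ∷ map (vertical c) (allFin m)))
    (cong₂ (λ Fs Gs → Fs ++ cornerFactor (X c) ∷ Gs)
           (trans (sym (List.map-∘ (reverse (allFin m)))) (List.map-∘ (reverse (allFin m))))
           (trans (sym (List.map-∘ (allFin m))) (List.map-∘ (allFin m))))

  _<ⁱ?_ : (a b : Letter (2 + m)) → Dec (a <ⁱ b)
  a <ⁱ? b = index a ℕ.<? index b

  ascending-coefficient : ∀ u → coefficient ascending u ≈ increasing-weight c u
  ascending-coefficient u = ≈-trans
    (coefficient-chain _<ⁱ?_ ℕ.<-asym ls (AllPairs.map⁺ (AllPairs.map (λ lt → s≤s (s≤s lt)) (allFin-ascending m))) (X c) u)
    (when-cong (chain? _<ⁱ?_ ℕ.<-asym ls u) (increasing? u)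
      (λ (ap , ∈s) → AllPairs⇒Linked ap , All.map (All.lookup (high-letters-high (allFin m))) ∈s)
      (λ (l , hs) → Linked⇒AllPairs ℕ.<-trans l , All.map (∈-high-letters ∈-allFin) hs)
      (λ _ → ≈-refl))
    where
    ls : List (Letter (2 + m))
    ls = high-letters (allFin m)

  increasing-weight-[] : ∀ {n} → increasing-weight c {n} [] ≈ 𝟙
  increasing-weight-[] {n} = when-yes (increasing? {n} []) ([] , [])

  increasing-weight-no : ∀ {u : Word n} → ¬ Increasing u → increasing-weight c u ≈ 𝟘
  increasing-weight-no {u = u} = when-no (increasing? u)

  increasing-weight-∷ : ∀ (a b : Letter n) u → High a → index a < index b →
                        increasing-weight c (a ∷ b ∷ u) ≈ X c ⊗ increasing-weight c (b ∷ u)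
  increasing-weight-∷ a b u ha lt = ≈-trans
    (when-cong (increasing? (a ∷ b ∷ u)) (increasing? (b ∷ u))
      (λ { (_ ∷ l , _ ∷ hs) → l , hs }) (λ (l , hs) → lt ∷ l , ha ∷ hs) (λ _ → ≈-refl))
    (when-⊗ (increasing? (b ∷ u)))

  low⇒¬increasing : ∀ {a : Letter n} {u} → Low a → ¬ Increasing (a ∷ u)
  low⇒¬increasing {a = a} la (_ , ha ∷ _) = high⇒¬low {a = a} ha la

  -- The coefficients of the rest of the block when only the letters `ls` of the horizontal part are
  -- still to be read; this allows induction over the horizontal boxes.
  descending : List (Letter (2 + m)) → Word (2 + m) → Poly XZ
  descending ls = coefficient (map factor ls ++ cornerFactor (X c) ∷ ascending)

  private
    asc : Word (2 + m) → Poly XZ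
    asc = coefficient ascending

    half : Poly XZ
    half = con ½ ⊗ (X c ⊗ X c)

    strip-low : ∀ l a u (g : Word (2 + m) → Poly XZ) → High a → Low l → strip (l ∷ []) (a ∷ u) g ≈ 𝟘
    strip-low l a u g ha ll = when-no (a ≟ˡ l) (λ { refl → high⇒¬low {a = a} ha ll })

  corner-[] : descending [] [] ≈ 𝟙
  corner-[] = ≈-trans
    (solve 3 (λ a t h → (:con 1ℚ :* a :+ (t :* :con 0ℚ :+ (t :* :con 0ℚ :+ (h :* :con 0ℚ :+ (h :* :con 0ℚ :+ :con 0ℚ))))) :=
        a) ≈-refl (asc []) (X c) half)
    (≈-trans (ascending-coefficient []) (increasing-weight-[] {2 + m}))

  corner-high : ∀ a u → High a → descending [] (a ∷ u) ≈ increasing-weight c (a ∷ u)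
  corner-high a u ha = begin
    descending [] (a ∷ u)
      ≈⟨ ⊕-congˡ (⊕-cong (⊗-congˡ (no-strip (s zero) [] refl)) (⊕-cong (⊗-congˡ (no-strip ŝ [] refl))
         (⊕-cong (⊗-congˡ (no-strip (s zero) (ŝ ∷ []) refl)) (⊕-congʳ (⊗-congˡ (no-strip ŝ (s zero ∷ []) refl)))))) ⟩
    𝟙 ⊗ asc (a ∷ u) ⊕ (X c ⊗ 𝟘 ⊕ (X c ⊗ 𝟘 ⊕ (half ⊗ 𝟘 ⊕ (half ⊗ 𝟘 ⊕ 𝟘))))
      ≈⟨ solve 3 (λ a t h → (:con 1ℚ :* a :+ (t :* :con 0ℚ :+
         (t :* :con 0ℚ :+ (h :* :con 0ℚ :+ (h :* :con 0ℚ :+ :con 0ℚ))))) := a) ≈-refl (asc (a ∷ u)) (X c) half ⟩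
    asc (a ∷ u)
      ≈⟨ ascending-coefficient (a ∷ u) ⟩
    increasing-weight c (a ∷ u) ∎
    where
    open ≈-Reasoning
    no-strip : ∀ l v → Low l → strip (l ∷ v) (a ∷ u) asc ≈ 𝟘
    no-strip l v ll = when-no (a ≟ˡ l) (λ { refl → high⇒¬low {a = a} ha ll })

  -- The vertical part has no low letters, so `a` comes from the corner, either alone or followed by
  -- the other low letter.
  corner-low : ∀ a u → Low a → descending [] (a ∷ u) ≈ X c ⊗ asc u ⊕ half ⊗ strip (twin a ∷ []) u asc
  corner-low (s zero) u la = ≈-trans
    (⊕-congʳ (⊗-congˡ (≈-trans (ascending-coefficient (s zero ∷ u))
        (increasing-weight-no (low⇒¬increasing {a = s {suc m} zero} refl)))))
    (solve 4 (λ a t h b → (:con 1ℚ :* :con 0ℚ :+ (t :* a :+ (t :* :con 0ℚ :+ (h :* b :+ (h :* :con 0ℚ :+ :con 0ℚ))))) :=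
        (t :* a :+ h :* b)) ≈-refl (asc u) (X c) half _)
  corner-low ŝ u la = ≈-trans
    (⊕-congʳ (⊗-congˡ (≈-trans (ascending-coefficient (ŝ ∷ u)) (increasing-weight-no (low⇒¬increasing {a = ŝ {m}} refl)))))
    (solve 4 (λ a t h b → (:con 1ℚ :* :con 0ℚ :+ (t :* :con 0ℚ :+ (t :* a :+ (h :* :con 0ℚ :+ (h :* b :+ :con 0ℚ))))) :=
        (t :* a :+ h :* b)) ≈-refl (asc u) (X c) half _)

  corner-block : ∀ a u → IsReduced (a ∷ u) → Low a → descending [] (a ∷ u) ≈ block-weight c (a ∷ u)
  corner-block a [] g la = begin
    descending [] (a ∷ [])        ≈⟨ corner-low a [] la ⟩
    X c ⊗ asc [] ⊕ half ⊗ 𝟘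
      ≈⟨ ⊕-congʳ (⊗-congˡ (≈-trans (ascending-coefficient []) (increasing-weight-[] {2 + m}))) ⟩
    X c ⊗ 𝟙 ⊕ half ⊗ 𝟘            ≈⟨ solve 2 (λ t h → (t :* :con 1ℚ :+ h :* :con 0ℚ) := t) ≈-refl (X c) half ⟩
    X c                           ≈⟨ block-weight-low c a la ⟨
    block-weight c (a ∷ []) ∎
    where open ≈-Reasoning
  corner-block a (b ∷ u) g la = ≈-trans (corner-low a (b ∷ u) la) (by-second (low? b))
    where
    open ≈-Reasoning
    by-second : Low b ⊎ High b → X c ⊗ asc (b ∷ u) ⊕ half ⊗ strip (twin a ∷ []) (b ∷ u) asc ≈ block-weight c (a ∷ b ∷ u)
    by-second (inj₂ hb) = begin
      X c ⊗ asc (b ∷ u) ⊕ half ⊗ strip (twin a ∷ []) (b ∷ u) asc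
        ≈⟨ ⊕-cong (⊗-congˡ (ascending-coefficient (b ∷ u))) (⊗-congˡ (strip-low (twin a) b u asc hb (low-twin a))) ⟩
      X c ⊗ increasing-weight c (b ∷ u) ⊕ half ⊗ 𝟘
        ≈⟨ ≈-trans (⊕-congˡ (⊗-zeroʳ half)) (⊕-identityʳ _) ⟩
      X c ⊗ increasing-weight c (b ∷ u)
        ≈⟨ block-weight-low-high c a b u g la hb ⟨
      block-weight c (a ∷ b ∷ u) ∎
      where
      low-twin : ∀ a → Low (twin {m} a)
      low-twin (s _) = refl
      low-twin ŝ     = refl
    by-second (inj₁ lb) = begin
      X c ⊗ asc (b ∷ u) ⊕ half ⊗ strip (twin a ∷ []) (b ∷ u) asc
        ≈⟨ ⊕-cong (⊗-congˡ (≈-trans (ascending-coefficient (b ∷ u)) (increasing-weight-no (low⇒¬increasing {a = b} lb))))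
                  (⊗-congˡ (≈-trans (when-yes (b ≟ˡ twin a) (low-other la lb (isReduced-≢ a b u g)))
                      (ascending-coefficient u))) ⟩
      X c ⊗ 𝟘 ⊕ half ⊗ increasing-weight c u
        ≈⟨ ≈-trans (⊕-congʳ (⊗-zeroʳ (X c))) (⊕-identityˡ _) ⟩
      half ⊗ increasing-weight c u
        ≈⟨ block-weight-low-low c a b u g la lb ⟨
      block-weight c (a ∷ b ∷ u) ∎

  -- ls is a final segment of the high letters in descending order.
  record Segment (ls : List (Letter (2 + m))) : Set where
    field
      sorted : AllPairs _>ⁱ_ ls
      high   : All High ls
      above  : ∀ {a} → High a → a ∉ ls → All (_<ⁱ a) ls

  segment-tail : ∀ {l ls} → Segment (l ∷ ls) → Segment ls
  segment-tail {l} {ls} seg = record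
    { sorted = AllPairs.tail sorted
    ; high   = All.tail high
    ; above  = λ {a} ha a∉ → by-head ha a∉ (a ≟ˡ l) }
    where
    open Segment seg
    by-head : ∀ {a} → High a → a ∉ ls → Dec (a ≡ l) → All (_<ⁱ a) ls
    by-head ha a∉ (yes refl) = AllPairs.head sorted
    by-head ha a∉ (no ne)    = All.tail (above ha λ { (here e) → ne e ; (there a∈) → a∉ a∈ })

  descending-[] : ∀ ls → descending ls [] ≈ 𝟙
  descending-[] []       = corner-[]
  descending-[] (l ∷ ls) = ≈-trans (coefficient-linear-[] l (X c) (map factor ls ++ cornerFactor (X c) ∷ ascending))
      (descending-[] ls)

  -- A first letter in `ls` comes from its horizontal box or from the vertical part, and in the
  -- latter case the whole word rises. If the next letter is smaller, the second case contributes
  -- nothing; if there is none or it is larger, the two cases contribute equally, which gives the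
  -- factor 2.
  descending-block : ∀ ls → Segment ls → ∀ a u → IsReduced (a ∷ u) → Low a ⊎ a ∈ ls → descending ls (a ∷ u) ≈ block-weight c
      (a ∷ u)
  -- A high first letter that the remaining horizontal boxes do not offer is not in the corner
  -- either, so the whole word is read from the vertical part.
  descending-increasing : ∀ ls → Segment ls → ∀ a u → IsReduced (a ∷ u) → High a → a ∉ ls → descending ls
      (a ∷ u) ≈ increasing-weight c (a ∷ u)

  private
    skip : ∀ l ls a u → a ≢ l → descending (l ∷ ls) (a ∷ u) ≈ descending ls (a ∷ u)
    skip l ls a u ne = ≈-trans (coefficient-linear-∷ l (X c) (map factor ls ++ cornerFactor (X c) ∷ ascending) a u)
      (≈-trans (⊕-congˡ (≈-trans (⊗-congˡ (when-no (a ≟ˡ l) ne)) (⊗-zeroʳ (X c)))) (⊕-identityʳ _))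

    take : ∀ ls → ∀ a u → descending (a ∷ ls) (a ∷ u) ≈ descending ls (a ∷ u) ⊕ X c ⊗ descending ls u
    take ls a u = ≈-trans (coefficient-linear-∷ a (X c) (map factor ls ++ cornerFactor (X c) ∷ ascending) a u)
      (⊕-congˡ (⊗-congˡ (when-yes (a ≟ˡ a) refl)))

  descending-increasing []       seg a u g ha a∉ = corner-high a u ha
  descending-increasing (l ∷ ls) seg a u g ha a∉ = ≈-trans (skip l ls a u (a∉ ∘ here))
    (descending-increasing ls (segment-tail seg) a u g ha (a∉ ∘ there))

  descending-block []       seg a u g (inj₁ la) = corner-block a u g la
  descending-block (l ∷ ls) seg a u g (inj₁ la) =
    ≈-trans (skip l ls a u λ { refl → high⇒¬low {a = a} (All.head (Segment.high seg)) la })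
        (descending-block ls (segment-tail seg) a u g (inj₁ la))
  descending-block (l ∷ ls) seg a u g (inj₂ (there a∈)) =
    ≈-trans (skip l ls a u λ { refl → ℕ.<-irrefl refl (All.lookup (AllPairs.head (Segment.sorted seg)) a∈) })
        (descending-block ls (segment-tail seg) a u g (inj₂ a∈))
  descending-block (a ∷ ls) seg .a u g (inj₂ (here refl)) = ≈-trans (take ls a u)
    (≈-trans (⊕-congʳ (descending-increasing ls (segment-tail seg) a u g ha a∉)) (by-rest u g))
    where
    ha : High a
    ha = All.head (Segment.high seg)
    a∉ : a ∉ ls
    a∉ a∈ = ℕ.<-irrefl refl (All.lookup (AllPairs.head (Segment.sorted seg)) a∈)
    open ≈-Reasoning
    by-rest : ∀ u → IsReduced (a ∷ u) → increasing-weight c (a ∷ u) ⊕ X c ⊗ descending ls u ≈ block-weight c (a ∷ u)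
    by-rest [] g = begin
      increasing-weight c (a ∷ []) ⊕ X c ⊗ descending ls []
        ≈⟨ ⊕-cong (when-yes (increasing? (a ∷ [])) ([-] , ha ∷ [])) (⊗-congˡ (descending-[] ls)) ⟩
      X c ⊗ 𝟙 ⊕ X c ⊗ 𝟙
        ≈⟨ solve 1 (λ t → (t :* :con 1ℚ :+ t :* :con 1ℚ) := (:con 2^[ 1 - 0 ] :* t)) ≈-refl (X c) ⟩
      con 2^[ 1 - 0 ] ⊗ X c
        ≈⟨ block-weight-high c a ha ⟨
      block-weight c (a ∷ []) ∎
    by-rest (b ∷ u) g = by-second (low? b) (b ∈? ls)
      where
      g′ : IsReduced (b ∷ u)
      g′ = isReduced-tail a (b ∷ u) g
      smaller : index b < index a → descending ls (b ∷ u) ≈ block-weight c (b ∷ u) →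
                increasing-weight c (a ∷ b ∷ u) ⊕ X c ⊗ descending ls (b ∷ u) ≈ block-weight c (a ∷ b ∷ u)
      smaller gt e = begin
        increasing-weight c (a ∷ b ∷ u) ⊕ X c ⊗ descending ls (b ∷ u)
          ≈⟨ ⊕-cong (increasing-weight-no {u = a ∷ b ∷ u} λ { (lt ∷ _ , _) → ℕ.<-asym lt gt }) (⊗-congˡ e) ⟩
        𝟘 ⊕ X c ⊗ block-weight c (b ∷ u)
          ≈⟨ ⊕-identityˡ _ ⟩
        X c ⊗ block-weight c (b ∷ u)
          ≈⟨ block-weight-descent c a b u ha gt ⟨
        block-weight c (a ∷ b ∷ u) ∎
      larger : index a < index b → descending ls (b ∷ u) ≈ increasing-weight c (b ∷ u) →
               increasing-weight c (a ∷ b ∷ u) ⊕ X c ⊗ descending ls (b ∷ u) ≈ block-weight c (a ∷ b ∷ u)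
      larger lt e = begin
        increasing-weight c (a ∷ b ∷ u) ⊕ X c ⊗ descending ls (b ∷ u)
          ≈⟨ ⊕-congˡ (≈-trans (⊗-congˡ e) (≈-sym (increasing-weight-∷ a b u ha lt))) ⟩
        increasing-weight c (a ∷ b ∷ u) ⊕ increasing-weight c (a ∷ b ∷ u)
          ≈⟨ solve 1 (λ t → (t :+ t) := (:con 2^[ 1 - 0 ] :* t)) ≈-refl _ ⟩
        con 2^[ 1 - 0 ] ⊗ increasing-weight c (a ∷ b ∷ u)
          ≈⟨ block-weight-ascent c a b u g ha lt ⟨
        block-weight c (a ∷ b ∷ u) ∎
      by-second : Low b ⊎ High b → Dec (b ∈ ls) →
                  increasing-weight c (a ∷ b ∷ u) ⊕ X c ⊗ descending ls (b ∷ u) ≈ block-weight c (a ∷ b ∷ u)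
      by-second (inj₁ lb) _ = smaller (subst (_< index a) (sym lb) ha)
          (descending-block ls (segment-tail seg) b u g′ (inj₁ lb))
      by-second (inj₂ hb) (yes b∈) = smaller (All.lookup (AllPairs.head (Segment.sorted seg)) b∈)
          (descending-block ls (segment-tail seg) b u g′ (inj₂ b∈))
      -- Besides `ls`, `b` also avoids `a` because the word is reduced; by the segment property it
      -- then lies above `a`.
      by-second (inj₂ hb) (no b∉) = larger
        (All.head (Segment.above seg hb λ { (here e) → isReduced-≢ a b u g (sym e) ; (there b∈) → b∉ b∈ }))
        (descending-increasing ls (segment-tail seg) b u g′ hb b∉)

  block-coefficient : ∀ u → IsReduced u → coefficient (map boxFactor (Γ-boxes c)) u ≈ block-weight c u
  block-coefficient u g = ≈-trans (≡⇒≈ (cong (λ Fs → coefficient Fs u) block-factors)) (by-word u g)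
    where
    ls : List (Letter (2 + m))
    ls = high-letters (reverse (allFin m))
    all∈ : ∀ {a} → High a → a ∈ ls
    all∈ = ∈-high-letters ∈-reverse-allFin
    segment : Segment ls
    segment = record
      { sorted = AllPairs.map⁺ (AllPairs.map (λ gt → s≤s (s≤s gt)) (reverse-allFin-descending m))
      ; high   = high-letters-high (reverse (allFin m))
      ; above  = λ ha a∉ → ⊥-elim (a∉ (all∈ ha)) }
    low-or-in : ∀ {a} → Low a ⊎ High a → Low a ⊎ a ∈ ls
    low-or-in (inj₁ la) = inj₁ la
    low-or-in (inj₂ ha) = inj₂ (all∈ ha)
    by-word : ∀ u → IsReduced u → descending ls u ≈ block-weight c u
    by-word []      g = ≈-trans (descending-[] ls) (≈-sym (≈-trans (when-yes (constant? c {2 + m} []) tt) (⊗-identityˡ 𝟙)))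
    by-word (a ∷ u) g = descending-block ls segment a u g (low-or-in (low? a))

-- The letters read from the block c are those with index c in the sequence. Both sides are sums
-- over the same cuts, and each piece of a reduced word is reduced, as the comparison within a block
-- requires.
blocks-coefficient : ∀ (cs : List (Fin k)) → AllPairs Fin._>_ cs → ∀ a → IsReduced a →
  coefficient (map boxFactor (concatMap (Γ-boxes {m = m}) cs)) a ≈ monotoneSum cs (length a) (X-weight a)
blocks-coefficient {k} {m} [] _ []      g = ≈-sym
    (≈-trans (when-yes (noForbiddenPeak? {k} {2 + m} [] []) tt) (⊗-identityˡ 𝟙))
blocks-coefficient []       _ (_ ∷ _) g = ≈-refl
blocks-coefficient {m = m} (c ∷ cs) (c> ∷ sorted) a g = begin
  coefficient (map boxFactor (concatMap (Γ-boxes {m = m}) (c ∷ cs))) a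
    ≡⟨ cong (λ Fs → coefficient Fs a) (List.map-++ boxFactor (Γ-boxes {m = m} c) (concatMap Γ-boxes cs)) ⟩
  coefficient (map boxFactor (Γ-boxes c) ++ rest) a
    ≈⟨ coefficient-++ (map boxFactor (Γ-boxes c)) rest a ⟩
  splitSum a (λ u v → coefficient (map boxFactor (Γ-boxes c)) u ⊗ coefficient rest v)
    ≈⟨ splitSum-cong a (λ u v e → split u v e (isReduced-++ u v (subst IsReduced (sym e) g))) ⟩
  splitSum a (λ u v → monotoneSum cs (length v) (λ js → X-weight a (replicate (length u) c ++ js)))
    ≈⟨ monotoneSum-split c cs a ⟨
  monotoneSum (c ∷ cs) (length a) (X-weight a) ∎
  where
  open ≈-Reasoning
  rest : List (Factor (2 + m) XZ)
  rest = map boxFactor (concatMap (Γ-boxes {m = m}) cs)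
  c∉ : All (c ≢_) cs
  c∉ = All.map (λ { gt refl → ℕ.<-irrefl refl gt }) c>
  split : ∀ u v → u ++ v ≡ a → IsReduced u × IsReduced v → coefficient (map boxFactor (Γ-boxes c)) u ⊗ coefficient rest v ≈
          monotoneSum cs (length v) (λ js → X-weight a (replicate (length u) c ++ js))
  split u v refl (gu , gv) = begin
    coefficient (map boxFactor (Γ-boxes c)) u ⊗ coefficient rest v
      ≈⟨ ⊗-cong (Block.block-coefficient m c u gu) (blocks-coefficient {m = m} cs sorted v gv) ⟩
    block-weight c u ⊗ monotoneSum cs (length v) (X-weight v)
      ≈⟨ monotoneSum-⊗ cs (length v) (block-weight c u) ⟨
    monotoneSum cs (length v) (λ js → block-weight c u ⊗ X-weight v js)
      ≈⟨ monotoneSum-cong cs c∉ (length v) (λ js c∉js _ → X-weight-split c u v js c∉js) ⟨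
    monotoneSum cs (length v) (λ js → X-weight (u ++ v) (replicate (length u) c ++ js)) ∎

-- Assembly of the middle sum and the theorem

X-coefficient-≈ : ∀ k (u : 𝒟 (2 + m)) a → IsReducedWordOf u a → X-coefficient k a ≈ coefficient (Γ-factors m k) a
X-coefficient-≈ k u a (e , l) = ≈-trans (X-monotone a)
  (≈-sym (blocks-coefficient (reverse (allFin k)) (reverse-allFin-descending k) a (refl , trans l (cong ℓ (sym e)))))

stair-plain : ∀ m k → All (Plain ∘ proj₁) (concatMap boxLetters (concatMap (stair-row {m = m} {k}) (allFin (suc m))))
stair-plain m k = rows (allFin (suc m))
  where
  row : ∀ i (js : List (Fin (suc m ∸ toℕ i))) → All (Plain ∘ proj₁) (concatMap boxLetters (map (stair {m} {k} i) js))
  row i []       = []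
  row i (j ∷ js) = plain _ ∷ row i js
  rows : ∀ is → All (Plain ∘ proj₁) (concatMap boxLetters (concatMap (stair-row {m = m} {k}) is))
  rows []       = []
  rows (i ∷ is) = subst (All (Plain ∘ proj₁))
      (sym (List.concatMap-++ boxLetters (stair-row {m = m} {k} i) (concatMap stair-row is)))
    (All.++⁺ (row i (reverse (allFin (suc m ∸ toℕ i)))) (rows is))

-- The staircase contains no ŝ, so its words represent elements of 𝒮ₙ only. Hence the sum over all
-- factorisations given by `apply-factorisations` reduces to those with v in 𝒮ₙ.
stair-vanishes : ∀ k (v : 𝒟 (2 + m)) → ¬ 𝒮 v → apply (stair-factors m k) (reduced v) ≈ 𝟘
stair-vanishes {m} k v v∉ = ≈-trans
  (apply-boxFactor (concatMap (stair-row {m = m} {k}) (allFin (suc m))) (reduced v) (reduced-commutes v))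
  (apply-plain (concatMap boxLetters (concatMap (stair-row {m = m} {k}) (allFin (suc m)))) (stair-plain m k) (reduced v)
    λ a ps → when-no (reduced? v a) λ (e , _) → v∉ (subst 𝒮 e (plain-word⇒𝒮 a ps)))

factorisationSum-≈ : ∀ k (w : 𝒟 (2 + m)) → factorisationSum k w ≈ apply (map linear (concatMap boxLetters (base m k)))
    (reduced w)
factorisationSum-≈ {m} k w = begin
  factorisationSum k w
    ≈⟨ ∑-cong (factorisations w) (λ (u , v) → separate u v) ⟩
  ∑ (factorisations w) (λ (u , v) → ∑ (R u) (X-coefficient k) ⊗ ∑ (R v) Z-coefficient)
    ≈⟨ ∑-filter factorisation? (cartesianProduct (elements (2 + m)) (elements (2 + m))) ⟩
  ∑ (cartesianProduct (elements (2 + m)) (elements (2 + m))) (λ (u , v) →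
    when (factorisation? (u , v)) (∑ (R u) (X-coefficient k) ⊗ ∑ (R v) Z-coefficient))
    ≈⟨ ∑-cong (cartesianProduct (elements (2 + m)) (elements (2 + m))) (λ (u , v) → term u v) ⟩
  ∑ (cartesianProduct (elements (2 + m)) (elements (2 + m))) (λ (u , v) → when (splits? w u v) (Γ-part u ⊗ stair-part v))
    ≈⟨ ∑-cartesianProductWith _,_ (elements (2 + m)) (elements (2 + m)) ⟩
  ∑ (elements (2 + m)) (λ u → ∑ (elements (2 + m)) λ v → when (splits? w u v) (Γ-part u ⊗ stair-part v))
    ≈⟨ apply-factorisations (Γ-factors m k) (stair-factors m k) w ⟨
  apply (Γ-factors m k ++ stair-factors m k) (reduced w)
    ≡⟨ cong (λ Fs → apply Fs (reduced w))
       (List.map-++ boxFactor (concatMap Γ-boxes (reverse (allFin k))) (concatMap stair-row (allFin (suc m)))) ⟨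
  apply (map boxFactor (base m k)) (reduced w)
    ≈⟨ apply-boxFactor (base m k) (reduced w) (reduced-commutes w) ⟩
  apply (map linear (concatMap boxLetters (base m k))) (reduced w) ∎
  where
  open ≈-Reasoning
  Γ-part stair-part : 𝒟 (2 + m) → Poly XZ
  Γ-part u     = apply (Γ-factors m k) (reduced u)
  stair-part v = apply (stair-factors m k) (reduced v)
  𝒮? : (v : 𝒟 (2 + m)) → Dec (𝒮 v)
  𝒮? v = Fin.all? (λ i → proj₁ (v ⟨ Sign.+ , i ⟩) Sign.≟ Sign.+)
  factorisation? : (uv : 𝒟 (2 + m) × 𝒟 (2 + m)) → Dec _
  factorisation? (u , v) = ((u ∙ v) ≟𝒟 w) ×-dec ((ℓ u + ℓ v) ℕ.≟ ℓ w) ×-dec 𝒮? v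
  separate : ∀ u v →
    ∑ (R u) (λ a → ∑ (𝒜x k a) λ α → ∑ (R v) λ b → ∑ (𝒜z b) λ β → con 2^[ variableCount α - o a ] ⊗ (x^ α ⊗ z^ β)) ≈
    ∑ (R u) (X-coefficient k) ⊗ ∑ (R v) Z-coefficient
  separate u v = ≈-trans
    (∑-cong (R u) λ a → ≈-trans
      (∑-cong (𝒜x k a) λ α → ≈-trans
        (∑-cong (R v) λ b → ≈-trans
          (∑-cong (𝒜z b) λ β → ≈-sym (⊗-assoc _ _ _))
          (≈-sym (∑-⊗ˡ (𝒜z b) (con 2^[ variableCount α - o a ] ⊗ x^ α))))
        (≈-sym (∑-⊗ˡ (R v) (con 2^[ variableCount α - o a ] ⊗ x^ α))))
      (≈-sym (∑-⊗ʳ (𝒜x k a) (∑ (R v) Z-coefficient))))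
    (≈-sym (∑-⊗ʳ (R u) (∑ (R v) Z-coefficient)))
  term : ∀ u v → when (factorisation? (u , v)) (∑ (R u) (X-coefficient k) ⊗ ∑ (R v) Z-coefficient) ≈
                 when (splits? w u v) (Γ-part u ⊗ stair-part v)
  term u v = by-𝒮 (𝒮? v)
    where
    by-𝒮 : (d : Dec (𝒮 v)) → when (((u ∙ v) ≟𝒟 w) ×-dec ((ℓ u + ℓ v) ℕ.≟ ℓ w) ×-dec d)
        (∑ (R u) (X-coefficient k) ⊗ ∑ (R v) Z-coefficient) ≈
                              when (splits? w u v) (Γ-part u ⊗ stair-part v)
    by-𝒮 (yes v∈) = when-cong (((u ∙ v) ≟𝒟 w) ×-dec ((ℓ u + ℓ v) ℕ.≟ ℓ w) ×-dec yes v∈) (splits? w u v)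
      (λ (e , l , _) → e , l) (λ (e , l) → e , l , v∈)
      (λ _ → ⊗-cong (R-sum (Γ-factors m k) u (X-coefficient k) (X-coefficient-≈ k u))
                    (R-sum (stair-factors m k) v Z-coefficient (λ b red → Z-coefficient-≈ k b (𝒮⇒plain-word v b v∈ red))))
    by-𝒮 (no v∉) = ≈-trans
      (when-no (((u ∙ v) ≟𝒟 w) ×-dec ((ℓ u + ℓ v) ℕ.≟ ℓ w) ×-dec no v∉) (λ (_ , _ , v∈) → v∉ v∈))
      (≈-sym (when-zero (splits? w u v) (≈-trans (⊗-congˡ (stair-vanishes k v v∉)) (⊗-zeroʳ _))))

theorem3p11 : (m k : ℕ) (w : 𝒟 (2 + m))
    (𝔇 : ∀ {n} → 𝒟 n → Poly ZP) → IsSchubertFamily 𝔇 →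
    pipeDreamSum k w ≈ factorisationSum k w
    × factorisationSum k w ≈ truncate k (𝔇 w)
theorem3p11 m k w 𝔇 fam =
  ≈-trans (pipeDreamSum-≈ k w) (≈-sym (factorisationSum-≈ k w)) ,
  ≈-trans (factorisationSum-≈ k w) (≈-sym (Truncation.truncate-≈ 𝔇 fam m k w))
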